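{- Let $p=\lfloor\frac{n-3-2l}{l+1}\rfloor$. Then the poset $(\mathcal{U}_{n,l}^{3},\preceq)$ has exactly $p+1$ minimal elements, namely $U_{n,l}^{3,0},U_{n,l}^{3,1},\dots,U_{n,l}^{3,p}$.
   Context: For a graph $G$ on $n$ vertices with Laplacian matrix $L(G)=D(G)-A(G)$, write $\det(\lambda I_n-L(G))=\sum_{k=0}^n(-1)^k c_k(G)\lambda^{n-k}$. For graphs $G,H$ of order $n$, $G\preceq H$ means $c_k(G)\le c_k(H)$ for all $0\le k\le n$, and $G\prec H$ means $G\preceq H$ and $c_k(G)<c_k(H)$ for some $k$. A minimal element of a set of graphs (up to isomorphism) is a graph $G$ in it with no $H$ in the set satisfying $H\prec G$. A leaf is a vertex of degree $1$. $\mathcal{U}_{n,l}^g$ is the set of connected unicyclic graphs with $n$ vertices, exactly $l$ leaves and girth $g$. The balanced starlike tree $BST_{m,l}$ is the tree of order $m$ with $l$ leaves obtained by identifying one end of each of $l$ paths, each of order $\lfloor\frac{m-1}{l}\rfloor+1$ or $\lceil\frac{m-1}{l}\rceil+1$, into a single vertex (its center). $U_{n,l}^{g,q}$ ($q\ge0$) is obtained from the cycle $C_g$ and a path $w_0w_1\cdots w_q$ by identifying $w_0$ with a cycle vertex and $w_q$ with the center of $BST_{n-q-g+1,l}$ (for $q=0$ the center is identified with the cycle vertex).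
   Formalization: Assumes l ≥ 2 and n ≥ 2l+3: for l = 1, n ≥ 7 all the listed graphs are isomorphic, so "exactly p+1" fails, and for l+3 ≤ n ≤ 2l+2 one gets p = −1 although the set is nonempty. -}

module Defs where

open import Data.Bool using (Bool; true; false; _∧_; _∨_; not; if_then_else_)
open import Data.Nat as ℕ using (ℕ; zero; suc; _∸_; _≤ᵇ_; _<ᵇ_; _≡ᵇ_; _⊓_; NonZero)
open import Data.Nat.DivMod using (_/_; _%_)
open import Data.Integer as ℤ using (ℤ; +_; -_)
open import Data.Fin using (Fin; toℕ; punchIn)
open import Data.List using (List; []; _∷_; upTo)
open import Data.Bool.ListAction using (any)
open import Data.Product using (Σ; _×_; ∃; ∃-syntax)
open import Data.Sum using (_⊎_)
open import Relation.Binary.PropositionalEquality using (_≡_)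
open import Relation.Nullary using (¬_)
open import Function.Bundles using (_↔_; Inverse)
open import Function.Definitions using (Injective)

Graph : ℕ → Set
Graph n = Fin n → Fin n → Bool

IsSimple : ∀ {n} → Graph n → Set
IsSimple {n} G = (∀ i j → G i j ≡ G j i) × (∀ i → G i i ≡ false)

countF : ∀ {m} → (Fin m → Bool) → ℕ
countF {zero} f = 0
countF {suc m} f = (if f Fin.zero then 1 else 0) ℕ.+ countF (λ i → f (Fin.suc i))

degree : ∀ {n} → Graph n → Fin n → ℕ
degree G i = countF (G i)

numEdges : ∀ {n} → Graph n → ℕ
numEdges {n} G = sumF (λ i → countF (λ j → G i j ∧ (toℕ i <ᵇ toℕ j)))
  where
  sumF : ∀ {m} → (Fin m → ℕ) → ℕ
  sumF {zero} f = 0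
  sumF {suc m} f = f Fin.zero ℕ.+ sumF (λ i → f (Fin.suc i))

numLeaves : ∀ {n} → Graph n → ℕ
numLeaves G = countF (λ i → degree G i ≡ᵇ 1)

data Reach {n} (G : Graph n) : Fin n → Fin n → Set where
  here : ∀ {i} → Reach G i i
  step : ∀ {i j k} → G i j ≡ true → Reach G j k → Reach G i k

Connected : ∀ {n} → Graph n → Set
Connected G = ∀ i j → Reach G i j

IsCycle : ∀ {n} → Graph n → (m : ℕ) → (Fin m → Fin n) → Set
IsCycle {n} G m f =
  (3 ℕ.≤ m) × Injective _≡_ _≡_ f ×
  (∀ (i j : Fin m) →
     (toℕ j ≡ suc (toℕ i) ⊎ (suc (toℕ i) ≡ m × toℕ j ≡ 0)) →
     G (f i) (f j) ≡ true)

HasCycleOfLength : ∀ {n} → Graph n → ℕ → Set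
HasCycleOfLength {n} G m = Σ (Fin m → Fin n) (IsCycle G m)

HasGirth : ∀ {n} → Graph n → ℕ → Set
HasGirth G g = HasCycleOfLength G g × (∀ m → HasCycleOfLength G m → g ℕ.≤ m)

-- the set U_{n,l}^g: connected unicyclic (connected with n edges) graphs
-- with n vertices, exactly l leaves, girth g
𝒰 : (n l g : ℕ) → Graph n → Set
𝒰 n l g G =
  IsSimple G × Connected G × numEdges G ≡ n × numLeaves G ≡ l × HasGirth G g

Iso : ∀ {n} → Graph n → Graph n → Set
Iso {n} G H = Σ (Fin n ↔ Fin n) λ σ →
  ∀ i j → H (Inverse.to σ i) (Inverse.to σ j) ≡ G i j

-- Polynomials over ℤ as coefficient lists (constant term first).

Poly : Set
Poly = List ℤ

_+P_ : Poly → Poly → Poly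
[] +P q = q
(a ∷ p) +P [] = a ∷ p
(a ∷ p) +P (b ∷ q) = (a ℤ.+ b) ∷ (p +P q)

negP : Poly → Poly
negP [] = []
negP (a ∷ p) = (- a) ∷ negP p

scaleP : ℤ → Poly → Poly
scaleP a [] = []
scaleP a (b ∷ q) = (a ℤ.* b) ∷ scaleP a q

_*P_ : Poly → Poly → Poly
[] *P q = []
(a ∷ p) *P q = scaleP a q +P (+ 0 ∷ (p *P q))

coeff : ℕ → Poly → ℤ
coeff k [] = + 0
coeff zero (a ∷ p) = a
coeff (suc k) (a ∷ p) = coeff k p

altSum : ∀ {m} → (Fin m → Poly) → Poly
altSum {zero} f = []
altSum {suc m} f = f Fin.zero +P negP (altSum (λ i → f (Fin.suc i)))

det : ∀ m → (Fin m → Fin m → Poly) → Poly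
det zero M = + 1 ∷ []
det (suc m) M =
  altSum (λ j → M Fin.zero j *P det m (λ i k → M (Fin.suc i) (punchIn j k)))

-- the matrix λ I - L(G), L = D - A, with entries in ℤ[λ]
charMatrix : ∀ {n} → Graph n → Fin n → Fin n → Poly
charMatrix G i j with toℕ i ≡ᵇ toℕ j
... | true  = (- (+ degree G i)) ∷ + 1 ∷ []
... | false = if G i j then (+ 1 ∷ []) else []

laplacianCharPoly : ∀ {n} → Graph n → Poly
laplacianCharPoly {n} G = det n (charMatrix G)

-- det(λI - L(G)) = Σ_k (-1)^k c_k(G) λ^{n-k}
c : ∀ {n} → ℕ → Graph n → ℤ
c {n} k G = ((- + 1) ℤ.^ k) ℤ.* coeff (n ∸ k) (laplacianCharPoly G)

_⪯_ : ∀ {n} → Graph n → Graph n → Set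
_⪯_ {n} G H = ∀ k → k ℕ.≤ n → c k G ℤ.≤ c k H

_≺_ : ∀ {n} → Graph n → Graph n → Set
_≺_ {n} G H = G ⪯ H × ∃[ k ] (k ℕ.≤ n × c k G ℤ.< c k H)

Minimal : ∀ {n} → (Graph n → Set) → Graph n → Set
Minimal {n} S G = S G × (∀ H → S H → ¬ (H ≺ G))

-- The graph U_{n,l}^{3,q}.
-- Labels: triangle 0,1,2; path w_0 = 0, w_j = j+2 (1 ≤ j ≤ q);
-- centre ctr = w_q; the remaining n-q-3 vertices q+3,...,n-1 form the
-- l legs of BST_{n-q-2,l}; leg i (i < l) consists of the consecutive
-- labels start i, ..., start i + len i - 1, where with
-- d = (n-q-3) div l, r = (n-q-3) mod l, leg i has d+1 vertices if i < r
-- and d vertices otherwise.  Every label v ≥ 3 has a parent.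

module U-construction (n l : ℕ) .{{_ : NonZero l}} (q : ℕ) where
  d r ctr : ℕ
  d = (n ∸ (q ℕ.+ 3)) / l
  r = (n ∸ (q ℕ.+ 3)) % l
  ctr = if q ≡ᵇ 0 then 0 else q ℕ.+ 2

  start : ℕ → ℕ
  start i = q ℕ.+ 3 ℕ.+ i ℕ.* d ℕ.+ (i ⊓ r)

  isStart : ℕ → Bool
  isStart v = any (λ i → start i ≡ᵇ v) (upTo l)

  parent : ℕ → ℕ
  parent v = if isStart v then ctr else (if v ≡ᵇ 3 then 0 else v ∸ 1)

  adjℕ : ℕ → ℕ → Bool
  adjℕ a b = ((a <ᵇ 3) ∧ (b <ᵇ 3) ∧ not (a ≡ᵇ b))
           ∨ ((3 ≤ᵇ a) ∧ (parent a ≡ᵇ b))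
           ∨ ((3 ≤ᵇ b) ∧ (parent b ≡ᵇ a))

U : (n l : ℕ) .{{_ : NonZero l}} → ℕ → Graph n
U n l q i j = U-construction.adjℕ n l q (toℕ i) (toℕ j)

{-# OPTIONS --safe #-}
-- The coefficient c_k is the coefficient of x^(n-k) in det (x I + L).  Cutting a pendant tree T off a vertex
-- replaces it by a pair (e , b) of polynomials with natural coefficients, e being det (x I + L(T)) and b the
-- minor without the root; so the graphs, which are triangles with a rooted tree at each vertex, are evaluated
-- by a fold, and c_k can be compared by semiring identities p′ = p + r.
--
-- Moving branches from v to w lowers all coefficients as soon as e_Y b_X ≤ e_X b_Y, where X and Y are the parts
-- of the remaining graph beyond w and v: the conductance e/b of X is at least that of Y.  This holds if Y is a
-- path on k vertices and X contains one starting at w.  Such moves (i) collect all trees at one triangle vertex,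
-- (ii) leave a single branching vertex, (iii) make the legs differ by at most one and (iv) bring the centre towards
-- the triangle while the leg lengths allow it, the triangle conducting more than a path on three vertices.
-- What cannot be improved is U n l q with q at most p.  Finally P(1) increases and the coefficient of x²
-- decreases strictly with q in that range, so these p + 1 graphs are pairwise incomparable.
module Submission where

open import Algebra.Bundles using (CommutativeSemiring; CommutativeRing)
open import Level using (0ℓ)
open import Relation.Binary.PropositionalEquality as ≡ using (_≡_)

-- Every inequality is proved by exhibiting the difference as a polynomial with natural
-- coefficients, so the integers occur only until the signs of `det (λ I - L)` have been removed.
-- The value at x = 1 travels along for two reasons: a positive difference there certifies that some
-- coefficient drops strictly, and since it is a natural number lowered by every move, the reduction
-- terminates.
--
-- The number p comes from the legs. With legs of d + 1 or d + 2 vertices, at least one of them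
-- short, q at most p means that l legs of q + 2 vertices would fit, that is q < d. The negation d ≤
-- q is exactly the condition under which a tail of q edges can be shortened. Below the threshold,
-- two evaluations of one difference have opposite signs. In the step between tails q and q + 1,
-- with a leg of d + 1 vertices beyond the longer tail and q + 1 < d, the coefficient of x² sees
-- only numbers of vertices, q + 3 for the triangle side against d + 2 for the path side; at x = 1
-- the bare triangle has conductance 2, more than any path. Hence the neighbours are incomparable
-- instead of ordered.

-- Counting edges.

module EdgeCount where

  open import Defs
  open import Data.Nat
  open import Data.Fin using (Fin; toℕ) renaming (zero to fz; suc to fs)
  open import Data.Bool using (_∧_; true)
  open import Relation.Binary.PropositionalEquality

  sumF : ∀ {m} → (Fin m → ℕ) → ℕ
  sumF {zero} f = 0
  sumF {suc m} f = f fz + sumF (λ i → f (fs i))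

  row : ∀ {n} → Graph n → Fin n → ℕ
  row G i = countF (λ j → G i j ∧ (toℕ i <ᵇ toℕ j))

  -- The summation inside numEdges is local to Defs and cannot be named; the underscore is solved to it in edges-sum.
  mutual
    local-sum : ∀ N (G : Graph N) m (g : Fin m → ℕ) → _ ≡ sumF g

    edges-sum : ∀ {n} (G : Graph n) → numEdges G ≡ sumF (row G)
    edges-sum {zero} G = refl
    edges-sum {suc m} G with row G fz | (λ i → row G (fs i))
    ... | a | g with suc m | G
    ... | N | G' = cong (a +_) (local-sum N G' m g)

    local-sum N G zero g = refl
    local-sum N G (suc m) g = cong (g fz +_) (local-sum N G m (λ i → g (fs i)))

  ≡ᵇ-refl : ∀ n → (n ≡ᵇ n) ≡ true
  ≡ᵇ-refl zero = refl
  ≡ᵇ-refl (suc n) = ≡ᵇ-refl n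

  ≡ᵇ-sound : ∀ m n → (m ≡ᵇ n) ≡ true → m ≡ n
  ≡ᵇ-sound zero zero _ = refl
  ≡ᵇ-sound (suc m) (suc n) e = cong suc (≡ᵇ-sound m n e)

-- Determinants over a commutative ring: transposition, conjugation, elimination of a pendant row.

module Determinant (R : CommutativeRing 0ℓ 0ℓ) where

  open import Data.Nat using (ℕ; zero; suc)
  open import Data.Fin using (Fin; zero; suc; punchIn; _≟_)
  open import Data.Fin.Properties using (punchInᵢ≢i)
  open import Data.Product using (_×_; _,_; Σ)
  open import Function using (_∘_)
  open import Relation.Nullary using (yes; no; contradiction)
  open import Relation.Binary.PropositionalEquality using (_≢_) renaming (refl to ≡-refl)
  open CommutativeRing R hiding (zero)
  open import Algebra.Properties.Ring ring using (-0#≈0#; -‿distribˡ-*; -‿distribʳ-*; -‿involutive; -‿+-comm)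
  open import Algebra.Properties.CommutativeSemigroup +-commutativeSemigroup using (interchange; x∙yz≈y∙xz)
  import Algebra.Properties.CommutativeSemigroup *-commutativeSemigroup as *-CS
  open import Relation.Binary.Reasoning.Setoid setoid

  Matrix : ℕ → Set
  Matrix n = Fin n → Fin n → Carrier

  _ᵀ : ∀ {n} → Matrix n → Matrix n
  (M ᵀ) i j = M j i

  opaque
    alternatingSum : ∀ {m} → (Fin m → Carrier) → Carrier
    alternatingSum {zero} f = 0#
    alternatingSum {suc m} f = f zero - alternatingSum (f ∘ suc)

    determinant : ∀ m → Matrix m → Carrier
    determinant zero M = 1#
    determinant (suc m) M = alternatingSum (λ j → M zero j * determinant m (λ i k → M (suc i) (punchIn j k)))

  private
    Alt = alternatingSum
    det = determinant

  opaque
    unfolding alternatingSum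

    alt-zero : ∀ (f : Fin zero → Carrier) → Alt f ≈ 0#
    alt-zero f = refl

    alt-suc : ∀ {m} (f : Fin (suc m) → Carrier) → Alt f ≈ f zero - Alt (λ i → f (suc i))
    alt-suc f = refl

  opaque
    unfolding determinant

    det-zero : ∀ (M : Matrix zero) → det zero M ≈ 1#
    det-zero M = refl

    det-suc : ∀ m (M : Matrix (suc m)) → det (suc m) M ≈ Alt (λ j → M zero j * det m (λ i k → M (suc i) (punchIn j k)))
    det-suc m M = refl

  det-suc₀ : ∀ m (M : Matrix (suc m)) → det (suc m) M ≈
    M zero zero * det m (λ i k → M (suc i) (suc k)) - Alt (λ j → M zero (suc j) * det m (λ i k → M (suc i) (punchIn (suc j) k)))
  det-suc₀ m M = trans (det-suc m M) (alt-suc _)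

  opaque
    unfolding alternatingSum

    alt-cong : ∀ {m} {f g : Fin m → Carrier} → (∀ i → f i ≈ g i) → Alt f ≈ Alt g
    alt-cong {zero} e = refl
    alt-cong {suc m} e = +-cong (e zero) (-‿cong (alt-cong (e ∘ suc)))

    alt-0 : ∀ {m} {f : Fin m → Carrier} → (∀ i → f i ≈ 0#) → Alt f ≈ 0#
    alt-0 {zero} e = refl
    alt-0 {suc m} e = trans (+-cong (e zero) (trans (-‿cong (alt-0 (e ∘ suc))) -0#≈0#)) (+-identityˡ 0#)

    alt-+ : ∀ {m} (f g : Fin m → Carrier) → Alt (λ i → f i + g i) ≈ Alt f + Alt g
    alt-+ {zero} f g = sym (+-identityˡ 0#)
    alt-+ {suc m} f g = begin
      (f zero + g zero) - Alt (λ i → f (suc i) + g (suc i)) ≈⟨ +-congˡ (trans (-‿cong (alt-+ (f ∘ suc) (g ∘ suc))) (sym (-‿+-comm _ _))) ⟩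
      (f zero + g zero) + (- Alt (f ∘ suc) + - Alt (g ∘ suc)) ≈⟨ interchange _ _ _ _ ⟩
      (f zero - Alt (f ∘ suc)) + (g zero - Alt (g ∘ suc)) ∎

    alt-neg : ∀ {m} (f : Fin m → Carrier) → Alt (λ i → - f i) ≈ - Alt f
    alt-neg {zero} f = sym -0#≈0#
    alt-neg {suc m} f = trans (+-congˡ (-‿cong (alt-neg (f ∘ suc)))) (-‿+-comm _ _)

    alt-* : ∀ {m} c (f : Fin m → Carrier) → Alt (λ i → c * f i) ≈ c * Alt f
    alt-* {zero} c f = sym (zeroʳ c)
    alt-* {suc m} c f = trans (+-congˡ (trans (-‿cong (alt-* c (f ∘ suc))) (-‿distribʳ-* c _))) (sym (distribˡ c _ _))

  alt-swap : ∀ {m n} (f : Fin m → Fin n → Carrier) → Alt (λ i → Alt (f i)) ≈ Alt (λ j → Alt (λ i → f i j))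
  alt-swap {zero} f = trans (alt-zero _) (sym (alt-0 λ j → alt-zero _))
  alt-swap {suc m} f = begin
    Alt (λ i → Alt (f i))                                  ≈⟨ alt-suc _ ⟩
    Alt (f zero) - Alt (λ i → Alt (f (suc i)))             ≈⟨ +-congˡ (-‿cong (alt-swap (λ i → f (suc i)))) ⟩
    Alt (f zero) - Alt (λ j → Alt (λ i → f (suc i) j))     ≈⟨ +-congˡ (sym (alt-neg _)) ⟩
    Alt (f zero) + Alt (λ j → - Alt (λ i → f (suc i) j))   ≈⟨ sym (alt-+ _ _) ⟩
    Alt (λ j → f zero j - Alt (λ i → f (suc i) j))         ≈⟨ alt-cong (λ j → sym (alt-suc _)) ⟩
    Alt (λ j → Alt (λ i → f i j))                          ∎

  det-cong : ∀ m {M N : Matrix m} → (∀ i j → M i j ≈ N i j) → det m M ≈ det m N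
  det-cong zero {M} {N} e = trans (det-zero M) (sym (det-zero N))
  det-cong (suc m) {M} {N} e = trans (det-suc m M) (trans
    (alt-cong λ j → *-cong (e zero j) (det-cong m λ i k → e (suc i) (punchIn j k)))
    (sym (det-suc m N)))

  -- Expanding the minors of the first row along their first column gives the
  -- same double sum as expanding the minors of the first column along their first row.
  det-ᵀ-step : ∀ m → (∀ M → det (suc m) (M ᵀ) ≈ det (suc m) M) → (∀ M → det m (M ᵀ) ≈ det m M) →
    ∀ M → det (suc (suc m)) (M ᵀ) ≈ det (suc (suc m)) M
  det-ᵀ-step m ih₁ ih₀ M = begin
    det _ (M ᵀ)               ≈⟨ det-suc₀ _ (M ᵀ) ⟩
    M zero zero * det _ (λ i j → M (suc j) (suc i)) - Alt (λ i → M (suc i) zero * det (suc m) (λ a b → M (punchIn (suc i) b) (suc a)))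
      ≈⟨ +-cong (*-congˡ (ih₁ (λ i j → M (suc i) (suc j)))) (-‿cong minors) ⟩
    M zero zero * det _ (λ i j → M (suc i) (suc j)) - Alt (λ j → M zero (suc j) * det (suc m) (λ a b → M (suc a) (punchIn (suc j) b)))
      ≈⟨ sym (det-suc₀ _ M) ⟩
    det _ M                   ∎
    where
    N : Fin (suc m) → Fin (suc m) → Matrix m
    N i j a b = M (suc (punchIn i a)) (suc (punchIn j b))
    rowMinor : ∀ i → M (suc i) zero * det (suc m) (λ a b → M (punchIn (suc i) b) (suc a))
                   ≈ Alt (λ j → M (suc i) zero * (M zero (suc j) * det m (N i j)))
    rowMinor i = trans (*-congˡ (trans (ih₁ (λ a b → M (punchIn (suc i) a) (suc b))) (det-suc m _))) (sym (alt-* _ _))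
    columnMinor : ∀ j → Alt (λ i → M (suc i) zero * (M zero (suc j) * det m (N i j)))
                      ≈ M zero (suc j) * det (suc m) (λ a b → M (suc a) (punchIn (suc j) b))
    columnMinor j = begin
      Alt (λ i → M (suc i) zero * (M zero (suc j) * det m (N i j)))
        ≈⟨ alt-cong (λ i → trans (*-CS.x∙yz≈y∙xz _ _ _) (*-congˡ (*-congˡ (sym (ih₀ (N i j)))))) ⟩
      Alt (λ i → M zero (suc j) * (M (suc i) zero * det m (N i j ᵀ)))
        ≈⟨ alt-* _ _ ⟩
      M zero (suc j) * Alt (λ i → M (suc i) zero * det m (N i j ᵀ))
        ≈⟨ *-congˡ (trans (sym (det-suc m _)) (ih₁ (λ a b → M (suc a) (punchIn (suc j) b)))) ⟩
      M zero (suc j) * det (suc m) (λ a b → M (suc a) (punchIn (suc j) b)) ∎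
    minors : Alt (λ i → M (suc i) zero * det (suc m) (λ a b → M (punchIn (suc i) b) (suc a)))
           ≈ Alt (λ j → M zero (suc j) * det (suc m) (λ a b → M (suc a) (punchIn (suc j) b)))
    minors = trans (alt-cong rowMinor) (trans (alt-swap _) (alt-cong columnMinor))

  det-ᵀ : ∀ m (M : Matrix m) → det m (M ᵀ) ≈ det m M
  det-ᵀ zero M = det-cong zero λ ()
  det-ᵀ (suc zero) M = det-cong 1 λ { zero zero → refl }
  det-ᵀ (suc (suc m)) M = det-ᵀ-step m (det-ᵀ (suc m)) (det-ᵀ m) M

  swap₀₁ : ∀ {m} → Fin (suc (suc m)) → Fin (suc (suc m))
  swap₀₁ zero = suc zero
  swap₀₁ (suc zero) = zero
  swap₀₁ (suc (suc i)) = suc (suc i)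

  -- In the expansion along the first row the two leading terms trade places, and with them their
  -- signs. In every later minor the exchanged columns are still the first two, so induction
  -- applies.
  det-swapColumns : ∀ m (M : Matrix (suc (suc m))) → det _ (λ i j → M i (swap₀₁ j)) ≈ - det _ M
  det-swapColumns m M = begin
    det _ (λ i j → M i (swap₀₁ j)) ≈⟨ trans (det-suc₀ _ _) (+-congˡ (-‿cong (alt-suc _))) ⟩
    p′ - (q′ - Alt r′)      ≈⟨ +-cong p′≈ (-‿cong (+-cong q′≈ (-‿cong (alts m M)))) ⟩
    q - (p - - Alt r)       ≈⟨ +-congˡ (trans (-‿cong (+-congˡ (-‿involutive _))) (sym (-‿+-comm _ _))) ⟩
    q + (- p + - Alt r)     ≈⟨ x∙yz≈y∙xz _ _ _ ⟩
    - p + (q - Alt r)       ≈⟨ +-congˡ (sym (-‿involutive _)) ⟩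
    - p + - - (q - Alt r)   ≈⟨ -‿+-comm _ _ ⟩
    - (p - (q - Alt r))     ≈⟨ -‿cong (sym (trans (det-suc₀ _ _) (+-congˡ (-‿cong (alt-suc _))))) ⟩
    - det _ M               ∎
    where
    r r′ : Fin m → Carrier
    r j = M zero (suc (suc j)) * det (suc m) (λ i k → M (suc i) (punchIn (suc (suc j)) k))
    r′ j = M zero (suc (suc j)) * det (suc m) (λ i k → M (suc i) (swap₀₁ (punchIn (suc (suc j)) k)))
    p q p′ q′ : Carrier
    p = M zero zero * det (suc m) (λ i k → M (suc i) (suc k))
    q = M zero (suc zero) * det (suc m) (λ i k → M (suc i) (punchIn (suc zero) k))
    p′ = M zero (suc zero) * det (suc m) (λ i k → M (suc i) (swap₀₁ (suc k)))
    q′ = M zero zero * det (suc m) (λ i k → M (suc i) (swap₀₁ (punchIn (suc zero) k)))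
    p′≈ : p′ ≈ q
    p′≈ = *-congˡ (det-cong (suc m) λ { i zero → refl ; i (suc k) → refl })
    q′≈ : q′ ≈ p
    q′≈ = *-congˡ (det-cong (suc m) λ { i zero → refl ; i (suc k) → refl })
    alts : ∀ m (M : Matrix (suc (suc m))) →
      Alt (λ j → M zero (suc (suc j)) * det (suc m) (λ i k → M (suc i) (swap₀₁ (punchIn (suc (suc j)) k))))
      ≈ - Alt (λ j → M zero (suc (suc j)) * det (suc m) (λ i k → M (suc i) (punchIn (suc (suc j)) k)))
    alts zero M = trans (alt-zero _) (trans (sym -0#≈0#) (-‿cong (sym (alt-zero _))))
    alts (suc m) M = trans (alt-cong λ j → trans (*-congˡ (trans
        (det-cong (suc (suc m)) λ { i zero → refl ; i (suc zero) → refl ; i (suc (suc k)) → refl })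
        (det-swapColumns m (λ i k → M (suc i) (punchIn (suc (suc j)) k)))))
        (sym (-‿distribʳ-* _ _)))
      (alt-neg _)

  -- The sign of a permutation stays an unspecified ring element `s`: conjugation permutes rows and
  -- columns, so only `s * s ≈ 1#` is ever asked of it.
  RowSign : ∀ {m} → (Fin m → Fin m) → Carrier → Set
  RowSign {m} σ s = ∀ M → det m (λ i j → M (σ i) j) ≈ s * det m M

  swapRows : ∀ {m} → RowSign (swap₀₁ {m}) (- 1#)
  swapRows {m} M = begin
    det _ (λ i j → M (swap₀₁ i) j)   ≈⟨ sym (det-ᵀ _ _) ⟩
    det _ (λ i j → M (swap₀₁ j) i)   ≈⟨ det-swapColumns m (M ᵀ) ⟩
    - det _ (M ᵀ)                    ≈⟨ -‿cong (trans (det-ᵀ _ M) (sym (*-identityˡ _))) ⟩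
    - (1# * det _ M)                 ≈⟨ -‿distribˡ-* _ _ ⟩
    - 1# * det _ M                   ∎

  lift₁ : ∀ {m} → (Fin m → Fin m) → Fin (suc m) → Fin (suc m)
  lift₁ σ zero = zero
  lift₁ σ (suc i) = suc (σ i)

  liftRows : ∀ {m} {σ : Fin m → Fin m} {s} → RowSign σ s → RowSign (lift₁ σ) s
  liftRows h M = trans (det-suc _ _) (trans
    (trans (alt-cong λ j → trans (*-congˡ (h (λ i k → M (suc i) (punchIn j k)))) (*-CS.x∙yz≈y∙xz _ _ _)) (alt-* _ _))
    (*-congˡ (sym (det-suc _ M))))

  front : ∀ {n} → Fin (suc n) → Fin (suc n) → Fin (suc n)
  front v zero = v
  front v (suc i) = punchIn v i

  Invariant : ∀ {m} → (Fin m → Fin m) → Set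
  Invariant {m} σ = ∀ M → det m (λ i j → M (σ i) (σ j)) ≈ det m M

  invariant : ∀ {m} {σ : Fin m → Fin m} {s} → RowSign σ s → s * s ≈ 1# → Invariant σ
  invariant {m} {σ} {s} h ss M = begin
    det m (λ i j → M (σ i) (σ j))     ≈⟨ h (λ i j → M i (σ j)) ⟩
    s * det m (λ i j → M i (σ j))     ≈⟨ *-congˡ (sym (det-ᵀ m _)) ⟩
    s * det m (λ i j → M j (σ i))     ≈⟨ *-congˡ (trans (h (M ᵀ)) (*-congˡ (det-ᵀ m M))) ⟩
    s * (s * det m M)                 ≈⟨ sym (*-assoc _ _ _) ⟩
    s * s * det m M                   ≈⟨ trans (*-congʳ ss) (*-identityˡ _) ⟩
    det m M                           ∎

  -- The cycle bringing `suc v` to the front is an exchange of the first two places combined with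
  -- the cycle for `v` on the remaining ones; each exchange contributes a factor -1.
  frontRows : ∀ {n} (v : Fin (suc n)) → Σ Carrier λ s → RowSign (front v) s × s * s ≈ 1#
  frontRows zero = 1# , (λ M → trans (det-cong _ λ { zero j → refl ; (suc i) j → refl }) (sym (*-identityˡ _))) , *-identityˡ 1#
  frontRows {suc n} (suc v) with frontRows v
  ... | s , h , ss = - 1# * s , rows , sq
    where
    rows : RowSign (front (suc v)) (- 1# * s)
    rows M = begin
      det _ (λ i j → M (front (suc v) i) j)               ≈⟨ det-cong _ (λ { zero j → refl ; (suc zero) j → refl ; (suc (suc i)) j → refl }) ⟩
      det _ (λ i j → M (lift₁ (front v) (swap₀₁ i)) j)    ≈⟨ swapRows (λ i j → M (lift₁ (front v) i) j) ⟩
      - 1# * det _ (λ i j → M (lift₁ (front v) i) j)      ≈⟨ *-congˡ (liftRows h M) ⟩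
      - 1# * (s * det _ M)                                ≈⟨ sym (*-assoc _ _ _) ⟩
      - 1# * s * det _ M                                  ∎
    sq : (- 1# * s) * (- 1# * s) ≈ 1#
    sq = begin
      (- 1# * s) * (- 1# * s)   ≈⟨ *-CS.interchange _ _ _ _ ⟩
      (- 1# * - 1#) * (s * s)   ≈⟨ *-congˡ ss ⟩
      (- 1# * - 1#) * 1#        ≈⟨ *-identityʳ _ ⟩
      - 1# * - 1#               ≈⟨ sym (-‿distribˡ-* _ _) ⟩
      - (1# * - 1#)             ≈⟨ -‿cong (*-identityˡ _) ⟩
      - - 1#                    ≈⟨ -‿involutive _ ⟩
      1#                        ∎

  det-front : ∀ {n} (v : Fin (suc n)) → Invariant (front v)
  det-front v with frontRows v
  ... | s , h , ss = invariant h ss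

  det-lift₁-front : ∀ {n} (v : Fin (suc n)) → Invariant (lift₁ (front v))
  det-lift₁-front v with frontRows v
  ... | s , h , ss = invariant (liftRows h) ss

  det-pendant₀ : ∀ {m} (M : Matrix (suc (suc m))) →
    (∀ j → M zero (suc (suc j)) ≈ 0#) → (∀ i → M (suc (suc i)) zero ≈ 0#) →
    det _ M ≈ M zero zero * det _ (λ i j → M (suc i) (suc j))
            - M zero (suc zero) * M (suc zero) zero * det _ (λ i j → M (suc (suc i)) (suc (suc j)))
  det-pendant₀ {m} M row col = trans (det-suc₀ _ M) (+-congˡ (-‿cong (begin
    Alt (λ j → M zero (suc j) * det _ (λ i k → M (suc i) (punchIn (suc j) k)))
      ≈⟨ leading _ (λ j → trans (*-congʳ (row j)) (zeroˡ _)) ⟩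
    M zero (suc zero) * det _ (λ i k → M (suc i) (punchIn (suc zero) k))
      ≈⟨ *-congˡ (trans (sym (det-ᵀ _ _)) (trans (det-suc _ _) (leading _ (λ j → trans (*-congʳ (col j)) (zeroˡ _))))) ⟩
    M zero (suc zero) * (M (suc zero) zero * det _ (λ i k → M (suc (suc k)) (suc (suc i))))
      ≈⟨ *-congˡ (*-congˡ (det-ᵀ m (λ i j → M (suc (suc i)) (suc (suc j))))) ⟩
    M zero (suc zero) * (M (suc zero) zero * det _ (λ i j → M (suc (suc i)) (suc (suc j))))
      ≈⟨ sym (*-assoc _ _ _) ⟩
    M zero (suc zero) * M (suc zero) zero * det _ (λ i j → M (suc (suc i)) (suc (suc j))) ∎)))
    where
    leading : ∀ {m} (f : Fin (suc m) → Carrier) → (∀ i → f (suc i) ≈ 0#) → Alt f ≈ f zero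
    leading f e = trans (alt-suc f) (trans (+-congˡ (trans (-‿cong (alt-0 e)) -0#≈0#)) (+-identityʳ _))

  -- The Schur complement of the entry (v , v) when v is coupled only to u, the row of u being multiplied by M v v.
  eliminated : ∀ {n} (v : Fin (suc n)) (u : Fin n) → Matrix (suc n) → Matrix n
  eliminated v u M i j with i ≟ u | j ≟ u
  ... | no _  | _     = M (punchIn v i) (punchIn v j)
  ... | yes _ | no _  = M v v * M (punchIn v i) (punchIn v j)
  ... | yes _ | yes _ = M v v * M (punchIn v i) (punchIn v j) - M v (punchIn v u) * M (punchIn v u) v

  -- With `v` and `u` moved to the places 0 and 1, the determinant is `M v v * det F - c * D zero`,
  -- where `D zero` is the minor without both rows and thus the leading minor of `F` along the row
  -- of `u`. Both terms are therefore expansions along that one row, which can absorb the factor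
  -- `M v v` and the correction; no division occurs.
  det-eliminate : ∀ {n} (v : Fin (suc n)) (u : Fin n) (M : Matrix (suc n)) →
    (∀ j → j ≢ u → M v (punchIn v j) ≈ 0#) → (∀ i → i ≢ u → M (punchIn v i) v ≈ 0#) →
    det _ M ≈ det _ (eliminated v u M)
  det-eliminate {suc n} v u M row col = begin
    det _ M                                     ≈⟨ sym (det-front v M) ⟩
    det _ A                                     ≈⟨ sym (det-lift₁-front u A) ⟩
    det _ (λ i j → A (lift₁ (front u) i) (lift₁ (front u) j))
      ≈⟨ det-pendant₀ _ (λ j → row (punchIn u j) (punchInᵢ≢i u j)) (λ i → col (punchIn u i) (punchInᵢ≢i u i)) ⟩
    M v v * det _ F - c * D zero                ≈⟨ +-cong (trans (*-congˡ (det-suc _ F)) (sym (alt-* _ _))) (-‿distribˡ-* c _) ⟩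
    Alt (λ j → M v v * (F zero j * D j)) + - c * D zero
      ≈⟨ trans (+-congʳ (alt-cong (λ j → sym (*-assoc _ _ _)))) (combine (λ j → M v v * F zero j) (- c) D) ⟩
    row′ zero * D zero - Alt (λ j → row′ (suc j) * D (suc j))  ≈⟨ sym (alt-suc _) ⟩
    Alt (λ j → row′ j * D j)                    ≈⟨ alt-cong (λ j → *-cong (row≈ j) (det-cong n λ i k → minor≈ i (punchIn j k))) ⟩
    Alt (λ j → E u (front u j) * det _ (λ i k → E (punchIn u i) (front u (punchIn j k))))  ≈⟨ sym (det-suc _ _) ⟩
    det _ (λ i j → E (front u i) (front u j))   ≈⟨ det-front u E ⟩
    det _ E                                     ∎
    where
    E = eliminated v u M
    A : Matrix (suc (suc n))
    A i j = M (front v i) (front v j)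
    F : Matrix (suc n)
    F i j = M (punchIn v (front u i)) (punchIn v (front u j))
    c = M v (punchIn v u) * M (punchIn v u) v
    D : Fin (suc n) → Carrier
    D j = det n (λ i k → F (suc i) (punchIn j k))
    row′ : Fin (suc n) → Carrier
    row′ zero = M v v * F zero zero - c
    row′ (suc j) = M v v * F zero (suc j)
    combine : ∀ (f : Fin (suc n) → Carrier) c (D : Fin (suc n) → Carrier) →
      Alt (λ j → f j * D j) + c * D zero ≈ (f zero + c) * D zero - Alt (λ j → f (suc j) * D (suc j))
    combine f c D = begin
      Alt (λ j → f j * D j) + c * D zero   ≈⟨ +-congʳ (alt-suc _) ⟩
      (f zero * D zero - X) + c * D zero   ≈⟨ trans (+-assoc _ _ _) (trans (+-congˡ (+-comm _ _)) (sym (+-assoc _ _ _))) ⟩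
      (f zero * D zero + c * D zero) - X   ≈⟨ +-congʳ (sym (distribʳ _ _ _)) ⟩
      (f zero + c) * D zero - X            ∎
      where X = Alt (λ j → f (suc j) * D (suc j))
    row≈ : ∀ j → row′ j ≈ E u (front u j)
    row≈ zero with u ≟ u
    ... | yes _ = refl
    ... | no ne = contradiction ≡-refl ne
    row≈ (suc j) with u ≟ u | punchIn u j ≟ u
    ... | yes _ | no _ = refl
    ... | no ne | _ = contradiction ≡-refl ne
    ... | yes _ | yes e = contradiction e (punchInᵢ≢i u j)
    minor≈ : ∀ i j → F (suc i) j ≈ E (punchIn u i) (front u j)
    minor≈ i j with punchIn u i ≟ u
    ... | no _ = refl
    ... | yes e = contradiction e (punchInᵢ≢i u i)

-- Formal power series over a commutative semiring.

module PowerSeries (A : CommutativeSemiring 0ℓ 0ℓ) where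

  open import Data.Nat using (ℕ; zero; suc)
  open import Data.Product using (_,_)
  open CommutativeSemiring A hiding (zero)
  open import Algebra.Properties.CommutativeSemigroup +-commutativeSemigroup using (interchange; x∙yz≈y∙xz)
  open import Relation.Binary.Reasoning.Setoid setoid

  Series : Set
  Series = ℕ → Carrier

  infix 4 _≋_
  infixl 6 _⊕_
  infixl 7 _⊛_

  -- A record instead of the bare pointwise statement, so that `f` and `g` can be recovered from the
  -- type of a proof.
  record _≋_ (f g : Series) : Set where
    constructor ⟪_⟫
    field at : ∀ n → f n ≈ g n
  open _≋_ public

  _⊕_ : Series → Series → Series
  (f ⊕ g) n = f n + g n

  tail : Series → Series
  tail f n = f (suc n)

  infixr 7 _·_
  _·_ : Carrier → Series → Series
  (a · f) n = a * f n

  -- The Cauchy product in the form suggested by `f = f 0 + X · tail f`, a recursion on the index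
  -- that avoids finite sums.
  _⊛_ : Series → Series → Series
  (f ⊛ g) zero = f 0 * g 0
  (f ⊛ g) (suc n) = f 0 * g (suc n) + (tail f ⊛ g) n

  𝟘 𝟙 X : Series
  𝟘 _ = 0#
  𝟙 zero = 1#
  𝟙 (suc _) = 0#
  X zero = 0#
  X (suc n) = 𝟙 n

  ⊛-cong : ∀ {f f′ g g′} → (∀ n → f n ≈ f′ n) → (∀ n → g n ≈ g′ n) → ∀ n → (f ⊛ g) n ≈ (f′ ⊛ g′) n
  ⊛-cong p q zero = *-cong (p 0) (q 0)
  ⊛-cong p q (suc n) = +-cong (*-cong (p 0) (q (suc n))) (⊛-cong (λ k → p (suc k)) q n)

  ⊛-distribʳ : ∀ h f g n → ((f ⊕ g) ⊛ h) n ≈ (f ⊛ h) n + (g ⊛ h) n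
  ⊛-distribʳ h f g zero = distribʳ _ _ _
  ⊛-distribʳ h f g (suc n) = trans (+-cong (distribʳ _ _ _) (⊛-distribʳ h (tail f) (tail g) n)) (interchange _ _ _ _)

  ⊛-zeroˡ : ∀ g n → (𝟘 ⊛ g) n ≈ 0#
  ⊛-zeroˡ g zero = zeroˡ _
  ⊛-zeroˡ g (suc n) = trans (+-cong (zeroˡ _) (⊛-zeroˡ g n)) (+-identityˡ _)

  ⊛-identityˡ : ∀ g n → (𝟙 ⊛ g) n ≈ g n
  ⊛-identityˡ g zero = *-identityˡ _
  ⊛-identityˡ g (suc n) = trans (+-cong (*-identityˡ _) (⊛-zeroˡ g n)) (+-identityʳ _)

  ⊛-scale : ∀ a f g n → ((a · f) ⊛ g) n ≈ a * (f ⊛ g) n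
  ⊛-scale a f g zero = *-assoc _ _ _
  ⊛-scale a f g (suc n) = trans (+-cong (*-assoc _ _ _) (⊛-scale a (tail f) g n)) (sym (distribˡ _ _ _))

  -- The mirror recursion, which peels the right factor; with it commutativity is an induction on
  -- the index.
  ⊛-sucʳ : ∀ f g n → (f ⊛ g) (suc n) ≈ g 0 * f (suc n) + (f ⊛ tail g) n
  ⊛-sucʳ f g zero = trans (+-comm _ _) (+-congʳ (*-comm _ _))
  ⊛-sucʳ f g (suc n) = trans (+-congˡ (⊛-sucʳ (tail f) g n)) (x∙yz≈y∙xz _ _ _)

  ⊛-comm : ∀ f g n → (f ⊛ g) n ≈ (g ⊛ f) n
  ⊛-comm f g zero = *-comm _ _
  ⊛-comm f g (suc n) = trans (+-congˡ (⊛-comm (tail f) g n)) (sym (⊛-sucʳ g f n))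

  ⊛-assoc : ∀ f g h n → ((f ⊛ g) ⊛ h) n ≈ (f ⊛ (g ⊛ h)) n
  ⊛-assoc f g h zero = *-assoc _ _ _
  ⊛-assoc f g h (suc n) = begin
    f 0 * g 0 * h (suc n) + (tail (f ⊛ g) ⊛ h) n
      ≈⟨ +-cong (*-assoc _ _ _) (⊛-distribʳ h (f 0 · tail g) (tail f ⊛ g) n) ⟩
    f 0 * (g 0 * h (suc n)) + (((f 0 · tail g) ⊛ h) n + ((tail f ⊛ g) ⊛ h) n)
      ≈⟨ +-congˡ (+-cong (⊛-scale (f 0) (tail g) h n) (⊛-assoc (tail f) g h n)) ⟩
    f 0 * (g 0 * h (suc n)) + (f 0 * (tail g ⊛ h) n + (tail f ⊛ (g ⊛ h)) n)
      ≈⟨ sym (+-assoc _ _ _) ⟩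
    f 0 * (g 0 * h (suc n)) + f 0 * (tail g ⊛ h) n + (tail f ⊛ (g ⊛ h)) n
      ≈⟨ +-congʳ (sym (distribˡ _ _ _)) ⟩
    f 0 * (g ⊛ h) (suc n) + (tail f ⊛ (g ⊛ h)) n ∎

  seriesSemiring : CommutativeSemiring 0ℓ 0ℓ
  seriesSemiring = record
    { Carrier = Series ; _≈_ = _≋_ ; _+_ = _⊕_ ; _*_ = _⊛_ ; 0# = 𝟘 ; 1# = 𝟙
    ; isCommutativeSemiring = record
      { isSemiring = record
        { isSemiringWithoutAnnihilatingZero = record
          { +-isCommutativeMonoid = record
            { isMonoid = record
              { isSemigroup = record
                { isMagma = record
                  { isEquivalence = record
                    { refl = ⟪ (λ _ → refl) ⟫ ; sym = λ p → ⟪ (λ n → sym (at p n)) ⟫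
                    ; trans = λ p q → ⟪ (λ n → trans (at p n) (at q n)) ⟫ }
                  ; ∙-cong = λ p q → ⟪ (λ n → +-cong (at p n) (at q n)) ⟫ }
                ; assoc = λ f g h → ⟪ (λ n → +-assoc _ _ _) ⟫ }
              ; identity = (λ f → ⟪ (λ n → +-identityˡ _) ⟫) , (λ f → ⟪ (λ n → +-identityʳ _) ⟫) }
            ; comm = λ f g → ⟪ (λ n → +-comm _ _) ⟫ }
          ; *-cong = λ p q → ⟪ ⊛-cong (at p) (at q) ⟫
          ; *-assoc = λ f g h → ⟪ ⊛-assoc f g h ⟫
          ; *-identity = (λ f → ⟪ ⊛-identityˡ f ⟫) , (λ f → ⟪ (λ n → trans (⊛-comm f 𝟙 n) (⊛-identityˡ f n)) ⟫)
          ; distrib = (λ f g h → ⟪ (λ n → trans (⊛-comm f _ n) (trans (⊛-distribʳ f g h n) (+-cong (⊛-comm g f n) (⊛-comm h f n)))) ⟫)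
                    , (λ f g h → ⟪ ⊛-distribʳ f g h ⟫) }
        ; zero = (λ f → ⟪ ⊛-zeroˡ f ⟫) , (λ f → ⟪ (λ n → trans (⊛-comm f 𝟘 n) (⊛-zeroˡ f n)) ⟫) }
      ; *-comm = λ f g → ⟪ ⊛-comm f g ⟫ } }

-- List polynomials as integer series, where trailing zeros no longer matter.

module IntegerSeries where

  open import Defs using (Poly; coeff; _+P_; negP; scaleP; _*P_; altSum; det)
  open import Data.Nat using (zero; suc)
  open import Data.Integer using (ℤ; +_; -_; _+_; _*_)
  import Data.Integer.Properties as ℤ
  open import Data.List using ([]; _∷_)
  open import Data.Fin using (Fin; punchIn)
  open import Data.Product using (_,_)
  open import Relation.Binary.PropositionalEquality
  open PowerSeries ℤ.+-*-commutativeSemiring public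
  open CommutativeSemiring seriesSemiring using (isCommutativeSemiring; +-isCommutativeMonoid; *-cong; *-assoc; *-identity; distrib; *-comm)

  ⊖_ : Series → Series
  (⊖ f) n = - f n

  seriesRing : CommutativeRing 0ℓ 0ℓ
  seriesRing = record
    { Carrier = Series ; _≈_ = _≋_ ; _+_ = _⊕_ ; _*_ = _⊛_ ; -_ = ⊖_ ; 0# = 𝟘 ; 1# = 𝟙
    ; isCommutativeRing = record
      { isRing = record
        { +-isAbelianGroup = record
          { isGroup = record
            { isMonoid = +-isMonoid
            ; inverse = (λ f → ⟪ (λ n → ℤ.+-inverseˡ (f n)) ⟫) , (λ f → ⟪ (λ n → ℤ.+-inverseʳ (f n)) ⟫)
            ; ⁻¹-cong = λ p → ⟪ (λ n → cong -_ (at p n)) ⟫ }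
          ; comm = CommutativeSemiring.+-comm seriesSemiring }
        ; *-cong = *-cong ; *-assoc = *-assoc ; *-identity = *-identity ; distrib = distrib }
      ; *-comm = *-comm } }
    where open CommutativeSemiring seriesSemiring using (+-isMonoid)

  -- Coefficient sequences turn the list polynomials of Defs into a commutative ring.
  ⟦_⟧ : Poly → Series
  ⟦ p ⟧ k = coeff k p

  ⟦+P⟧ : ∀ p q → ⟦ p +P q ⟧ ≋ ⟦ p ⟧ ⊕ ⟦ q ⟧
  ⟦+P⟧ p q = ⟪ go p q ⟫
    where
    go : ∀ p q k → coeff k (p +P q) ≡ coeff k p + coeff k q
    go [] q k = sym (ℤ.+-identityˡ _)
    go (a ∷ p) [] k = sym (ℤ.+-identityʳ _)
    go (a ∷ p) (b ∷ q) zero = refl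
    go (a ∷ p) (b ∷ q) (suc k) = go p q k

  ⟦negP⟧ : ∀ p → ⟦ negP p ⟧ ≋ ⊖ ⟦ p ⟧
  ⟦negP⟧ p = ⟪ go p ⟫
    where
    go : ∀ p k → coeff k (negP p) ≡ - coeff k p
    go [] k = refl
    go (a ∷ p) zero = refl
    go (a ∷ p) (suc k) = go p k

  coeff-scaleP : ∀ a p k → coeff k (scaleP a p) ≡ a * coeff k p
  coeff-scaleP a [] k = sym (ℤ.*-zeroʳ a)
  coeff-scaleP a (b ∷ p) zero = refl
  coeff-scaleP a (b ∷ p) (suc k) = coeff-scaleP a p k

  ⟦*P⟧ : ∀ p q → ⟦ p *P q ⟧ ≋ ⟦ p ⟧ ⊛ ⟦ q ⟧
  ⟦*P⟧ p q = ⟪ go p ⟫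
    where
    go : ∀ p k → coeff k (p *P q) ≡ (⟦ p ⟧ ⊛ ⟦ q ⟧) k
    go [] k = sym (⊛-zeroˡ ⟦ q ⟧ k)
    go (a ∷ p) k = trans (at (⟦+P⟧ (scaleP a q) _) k) (trans (cong (_+ _) (coeff-scaleP a q k)) (split k))
      where
      split : ∀ k → a * coeff k q + coeff k (+ 0 ∷ (p *P q)) ≡ (⟦ a ∷ p ⟧ ⊛ ⟦ q ⟧) k
      split zero = ℤ.+-identityʳ _
      split (suc k) = cong (λ t → a * coeff (suc k) q + t) (go p k)

  open Determinant seriesRing
  open CommutativeRing seriesRing using () renaming (refl to ≋-refl; sym to ≋-sym; trans to ≋-trans; +-cong to ⊕-cong; -‿cong to ⊖-cong; *-cong to ⊛-≋)

  ⟦altSum⟧ : ∀ {m} (f : Fin m → Poly) → ⟦ altSum f ⟧ ≋ alternatingSum (λ i → ⟦ f i ⟧)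
  ⟦altSum⟧ {zero} f = ≋-sym (alt-zero _)
  ⟦altSum⟧ {suc m} f = ≋-trans (⟦+P⟧ (f Fin.zero) (negP rest)) (≋-trans
    (⊕-cong {⟦ f Fin.zero ⟧} ≋-refl (≋-trans (⟦negP⟧ rest) (⊖-cong (⟦altSum⟧ (λ i → f (Fin.suc i))))))
    (≋-sym (alt-suc _)))
    where rest = altSum (λ i → f (Fin.suc i))

  ⟦det⟧ : ∀ m (M : Fin m → Fin m → Poly) → ⟦ det m M ⟧ ≋ determinant m (λ i j → ⟦ M i j ⟧)
  ⟦det⟧ zero M = ≋-trans ⟪ (λ { zero → refl ; (suc k) → refl }) ⟫ (≋-sym (det-zero _))
  ⟦det⟧ (suc m) M = ≋-trans (⟦altSum⟧ (λ j → M Fin.zero j *P det m (minor j))) (≋-trans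
    (alt-cong λ j → ≋-trans (⟦*P⟧ (M Fin.zero j) (det m (minor j))) (⊛-≋ {⟦ M Fin.zero j ⟧} ≋-refl (⟦det⟧ m (minor j))))
    (≋-sym (det-suc m (λ i j → ⟦ M i j ⟧))))
    where
    minor : Fin (suc m) → Fin m → Fin m → Poly
    minor j i k = M (Fin.suc i) (punchIn j k)

-- Rooted trees, triangles of rooted trees, and the attachment of pendant vertices.

module RootedTree where

  open import Data.Bool using (Bool; true; false; _∧_)
  open import Data.Bool.Properties using (∧-comm)
  open import Data.Nat using (ℕ; _+_)
  open import Data.Product using (Σ; _,_; ∃-syntax)
  open import Data.Sum using (_⊎_; inj₁; inj₂)
  open import Relation.Binary.PropositionalEquality
  open import Relation.Nullary using (¬_)

  infixl 5 _◁_

  -- S ◁ c is S with the tree c hung below its root as one more child.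
  data Tree : Set where
    • : Tree
    _◁_ : Tree → Tree → Tree

  data Vertex : Tree → Set where
    here : Vertex •
    inS : ∀ {S c} → Vertex S → Vertex (S ◁ c)
    inC : ∀ {S c} → Vertex c → Vertex (S ◁ c)

  size : Tree → ℕ
  size • = 1
  size (S ◁ c) = size S + size c

  isRoot : ∀ {T} → Vertex T → Bool
  isRoot here = true
  isRoot (inS u) = isRoot u
  isRoot (inC u) = false

  root : ∀ T → Vertex T
  root • = here
  root (S ◁ c) = inS (root S)

  adj : ∀ {T} → Vertex T → Vertex T → Bool
  adj here here = false
  adj (inS u) (inS v) = adj u v
  adj (inS u) (inC v) = isRoot u ∧ isRoot v
  adj (inC u) (inS v) = isRoot u ∧ isRoot v
  adj (inC u) (inC v) = adj u v

  -- The unicyclic graphs of girth 3: a triangle whose three vertices are roots of trees.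
  record Code : Set where
    constructor code
    field t₁ t₂ t₃ : Tree
  open Code public

  data Vertexᶜ (κ : Code) : Set where
    in₁ : Vertex (t₁ κ) → Vertexᶜ κ
    in₂ : Vertex (t₂ κ) → Vertexᶜ κ
    in₃ : Vertex (t₃ κ) → Vertexᶜ κ

  sizeᶜ : Code → ℕ
  sizeᶜ κ = size (t₁ κ) + (size (t₂ κ) + size (t₃ κ))

  adjᶜ : ∀ {κ} → Vertexᶜ κ → Vertexᶜ κ → Bool
  adjᶜ (in₁ u) (in₁ v) = adj u v
  adjᶜ (in₂ u) (in₂ v) = adj u v
  adjᶜ (in₃ u) (in₃ v) = adj u v
  adjᶜ (in₁ u) (in₂ v) = isRoot u ∧ isRoot v
  adjᶜ (in₁ u) (in₃ v) = isRoot u ∧ isRoot v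
  adjᶜ (in₂ u) (in₁ v) = isRoot u ∧ isRoot v
  adjᶜ (in₂ u) (in₃ v) = isRoot u ∧ isRoot v
  adjᶜ (in₃ u) (in₁ v) = isRoot u ∧ isRoot v
  adjᶜ (in₃ u) (in₂ v) = isRoot u ∧ isRoot v

  isRoot-root : ∀ T → isRoot (root T) ≡ true
  isRoot-root • = refl
  isRoot-root (S ◁ c) = isRoot-root S

  isRoot⇒root : ∀ {T} (u : Vertex T) → isRoot u ≡ true → u ≡ root T
  isRoot⇒root here _ = refl
  isRoot⇒root (inS u) e = cong inS (isRoot⇒root u e)

  adj-sym : ∀ {T} (u v : Vertex T) → adj u v ≡ adj v u
  adj-sym here here = refl
  adj-sym (inS u) (inS v) = adj-sym u v
  adj-sym (inS u) (inC v) = ∧-comm (isRoot u) (isRoot v)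
  adj-sym (inC u) (inS v) = ∧-comm (isRoot u) (isRoot v)
  adj-sym (inC u) (inC v) = adj-sym u v

  adj-irrefl : ∀ {T} (u : Vertex T) → adj u u ≡ false
  adj-irrefl here = refl
  adj-irrefl (inS u) = adj-irrefl u
  adj-irrefl (inC u) = adj-irrefl u

  adjᶜ-sym : ∀ {κ} (u v : Vertexᶜ κ) → adjᶜ u v ≡ adjᶜ v u
  adjᶜ-sym (in₁ u) (in₁ v) = adj-sym u v
  adjᶜ-sym (in₂ u) (in₂ v) = adj-sym u v
  adjᶜ-sym (in₃ u) (in₃ v) = adj-sym u v
  adjᶜ-sym (in₁ u) (in₂ v) = ∧-comm (isRoot u) (isRoot v)
  adjᶜ-sym (in₁ u) (in₃ v) = ∧-comm (isRoot u) (isRoot v)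
  adjᶜ-sym (in₂ u) (in₁ v) = ∧-comm (isRoot u) (isRoot v)
  adjᶜ-sym (in₂ u) (in₃ v) = ∧-comm (isRoot u) (isRoot v)
  adjᶜ-sym (in₃ u) (in₁ v) = ∧-comm (isRoot u) (isRoot v)
  adjᶜ-sym (in₃ u) (in₂ v) = ∧-comm (isRoot u) (isRoot v)

  adjᶜ-irrefl : ∀ {κ} (u : Vertexᶜ κ) → adjᶜ u u ≡ false
  adjᶜ-irrefl (in₁ u) = adj-irrefl u
  adjᶜ-irrefl (in₂ u) = adj-irrefl u
  adjᶜ-irrefl (in₃ u) = adj-irrefl u

  -- B arises from A by attaching a new pendant vertex to p.
  record LeafExtension {A B : Set} (_~_ : A → A → Bool) (_~′_ : B → B → Bool) : Set where
    field
      p : A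
      new : B
      emb : A → B
      view : ∀ w → (w ≡ new) ⊎ (∃[ u ] w ≡ emb u)
      emb-injective : ∀ {u v} → emb u ≡ emb v → u ≡ v
      new≢emb : ∀ {u} → ¬ new ≡ emb u
      ~-emb : ∀ u v → (emb u ~′ emb v) ≡ (u ~ v)
      ~-new : (new ~′ emb p) ≡ true
      ~-new-only : ∀ u → (new ~′ emb u) ≡ true → u ≡ p

  -- The new leaf becomes the innermost child of its parent, so that a fold over the tree combines
  -- the two before any other child is treated.
  addLeaf : ∀ T → Vertex T → Tree
  addLeaf • here = • ◁ •
  addLeaf (S ◁ c) (inS p) = addLeaf S p ◁ c
  addLeaf (S ◁ c) (inC p) = S ◁ addLeaf c p

  new : ∀ {T} (p : Vertex T) → Vertex (addLeaf T p)
  new here = inC here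
  new (inS p) = inS (new p)
  new (inC p) = inC (new p)

  emb : ∀ {T} (p : Vertex T) → Vertex T → Vertex (addLeaf T p)
  emb here here = inS here
  emb (inS p) (inS u) = inS (emb p u)
  emb (inS p) (inC u) = inC u
  emb (inC p) (inS u) = inS u
  emb (inC p) (inC u) = inC (emb p u)

  isRoot-new : ∀ {T} (p : Vertex T) → isRoot (new p) ≡ false
  isRoot-new here = refl
  isRoot-new (inS p) = isRoot-new p
  isRoot-new (inC p) = refl

  isRoot-emb : ∀ {T} (p u : Vertex T) → isRoot (emb p u) ≡ isRoot u
  isRoot-emb here here = refl
  isRoot-emb (inS p) (inS u) = isRoot-emb p u
  isRoot-emb (inS p) (inC u) = refl
  isRoot-emb (inC p) (inS u) = refl
  isRoot-emb (inC p) (inC u) = refl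

  viewLeaf : ∀ {T} (p : Vertex T) w → (w ≡ new p) ⊎ (∃[ u ] w ≡ emb p u)
  viewLeaf here (inS here) = inj₂ (here , refl)
  viewLeaf here (inC here) = inj₁ refl
  viewLeaf (inS p) (inS w) with viewLeaf p w
  ... | inj₁ e = inj₁ (cong inS e)
  ... | inj₂ (u , e) = inj₂ (inS u , cong inS e)
  viewLeaf (inS p) (inC w) = inj₂ (inC w , refl)
  viewLeaf (inC p) (inS w) = inj₂ (inS w , refl)
  viewLeaf (inC p) (inC w) with viewLeaf p w
  ... | inj₁ e = inj₁ (cong inC e)
  ... | inj₂ (u , e) = inj₂ (inC u , cong inC e)

  inS-injective : ∀ {S c} {u v : Vertex S} → inS {S} {c} u ≡ inS v → u ≡ v
  inS-injective refl = refl

  inC-injective : ∀ {S c} {u v : Vertex c} → inC {S} {c} u ≡ inC v → u ≡ v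
  inC-injective refl = refl

  emb-injective : ∀ {T} (p : Vertex T) {u v} → emb p u ≡ emb p v → u ≡ v
  emb-injective here {here} {here} _ = refl
  emb-injective (inS p) {inS u} {inS v} e = cong inS (emb-injective p (inS-injective e))
  emb-injective (inS p) {inC u} {inC v} e = cong inC (inC-injective e)
  emb-injective (inC p) {inS u} {inS v} e = cong inS (inS-injective e)
  emb-injective (inC p) {inC u} {inC v} e = cong inC (emb-injective p (inC-injective e))

  new≢emb : ∀ {T} (p : Vertex T) {u} → ¬ new p ≡ emb p u
  new≢emb here {here} ()
  new≢emb (inS p) {inS u} e = new≢emb p (inS-injective e)
  new≢emb (inC p) {inC u} e = new≢emb p (inC-injective e)

  adj-emb : ∀ {T} (p u v : Vertex T) → adj (emb p u) (emb p v) ≡ adj u v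
  adj-emb here here here = refl
  adj-emb (inS p) (inS u) (inS v) = adj-emb p u v
  adj-emb (inS p) (inS u) (inC v) = cong (_∧ isRoot v) (isRoot-emb p u)
  adj-emb (inS p) (inC u) (inS v) = cong (isRoot u ∧_) (isRoot-emb p v)
  adj-emb (inS p) (inC u) (inC v) = refl
  adj-emb (inC p) (inS u) (inS v) = refl
  adj-emb (inC p) (inS u) (inC v) = cong (isRoot u ∧_) (isRoot-emb p v)
  adj-emb (inC p) (inC u) (inS v) = cong (_∧ isRoot v) (isRoot-emb p u)
  adj-emb (inC p) (inC u) (inC v) = adj-emb p u v

  adj-new : ∀ {T} (p : Vertex T) → adj (new p) (emb p p) ≡ true
  adj-new here = refl
  adj-new (inS p) = adj-new p
  adj-new (inC p) = adj-new p

  adj-new-only : ∀ {T} (p u : Vertex T) → adj (new p) (emb p u) ≡ true → u ≡ p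
  adj-new-only here here _ = refl
  adj-new-only (inS p) (inS u) e = cong inS (adj-new-only p u e)
  adj-new-only (inS p) (inC u) e with isRoot (new p) | isRoot-new p
  adj-new-only (inS p) (inC u) () | false | _
  adj-new-only (inC p) (inS u) e with isRoot (new p) | isRoot-new p
  adj-new-only (inC p) (inS u) () | false | _
  adj-new-only (inC p) (inC u) e = cong inC (adj-new-only p u e)

  addLeafᶜ : ∀ κ → Vertexᶜ κ → Code
  addLeafᶜ κ (in₁ p) = record κ { t₁ = addLeaf (t₁ κ) p }
  addLeafᶜ κ (in₂ p) = record κ { t₂ = addLeaf (t₂ κ) p }
  addLeafᶜ κ (in₃ p) = record κ { t₃ = addLeaf (t₃ κ) p }

  newᶜ : ∀ {κ} (p : Vertexᶜ κ) → Vertexᶜ (addLeafᶜ κ p)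
  newᶜ (in₁ p) = in₁ (new p)
  newᶜ (in₂ p) = in₂ (new p)
  newᶜ (in₃ p) = in₃ (new p)

  embᶜ : ∀ {κ} (p : Vertexᶜ κ) → Vertexᶜ κ → Vertexᶜ (addLeafᶜ κ p)
  embᶜ (in₁ p) (in₁ u) = in₁ (emb p u)
  embᶜ (in₁ p) (in₂ u) = in₂ u
  embᶜ (in₁ p) (in₃ u) = in₃ u
  embᶜ (in₂ p) (in₁ u) = in₁ u
  embᶜ (in₂ p) (in₂ u) = in₂ (emb p u)
  embᶜ (in₂ p) (in₃ u) = in₃ u
  embᶜ (in₃ p) (in₁ u) = in₁ u
  embᶜ (in₃ p) (in₂ u) = in₂ u
  embᶜ (in₃ p) (in₃ u) = in₃ (emb p u)

  private
    in₁-injective : ∀ {κ} {u v : Vertex (t₁ κ)} → in₁ {κ} u ≡ in₁ v → u ≡ v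
    in₁-injective refl = refl
    in₂-injective : ∀ {κ} {u v : Vertex (t₂ κ)} → in₂ {κ} u ≡ in₂ v → u ≡ v
    in₂-injective refl = refl
    in₃-injective : ∀ {κ} {u v : Vertex (t₃ κ)} → in₃ {κ} u ≡ in₃ v → u ≡ v
    in₃-injective refl = refl

    viewᶜ : ∀ {κ} (p : Vertexᶜ κ) w → (w ≡ newᶜ p) ⊎ (∃[ u ] w ≡ embᶜ p u)
    viewᶜ (in₁ p) (in₁ w) with viewLeaf p w
    ... | inj₁ e = inj₁ (cong in₁ e)
    ... | inj₂ (u , e) = inj₂ (in₁ u , cong in₁ e)
    viewᶜ (in₁ p) (in₂ w) = inj₂ (in₂ w , refl)
    viewᶜ (in₁ p) (in₃ w) = inj₂ (in₃ w , refl)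
    viewᶜ (in₂ p) (in₁ w) = inj₂ (in₁ w , refl)
    viewᶜ (in₂ p) (in₂ w) with viewLeaf p w
    ... | inj₁ e = inj₁ (cong in₂ e)
    ... | inj₂ (u , e) = inj₂ (in₂ u , cong in₂ e)
    viewᶜ (in₂ p) (in₃ w) = inj₂ (in₃ w , refl)
    viewᶜ (in₃ p) (in₁ w) = inj₂ (in₁ w , refl)
    viewᶜ (in₃ p) (in₂ w) = inj₂ (in₂ w , refl)
    viewᶜ (in₃ p) (in₃ w) with viewLeaf p w
    ... | inj₁ e = inj₁ (cong in₃ e)
    ... | inj₂ (u , e) = inj₂ (in₃ u , cong in₃ e)

    embᶜ-injective : ∀ {κ} (p : Vertexᶜ κ) {u v} → embᶜ p u ≡ embᶜ p v → u ≡ v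
    embᶜ-injective (in₁ p) {in₁ u} {in₁ v} e = cong in₁ (emb-injective p (in₁-injective e))
    embᶜ-injective (in₁ p) {in₂ u} {in₂ v} e = cong in₂ (in₂-injective e)
    embᶜ-injective (in₁ p) {in₃ u} {in₃ v} e = cong in₃ (in₃-injective e)
    embᶜ-injective (in₂ p) {in₁ u} {in₁ v} e = cong in₁ (in₁-injective e)
    embᶜ-injective (in₂ p) {in₂ u} {in₂ v} e = cong in₂ (emb-injective p (in₂-injective e))
    embᶜ-injective (in₂ p) {in₃ u} {in₃ v} e = cong in₃ (in₃-injective e)
    embᶜ-injective (in₃ p) {in₁ u} {in₁ v} e = cong in₁ (in₁-injective e)
    embᶜ-injective (in₃ p) {in₂ u} {in₂ v} e = cong in₂ (in₂-injective e)
    embᶜ-injective (in₃ p) {in₃ u} {in₃ v} e = cong in₃ (emb-injective p (in₃-injective e))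

    newᶜ≢embᶜ : ∀ {κ} (p : Vertexᶜ κ) {u} → ¬ newᶜ p ≡ embᶜ p u
    newᶜ≢embᶜ (in₁ p) {in₁ u} e = new≢emb p (in₁-injective e)
    newᶜ≢embᶜ (in₂ p) {in₂ u} e = new≢emb p (in₂-injective e)
    newᶜ≢embᶜ (in₃ p) {in₃ u} e = new≢emb p (in₃-injective e)

    adjᶜ-embᶜ : ∀ {κ} (p u v : Vertexᶜ κ) → adjᶜ (embᶜ p u) (embᶜ p v) ≡ adjᶜ u v
    adjᶜ-embᶜ (in₁ p) (in₁ u) (in₁ v) = adj-emb p u v
    adjᶜ-embᶜ (in₁ p) (in₁ u) (in₂ v) = cong (_∧ isRoot v) (isRoot-emb p u)
    adjᶜ-embᶜ (in₁ p) (in₁ u) (in₃ v) = cong (_∧ isRoot v) (isRoot-emb p u)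
    adjᶜ-embᶜ (in₁ p) (in₂ u) (in₁ v) = cong (isRoot u ∧_) (isRoot-emb p v)
    adjᶜ-embᶜ (in₁ p) (in₂ u) (in₂ v) = refl
    adjᶜ-embᶜ (in₁ p) (in₂ u) (in₃ v) = refl
    adjᶜ-embᶜ (in₁ p) (in₃ u) (in₁ v) = cong (isRoot u ∧_) (isRoot-emb p v)
    adjᶜ-embᶜ (in₁ p) (in₃ u) (in₂ v) = refl
    adjᶜ-embᶜ (in₁ p) (in₃ u) (in₃ v) = refl
    adjᶜ-embᶜ (in₂ p) (in₁ u) (in₁ v) = refl
    adjᶜ-embᶜ (in₂ p) (in₁ u) (in₂ v) = cong (isRoot u ∧_) (isRoot-emb p v)
    adjᶜ-embᶜ (in₂ p) (in₁ u) (in₃ v) = refl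
    adjᶜ-embᶜ (in₂ p) (in₂ u) (in₁ v) = cong (_∧ isRoot v) (isRoot-emb p u)
    adjᶜ-embᶜ (in₂ p) (in₂ u) (in₂ v) = adj-emb p u v
    adjᶜ-embᶜ (in₂ p) (in₂ u) (in₃ v) = cong (_∧ isRoot v) (isRoot-emb p u)
    adjᶜ-embᶜ (in₂ p) (in₃ u) (in₁ v) = refl
    adjᶜ-embᶜ (in₂ p) (in₃ u) (in₂ v) = cong (isRoot u ∧_) (isRoot-emb p v)
    adjᶜ-embᶜ (in₂ p) (in₃ u) (in₃ v) = refl
    adjᶜ-embᶜ (in₃ p) (in₁ u) (in₁ v) = refl
    adjᶜ-embᶜ (in₃ p) (in₁ u) (in₂ v) = refl
    adjᶜ-embᶜ (in₃ p) (in₁ u) (in₃ v) = cong (isRoot u ∧_) (isRoot-emb p v)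
    adjᶜ-embᶜ (in₃ p) (in₂ u) (in₁ v) = refl
    adjᶜ-embᶜ (in₃ p) (in₂ u) (in₂ v) = refl
    adjᶜ-embᶜ (in₃ p) (in₂ u) (in₃ v) = cong (isRoot u ∧_) (isRoot-emb p v)
    adjᶜ-embᶜ (in₃ p) (in₃ u) (in₁ v) = cong (_∧ isRoot v) (isRoot-emb p u)
    adjᶜ-embᶜ (in₃ p) (in₃ u) (in₂ v) = cong (_∧ isRoot v) (isRoot-emb p u)
    adjᶜ-embᶜ (in₃ p) (in₃ u) (in₃ v) = adj-emb p u v

    adjᶜ-new : ∀ {κ} (p : Vertexᶜ κ) → adjᶜ (newᶜ p) (embᶜ p p) ≡ true
    adjᶜ-new (in₁ p) = adj-new p
    adjᶜ-new (in₂ p) = adj-new p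
    adjᶜ-new (in₃ p) = adj-new p

    nonroot : ∀ {T} (p : Vertex T) {b} {A : Set} → (isRoot (new p) ∧ b) ≡ true → A
    nonroot p e with isRoot (new p) | isRoot-new p
    nonroot p () | false | _

    adjᶜ-new-only : ∀ {κ} (p u : Vertexᶜ κ) → adjᶜ (newᶜ p) (embᶜ p u) ≡ true → u ≡ p
    adjᶜ-new-only (in₁ p) (in₁ u) e = cong in₁ (adj-new-only p u e)
    adjᶜ-new-only (in₁ p) (in₂ u) e = nonroot p e
    adjᶜ-new-only (in₁ p) (in₃ u) e = nonroot p e
    adjᶜ-new-only (in₂ p) (in₁ u) e = nonroot p e
    adjᶜ-new-only (in₂ p) (in₂ u) e = cong in₂ (adj-new-only p u e)
    adjᶜ-new-only (in₂ p) (in₃ u) e = nonroot p e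
    adjᶜ-new-only (in₃ p) (in₁ u) e = nonroot p e
    adjᶜ-new-only (in₃ p) (in₂ u) e = nonroot p e
    adjᶜ-new-only (in₃ p) (in₃ u) e = cong in₃ (adj-new-only p u e)

  leafExtension : ∀ {κ} (p : Vertexᶜ κ) → LeafExtension (adjᶜ {κ}) (adjᶜ {addLeafᶜ κ p})
  leafExtension p = record
    { p = p ; new = newᶜ p ; emb = embᶜ p ; view = viewᶜ p
    ; emb-injective = embᶜ-injective p ; new≢emb = newᶜ≢embᶜ p
    ; ~-emb = adjᶜ-embᶜ p ; ~-new = adjᶜ-new p ; ~-new-only = adjᶜ-new-only p }

  -- Since `addLeaf` inserts at the innermost place, a bare last child can be the removed leaf only
  -- if it is the only child; otherwise the leaf is sought among the earlier children.
  removeLeaf : ∀ S c → ∃[ T ] Σ (Vertex T) λ p → addLeaf T p ≡ S ◁ c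
  removeLeaf • • = • , here , refl
  removeLeaf (S ◁ c) • with removeLeaf S c
  ... | T , p , e = T ◁ • , inS p , cong (_◁ •) e
  removeLeaf S (c ◁ d) with removeLeaf c d
  ... | T , p , e = S ◁ T , inC p , cong (S ◁_) e

  triangle : Code
  triangle = code • • •

  -- Induction over pendant vertices, matching the elimination of one matrix row at a time.
  data LeafView : Code → Set where
    base : LeafView triangle
    ext : ∀ κ p → LeafView (addLeafᶜ κ p)

  leafView : ∀ κ → LeafView κ
  leafView (code • • •) = base
  leafView (code • • (S ◁ c)) with removeLeaf S c
  ... | T , p , e = subst (λ t → LeafView (code • • t)) e (ext (code • • T) (in₃ p))
  leafView (code • (S ◁ c) T₃) with removeLeaf S c
  ... | T , p , e = subst (λ t → LeafView (code • t T₃)) e (ext (code • T T₃) (in₂ p))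
  leafView (code (S ◁ c) T₂ T₃) with removeLeaf S c
  ... | T , p , e = subst (λ t → LeafView (code t T₂ T₃)) e (ext (code T T₂ T₃) (in₁ p))

-- Chains, paths and spiders, with their sizes and leaves.

module Shapes where

  open import Data.Nat using (ℕ; zero; suc; _+_)
  open import Data.Nat.Properties
  open import Data.List using (List; []; _∷_; length)
  open import Data.Nat.ListAction using (sum)
  open import Relation.Binary.PropositionalEquality
  open RootedTree

  chain : ℕ → Tree → Tree
  chain zero T = T
  chain (suc k) T = • ◁ chain k T

  -- path m has m + 1 vertices and is rooted at an end.
  path : ℕ → Tree
  path m = chain m •

  -- Identifies the roots of two trees.
  infixl 5 _⧺_
  _⧺_ : Tree → Tree → Tree
  T ⧺ • = T
  T ⧺ (S ◁ c) = (T ⧺ S) ◁ c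

  spider : List ℕ → Tree
  spider [] = •
  spider (m ∷ ms) = spider ms ◁ path m

  -- Leaves below the root; a bare root counts as a leaf only when it hangs from a parent.
  mutual
    leaves : Tree → ℕ
    leaves • = 0
    leaves (S ◁ c) = leaves S + leavesHung c

    leavesHung : Tree → ℕ
    leavesHung • = 1
    leavesHung (S ◁ c) = leaves S + leavesHung c

  leavesᶜ : Code → ℕ
  leavesᶜ κ = leaves (t₁ κ) + (leaves (t₂ κ) + leaves (t₃ κ))

  size-chain : ∀ k T → size (chain k T) ≡ k + size T
  size-chain zero T = refl
  size-chain (suc k) T = cong suc (size-chain k T)

  chain-suc : ∀ k T → chain (suc k) T ≡ chain k (• ◁ T)
  chain-suc zero T = refl
  chain-suc (suc k) T = cong (• ◁_) (chain-suc k T)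

  size-path : ∀ m → size (path m) ≡ suc m
  size-path m = trans (size-chain m •) (+-comm m 1)

  size-⧺ : ∀ T S → suc (size (T ⧺ S)) ≡ size T + size S
  size-⧺ T • = +-comm 1 (size T)
  size-⧺ T (S ◁ c) = trans (cong (_+ size c) (size-⧺ T S)) (+-assoc (size T) (size S) (size c))

  size-spider : ∀ ms → size (spider ms) ≡ suc (length ms + sum ms)
  size-spider [] = refl
  size-spider (m ∷ ms) = trans (cong₂ _+_ (size-spider ms) (size-path m)) (cong suc (trans (+-suc _ m)
    (cong suc (trans (+-assoc (length ms) (sum ms) m) (cong (length ms +_) (+-comm (sum ms) m))))))

  leaves-⧺ : ∀ T S → leaves (T ⧺ S) ≡ leaves T + leaves S
  leaves-⧺ T • = sym (+-identityʳ _)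
  leaves-⧺ T (S ◁ c) = trans (cong (_+ leavesHung c) (leaves-⧺ T S)) (+-assoc (leaves T) (leaves S) _)

  leavesHung-⧺ : ∀ A B S → leavesHung ((A ◁ B) ⧺ S) ≡ leaves ((A ◁ B) ⧺ S)
  leavesHung-⧺ A B • = refl
  leavesHung-⧺ A B (S ◁ c) = refl

  leavesHung-chain : ∀ k T → leavesHung (chain k T) ≡ leavesHung T
  leavesHung-chain zero T = refl
  leavesHung-chain (suc k) T = leavesHung-chain k T

  leavesHung-path : ∀ m → leavesHung (path m) ≡ 1
  leavesHung-path m = leavesHung-chain m •

  leaves-spider : ∀ ms → leaves (spider ms) ≡ length ms
  leaves-spider [] = refl
  leaves-spider (m ∷ ms) = trans (cong₂ _+_ (leaves-spider ms) (leavesHung-path m)) (+-comm _ 1)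

-- Graphs represented by codes, and the deletion of a leaf.

module Representation where

  open import Defs using (Graph; countF; degree; IsSimple)
  open import Data.Bool using (Bool; true; false; if_then_else_)
  open import Data.Bool.Properties using (¬-not)
  open import Data.Nat using (ℕ; zero; suc; _+_)
  open import Data.Nat.Properties using (+-commutativeSemigroup)
  open import Algebra.Properties.CommutativeSemigroup +-commutativeSemigroup using (x∙yz≈y∙xz)
  open import Data.Fin using (Fin; zero; suc; punchIn; punchOut)
  open import Data.Fin.Properties using (punchInᵢ≢i; punchIn-injective; punchIn-punchOut)
  open import Data.Product using (_,_; proj₁; proj₂; ∃-syntax)
  open import Data.Sum using (inj₁; inj₂)
  open import Function using (_∘_)
  open import Relation.Binary.PropositionalEquality
  open import Relation.Nullary using (contradiction)
  open RootedTree using (Code; Vertexᶜ; adjᶜ; adjᶜ-sym; adjᶜ-irrefl; addLeafᶜ; LeafExtension; leafExtension)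

  toNat : Bool → ℕ
  toNat b = if b then 1 else 0

  countF-cong : ∀ {n} {f g : Fin n → Bool} → (∀ i → f i ≡ g i) → countF f ≡ countF g
  countF-cong {zero} e = refl
  countF-cong {suc n} e = cong₂ (λ b k → toNat b + k) (e zero) (countF-cong (e ∘ suc))

  countF-remove : ∀ {n} (v : Fin (suc n)) (f : Fin (suc n) → Bool) →
    countF f ≡ toNat (f v) + countF (λ i → f (punchIn v i))
  countF-remove zero f = refl
  countF-remove {suc n} (suc v) f =
    trans (cong (toNat (f zero) +_) (countF-remove v (f ∘ suc))) (x∙yz≈y∙xz (toNat (f zero)) (toNat (f (suc v))) _)

  countF-none : ∀ {n} {f : Fin n → Bool} → (∀ i → f i ≡ false) → countF f ≡ 0
  countF-none {zero} e = refl
  countF-none {suc n} e rewrite e zero = countF-none (e ∘ suc)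

  countF-unique : ∀ {n} {f : Fin n → Bool} u → f u ≡ true → (∀ i → i ≢ u → f i ≡ false) → countF f ≡ 1
  countF-unique {suc n} {f} u e h rewrite countF-remove u f | e =
    cong suc (countF-none λ i → h (punchIn u i) (punchInᵢ≢i u i))

  record Rep {n} (G : Graph n) (κ : Code) : Set where
    field
      to : Vertexᶜ κ → Fin n
      from : Fin n → Vertexᶜ κ
      to-from : ∀ i → to (from i) ≡ i
      from-to : ∀ u → from (to u) ≡ u
      edge : ∀ u v → G (to u) (to v) ≡ adjᶜ u v

    to-injective : ∀ {u v} → to u ≡ to v → u ≡ v
    to-injective {u} {v} e = trans (sym (from-to u)) (trans (cong from e) (from-to v))

    edge′ : ∀ i j → G i j ≡ adjᶜ (from i) (from j)
    edge′ i j = trans (cong₂ G (sym (to-from i)) (sym (to-from j))) (edge _ _)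

    simple : IsSimple G
    simple = (λ i j → trans (edge′ i j) (trans (adjᶜ-sym (from i) (from j)) (sym (edge′ j i))))
           , (λ i → trans (edge′ i i) (adjᶜ-irrefl (from i)))

  delete : ∀ {n} → Fin (suc n) → Graph (suc n) → Graph n
  delete v G i j = G (punchIn v i) (punchIn v j)

  -- Collects what the elimination of the leaf's row needs: its neighbour `u`, the absence of any
  -- other neighbour, and the fact that the deletion lowers only the degree of `u`.
  module Peel {n} {G : Graph (suc n)} {κ} (p : Vertexᶜ κ) (rep : Rep G (addLeafᶜ κ p)) where
    open Rep rep
    open LeafExtension (leafExtension p) hiding (p)

    v : Fin (suc n)
    v = to new

    to≢ : ∀ x → v ≢ to (emb x)
    to≢ x e = new≢emb (to-injective e)

    to′ : Vertexᶜ κ → Fin n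
    to′ x = punchOut (to≢ x)

    punchIn-to′ : ∀ x → punchIn v (to′ x) ≡ to (emb x)
    punchIn-to′ x = punchIn-punchOut (to≢ x)

    unembed : ∀ i → ∃[ x ] from (punchIn v i) ≡ emb x
    unembed i with view (from (punchIn v i))
    ... | inj₁ e = contradiction (trans (sym (to-from _)) (cong to e)) (punchInᵢ≢i v i)
    ... | inj₂ r = r

    to-emb : ∀ i → to (emb (proj₁ (unembed i))) ≡ punchIn v i
    to-emb i = trans (cong to (sym (proj₂ (unembed i)))) (to-from _)

    rep′ : Rep (delete v G) κ
    rep′ = record
      { to = to′
      ; from = λ i → proj₁ (unembed i)
      ; to-from = λ i → punchIn-injective v _ _ (trans (punchIn-to′ _) (to-emb i))
      ; from-to = λ x → emb-injective (to-injective (trans (to-emb (to′ x)) (punchIn-to′ x)))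
      ; edge = λ x y → trans (cong₂ G (punchIn-to′ x) (punchIn-to′ y)) (trans (edge _ _) (~-emb x y))
      }

    u : Fin n
    u = to′ p

    pendant : G v (punchIn v u) ≡ true
    pendant = trans (cong (G v) (punchIn-to′ p)) (trans (edge _ _) ~-new)

    pendant-only : ∀ j → j ≢ u → G v (punchIn v j) ≡ false
    pendant-only j ne = ¬-not λ e → ne (punchIn-injective v _ _ (trans (sym (to-emb j)) (trans
      (cong (to ∘ emb) (~-new-only _ (trans (sym (edge _ _)) (trans (cong (G v) (to-emb j)) e)))) (sym (punchIn-to′ p)))))

    degree-v : degree G v ≡ 1
    degree-v = trans (countF-remove v (G v)) (cong₂ (λ b k → toNat b + k) (proj₂ simple v) (countF-unique u pendant pendant-only))

    degree-u : degree G (punchIn v u) ≡ suc (degree (delete v G) u)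
    degree-u = trans (countF-remove v (G (punchIn v u))) (cong (λ b → toNat b + degree (delete v G) u) (trans (proj₁ simple _ v) pendant))

    degree-other : ∀ i → i ≢ u → degree G (punchIn v i) ≡ degree (delete v G) i
    degree-other i ne = trans (countF-remove v (G (punchIn v i))) (cong (λ b → toNat b + degree (delete v G) i) (trans (proj₁ simple _ v) (pendant-only i ne)))

-- Graphs given by codes: degrees, edges, leaves, connectedness, girth.

module Membership where

  open import Defs
  open import Data.Bool using (Bool; true; false; _∧_)
  open import Data.Bool.Properties using (∧-zeroʳ; ∧-identityʳ)
  open import Data.Nat using (ℕ; zero; suc; _+_; _*_; _≡ᵇ_)
  open import Data.Nat.Properties
  open import Data.Nat.Solver using (module +-*-Solver)
  open import Algebra.Properties.CommutativeSemigroup +-commutativeSemigroup using (interchange)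
  open import Algebra.Properties.CommutativeMonoid.Sum +-0-commutativeMonoid using (sum; sum-permute; sum-cong-≗; ∑-distrib-+)
  open import Data.Fin using (Fin; zero; suc; toℕ; _↑ˡ_; _↑ʳ_; splitAt)
  open import Data.Fin.Properties using (splitAt-↑ˡ; splitAt-↑ʳ; join-splitAt)
  open import Data.Product using (_×_; _,_; proj₁; proj₂)
  open import Data.Sum using (_⊎_; inj₁; inj₂; [_,_]′)
  open import Function using (_∘_)
  open import Function.Bundles using (mk↔ₛ′)
  open import Relation.Binary.PropositionalEquality
  open import Relation.Nullary using (contradiction)
  open RootedTree
  open Shapes
  open Representation
  open EdgeCount using (row; edges-sum)

  index : ∀ {T} → Vertex T → Fin (size T)
  index here = zero
  index {S ◁ c} (inS u) = index u ↑ˡ size c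
  index {S ◁ c} (inC u) = size S ↑ʳ index u

  vertex : ∀ T → Fin (size T) → Vertex T
  vertex • i = here
  vertex (S ◁ c) i = [ inS ∘ vertex S , inC ∘ vertex c ]′ (splitAt (size S) i)

  vertex-index : ∀ {T} (u : Vertex T) → vertex T (index u) ≡ u
  vertex-index here = refl
  vertex-index {S ◁ c} (inS u) rewrite splitAt-↑ˡ (size S) (index u) (size c) = cong inS (vertex-index u)
  vertex-index {S ◁ c} (inC u) rewrite splitAt-↑ʳ (size S) (size c) (index u) = cong inC (vertex-index u)

  index-vertex : ∀ T i → index (vertex T i) ≡ i
  index-vertex • zero = refl
  index-vertex (S ◁ c) i with splitAt (size S) i | join-splitAt (size S) (size c) i
  ... | inj₁ j | e = trans (cong (_↑ˡ size c) (index-vertex S j)) e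
  ... | inj₂ j | e = trans (cong (size S ↑ʳ_) (index-vertex c j)) e

  indexᶜ : ∀ {κ} → Vertexᶜ κ → Fin (sizeᶜ κ)
  indexᶜ {κ} (in₁ u) = index u ↑ˡ (size (t₂ κ) + size (t₃ κ))
  indexᶜ {κ} (in₂ u) = size (t₁ κ) ↑ʳ (index u ↑ˡ size (t₃ κ))
  indexᶜ {κ} (in₃ u) = size (t₁ κ) ↑ʳ (size (t₂ κ) ↑ʳ index u)

  vertexᶜ : ∀ κ → Fin (sizeᶜ κ) → Vertexᶜ κ
  vertexᶜ κ i = [ in₁ ∘ vertex (t₁ κ) , (λ j → [ in₂ ∘ vertex (t₂ κ) , in₃ ∘ vertex (t₃ κ) ]′ (splitAt (size (t₂ κ)) j)) ]′ (splitAt (size (t₁ κ)) i)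

  vertexᶜ-indexᶜ : ∀ {κ} (u : Vertexᶜ κ) → vertexᶜ κ (indexᶜ u) ≡ u
  vertexᶜ-indexᶜ {κ} (in₁ u) rewrite splitAt-↑ˡ (size (t₁ κ)) (index u) (size (t₂ κ) + size (t₃ κ)) = cong in₁ (vertex-index u)
  vertexᶜ-indexᶜ {κ} (in₂ u) rewrite splitAt-↑ʳ (size (t₁ κ)) (size (t₂ κ) + size (t₃ κ)) (index u ↑ˡ size (t₃ κ)) | splitAt-↑ˡ (size (t₂ κ)) (index u) (size (t₃ κ)) = cong in₂ (vertex-index u)
  vertexᶜ-indexᶜ {κ} (in₃ u) rewrite splitAt-↑ʳ (size (t₁ κ)) (size (t₂ κ) + size (t₃ κ)) (size (t₂ κ) ↑ʳ index u) | splitAt-↑ʳ (size (t₂ κ)) (size (t₃ κ)) (index u) = cong in₃ (vertex-index u)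

  indexᶜ-vertexᶜ : ∀ κ i → indexᶜ (vertexᶜ κ i) ≡ i
  indexᶜ-vertexᶜ κ i with splitAt (size (t₁ κ)) i | join-splitAt (size (t₁ κ)) (size (t₂ κ) + size (t₃ κ)) i
  ... | inj₁ j | e = trans (cong (_↑ˡ (size (t₂ κ) + size (t₃ κ))) (index-vertex (t₁ κ) j)) e
  ... | inj₂ j | e with splitAt (size (t₂ κ)) j | join-splitAt (size (t₂ κ)) (size (t₃ κ)) j
  ... | inj₁ k | e′ = trans (cong (size (t₁ κ) ↑ʳ_) (trans (cong (_↑ˡ size (t₃ κ)) (index-vertex (t₂ κ) k)) e′)) e
  ... | inj₂ k | e′ = trans (cong (size (t₁ κ) ↑ʳ_) (trans (cong (size (t₂ κ) ↑ʳ_) (index-vertex (t₃ κ) k)) e′)) e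

  graphOf : ∀ κ → Graph (sizeᶜ κ)
  graphOf κ i j = adjᶜ (vertexᶜ κ i) (vertexᶜ κ j)

  rep-graphOf : ∀ κ → Rep (graphOf κ) κ
  rep-graphOf κ = record
    { to = indexᶜ ; from = vertexᶜ κ ; to-from = indexᶜ-vertexᶜ κ ; from-to = vertexᶜ-indexᶜ
    ; edge = λ u v → cong₂ adjᶜ (vertexᶜ-indexᶜ u) (vertexᶜ-indexᶜ v) }

  sumV : ∀ T → (Vertex T → ℕ) → ℕ
  sumV • f = f here
  sumV (S ◁ c) f = sumV S (f ∘ inS) + sumV c (f ∘ inC)

  sumᶜ : ∀ κ → (Vertexᶜ κ → ℕ) → ℕ
  sumᶜ κ f = sumV (t₁ κ) (f ∘ in₁) + (sumV (t₂ κ) (f ∘ in₂) + sumV (t₃ κ) (f ∘ in₃))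

  sum-++ : ∀ m {n} (f : Fin (m + n) → ℕ) → sum f ≡ sum (λ i → f (i ↑ˡ n)) + sum (λ i → f (m ↑ʳ i))
  sum-++ zero f = refl
  sum-++ (suc m) f = trans (cong (f zero +_) (sum-++ m (f ∘ suc))) (sym (+-assoc (f zero) _ _))

  sumV-sum : ∀ T (f : Vertex T → ℕ) → sumV T f ≡ sum (f ∘ vertex T)
  sumV-sum • f = sym (+-identityʳ _)
  sumV-sum (S ◁ c) f = trans (cong₂ _+_ (sumV-sum S (f ∘ inS)) (sumV-sum c (f ∘ inC)))
    (sym (trans (sum-++ (size S) (f ∘ vertex (S ◁ c))) (cong₂ _+_
      (sum-cong-≗ (λ i → cong (f ∘ [ inS ∘ vertex S , inC ∘ vertex c ]′) (splitAt-↑ˡ (size S) i (size c))))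
      (sum-cong-≗ (λ i → cong (f ∘ [ inS ∘ vertex S , inC ∘ vertex c ]′) (splitAt-↑ʳ (size S) (size c) i))))))

  sumᶜ-sum : ∀ κ (f : Vertexᶜ κ → ℕ) → sumᶜ κ f ≡ sum (f ∘ vertexᶜ κ)
  sumᶜ-sum κ f = trans (cong₂ _+_ (sumV-sum T₁ (f ∘ in₁)) (cong₂ _+_ (sumV-sum T₂ (f ∘ in₂)) (sumV-sum T₃ (f ∘ in₃))))
    (sym (trans (sum-++ (size T₁) (f ∘ vertexᶜ κ)) (cong₂ _+_
      (sum-cong-≗ (λ i → cong (f ∘ outer) (splitAt-↑ˡ (size T₁) i (size T₂ + size T₃))))
      (trans (sum-cong-≗ (λ i → cong (f ∘ outer) (splitAt-↑ʳ (size T₁) (size T₂ + size T₃) i)))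
        (trans (sum-++ (size T₂) (f ∘ inner ∘ splitAt (size T₂))) (cong₂ _+_
          (sum-cong-≗ (λ i → cong (f ∘ inner) (splitAt-↑ˡ (size T₂) i (size T₃))))
          (sum-cong-≗ (λ i → cong (f ∘ inner) (splitAt-↑ʳ (size T₂) (size T₃) i)))))))))
    where
    T₁ = t₁ κ
    T₂ = t₂ κ
    T₃ = t₃ κ
    inner : Fin (size T₂) ⊎ Fin (size T₃) → Vertexᶜ κ
    inner = [ in₂ ∘ vertex T₂ , in₃ ∘ vertex T₃ ]′
    outer : Fin (size T₁) ⊎ Fin (size T₂ + size T₃) → Vertexᶜ κ
    outer = [ in₁ ∘ vertex T₁ , inner ∘ splitAt (size T₂) ]′

  sumV-cong : ∀ T {f g : Vertex T → ℕ} → (∀ u → f u ≡ g u) → sumV T f ≡ sumV T g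
  sumV-cong • e = e here
  sumV-cong (S ◁ c) e = cong₂ _+_ (sumV-cong S (e ∘ inS)) (sumV-cong c (e ∘ inC))

  sumᶜ-cong : ∀ κ {f g : Vertexᶜ κ → ℕ} → (∀ u → f u ≡ g u) → sumᶜ κ f ≡ sumᶜ κ g
  sumᶜ-cong κ e = cong₂ _+_ (sumV-cong (t₁ κ) (e ∘ in₁)) (cong₂ _+_ (sumV-cong (t₂ κ) (e ∘ in₂)) (sumV-cong (t₃ κ) (e ∘ in₃)))

  sumV-+ : ∀ T (f g : Vertex T → ℕ) → sumV T (λ u → f u + g u) ≡ sumV T f + sumV T g
  sumV-+ • f g = refl
  sumV-+ (S ◁ c) f g = trans (cong₂ _+_ (sumV-+ S (f ∘ inS) (g ∘ inS)) (sumV-+ c (f ∘ inC) (g ∘ inC)))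
    (interchange (sumV S (f ∘ inS)) (sumV S (g ∘ inS)) (sumV c (f ∘ inC)) (sumV c (g ∘ inC)))

  sumV-0 : ∀ T → sumV T (λ _ → 0) ≡ 0
  sumV-0 • = refl
  sumV-0 (S ◁ c) = cong₂ _+_ (sumV-0 S) (sumV-0 c)

  sum-root : ∀ T → sumV T (toNat ∘ isRoot) ≡ 1
  sum-root • = refl
  sum-root (S ◁ c) = cong₂ _+_ (sum-root S) (sumV-0 c)

  sum-root-∧ : ∀ T r → sumV T (λ u → toNat (r ∧ isRoot u)) ≡ toNat r
  sum-root-∧ T true = sum-root T
  sum-root-∧ T false = sumV-0 T

  deg : ∀ {T} → Vertex T → ℕ
  deg {T} u = sumV T (λ v → toNat (adj u v))

  rootNat : ∀ {T} → Vertex T → ℕ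
  rootNat = toNat ∘ isRoot

  deg-inS : ∀ {S c} (u : Vertex S) → deg {S ◁ c} (inS u) ≡ deg u + rootNat u
  deg-inS {S} {c} u = cong (deg u +_) (sum-root-∧ c (isRoot u))

  deg-inC : ∀ {S c} (u : Vertex c) → deg {S ◁ c} (inC u) ≡ deg u + rootNat u
  deg-inC {S} {c} u = trans (cong (_+ deg u) (sum-root-∧ S (isRoot u))) (+-comm (rootNat u) (deg u))

  degᶜ : ∀ {κ} → Vertexᶜ κ → ℕ
  degᶜ {κ} u = sumᶜ κ (λ v → toNat (adjᶜ u v))

  degᶜ-in₁ : ∀ {κ} (u : Vertex (t₁ κ)) → degᶜ {κ} (in₁ u) ≡ deg u + (rootNat u + rootNat u)
  degᶜ-in₁ {κ} u = cong (deg u +_) (cong₂ _+_ (sum-root-∧ (t₂ κ) (isRoot u)) (sum-root-∧ (t₃ κ) (isRoot u)))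

  degᶜ-in₂ : ∀ {κ} (u : Vertex (t₂ κ)) → degᶜ {κ} (in₂ u) ≡ deg u + (rootNat u + rootNat u)
  degᶜ-in₂ {κ} u = trans (cong₂ (λ p q → p + (deg u + q)) (sum-root-∧ (t₁ κ) (isRoot u)) (sum-root-∧ (t₃ κ) (isRoot u)))
    (solve 2 (λ r d → r :+ (d :+ r) := d :+ (r :+ r)) refl (rootNat u) (deg u))
    where open +-*-Solver

  degᶜ-in₃ : ∀ {κ} (u : Vertex (t₃ κ)) → degᶜ {κ} (in₃ u) ≡ deg u + (rootNat u + rootNat u)
  degᶜ-in₃ {κ} u = trans (cong₂ (λ p q → p + (q + deg u)) (sum-root-∧ (t₁ κ) (isRoot u)) (sum-root-∧ (t₂ κ) (isRoot u)))
    (solve 2 (λ r d → r :+ (r :+ d) := d :+ (r :+ r)) refl (rootNat u) (deg u))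
    where open +-*-Solver

  sum-deg : ∀ T → sumV T deg + 2 ≡ 2 * size T
  sum-deg • = refl
  sum-deg (S ◁ c) = begin
    sumV S (deg ∘ inS {c = c}) + sumV c (deg ∘ inC {S}) + 2
      ≡⟨ cong (_+ 2) (cong₂ _+_ (trans (sumV-cong S (deg-inS {S} {c})) (trans (sumV-+ S deg rootNat) (cong (sumV S deg +_) (sum-root S))))
                                (trans (sumV-cong c (deg-inC {S} {c})) (trans (sumV-+ c deg rootNat) (cong (sumV c deg +_) (sum-root c))))) ⟩
    sumV S deg + 1 + (sumV c deg + 1) + 2
      ≡⟨ solve 2 (λ s c → s :+ con 1 :+ (c :+ con 1) :+ con 2 := (s :+ con 2) :+ (c :+ con 2)) refl (sumV S deg) (sumV c deg) ⟩
    (sumV S deg + 2) + (sumV c deg + 2)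
      ≡⟨ cong₂ _+_ (sum-deg S) (sum-deg c) ⟩
    2 * size S + 2 * size c
      ≡⟨ sym (*-distribˡ-+ 2 (size S) (size c)) ⟩
    2 * (size S + size c) ∎
    where
    open ≡-Reasoning
    open +-*-Solver

  private
    sum-degᶜ′ : ∀ T (f : Vertex T → ℕ) → (∀ u → f u ≡ deg u + (rootNat u + rootNat u)) → sumV T f ≡ 2 * size T
    sum-degᶜ′ T f h = trans (sumV-cong T h) (trans (sumV-+ T deg _) (trans
      (cong (sumV T deg +_) (trans (sumV-+ T rootNat rootNat) (cong₂ _+_ (sum-root T) (sum-root T)))) (sum-deg T)))

  sum-degᶜ : ∀ κ → sumᶜ κ degᶜ ≡ 2 * sizeᶜ κ
  sum-degᶜ κ = trans (cong₂ _+_ (sum-degᶜ′ (t₁ κ) _ (degᶜ-in₁ {κ})) (cong₂ _+_ (sum-degᶜ′ (t₂ κ) _ (degᶜ-in₂ {κ})) (sum-degᶜ′ (t₃ κ) _ (degᶜ-in₃ {κ}))))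
    (sym (trans (*-distribˡ-+ 2 (size (t₁ κ)) _) (cong (2 * size (t₁ κ) +_) (*-distribˡ-+ 2 (size (t₂ κ)) _))))

  -- Vertices of total degree 1 when the root has k further neighbours.
  countLeaves : ℕ → Tree → ℕ
  countLeaves k T = sumV T (λ u → toNat (deg u + k * rootNat u ≡ᵇ 1))

  countLeaves-◁ : ∀ k S c → countLeaves k (S ◁ c) ≡ countLeaves (suc k) S + countLeaves 1 c
  countLeaves-◁ k S c = cong₂ _+_
    (sumV-cong S (λ u → cong (λ d → toNat (d ≡ᵇ 1)) (trans (cong (_+ k * rootNat u) (deg-inS {S} {c} u)) (+-assoc (deg u) (rootNat u) (k * rootNat u)))))
    (sumV-cong c (λ u → cong (λ d → toNat (d ≡ᵇ 1)) (trans (cong₂ _+_ (deg-inC {S} {c} u) (*-zeroʳ k)) (+-assoc (deg u) (rootNat u) 0))))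

  mutual
    -- A root with two further neighbours can never have degree 1. Triangle vertices are in this
    -- position, whereas a child has exactly one further neighbour, its parent, and is a leaf when
    -- bare.
    countLeaves-free : ∀ k T → countLeaves (2 + k) T ≡ leaves T
    countLeaves-free k • = refl
    countLeaves-free k (S ◁ c) = trans (countLeaves-◁ (2 + k) S c) (cong₂ _+_ (countLeaves-free (suc k) S) (countLeaves-hung c))

    countLeaves-hung : ∀ T → countLeaves 1 T ≡ leavesHung T
    countLeaves-hung • = refl
    countLeaves-hung (S ◁ c) = trans (countLeaves-◁ 1 S c) (cong₂ _+_ (countLeaves-free 0 S) (countLeaves-hung c))

  private
    countLeavesᶜ′ : ∀ T (f : Vertex T → ℕ) → (∀ u → f u ≡ deg u + (rootNat u + rootNat u)) → sumV T (λ u → toNat (f u ≡ᵇ 1)) ≡ leaves T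
    countLeavesᶜ′ T f h = trans (sumV-cong T (λ u → cong (λ d → toNat (d ≡ᵇ 1)) (trans (h u) (cong (λ t → deg u + (rootNat u + t)) (sym (+-identityʳ (rootNat u))))))) (countLeaves-free 0 T)

  countLeavesᶜ : ∀ κ → sumᶜ κ (λ u → toNat (degᶜ u ≡ᵇ 1)) ≡ leavesᶜ κ
  countLeavesᶜ κ = cong₂ _+_ (countLeavesᶜ′ (t₁ κ) _ (degᶜ-in₁ {κ})) (cong₂ _+_ (countLeavesᶜ′ (t₂ κ) _ (degᶜ-in₂ {κ})) (countLeavesᶜ′ (t₃ κ) _ (degᶜ-in₃ {κ})))

  countF-sum : ∀ {n} (f : Fin n → Bool) → countF f ≡ sum (toNat ∘ f)
  countF-sum {zero} f = refl
  countF-sum {suc n} f = cong (toNat (f zero) +_) (countF-sum (f ∘ suc))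

  -- Induction deletes vertex 0. Its row counts its edges once in `numEdges`; in the degree sum they
  -- appear again in the column of 0, which symmetry identifies with the row.
  handshake : ∀ {n} (G : Graph n) → IsSimple G → numEdges G + numEdges G ≡ sum (degree G)
  handshake G simple = trans (cong₂ _+_ (edges-sum G) (edges-sum G)) (go G simple)
    where
    go : ∀ {n} (G : Graph n) → IsSimple G → EdgeCount.sumF (row G) + EdgeCount.sumF (row G) ≡ sum (degree G)
    go {zero} G _ = refl
    go {suc n} G (sy , ir) = begin
      (row G zero + F (row G ∘ suc)) + (row G zero + F (row G ∘ suc))
        ≡⟨ cong (λ t → t + t) (cong₂ _+_ row₀ (F-cong rows)) ⟩
      (r + F (row G′)) + (r + F (row G′))
        ≡⟨ interchange r (F (row G′)) r (F (row G′)) ⟩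
      (r + r) + (F (row G′) + F (row G′))
        ≡⟨ cong ((r + r) +_) (go G′ ((λ i j → sy (suc i) (suc j)) , (λ i → ir (suc i)))) ⟩
      (r + r) + sum (degree G′)
        ≡⟨ +-assoc r r _ ⟩
      r + (r + sum (degree G′))
        ≡⟨ cong₂ _+_ (sym (cong (λ b → toNat b + r) (ir zero))) (cong (_+ sum (degree G′)) r-sum) ⟩
      degree G zero + (sum (λ i → toNat (G (suc i) zero)) + sum (degree G′))
        ≡⟨ cong (degree G zero +_) (sym (∑-distrib-+ (λ i → toNat (G (suc i) zero)) (degree G′))) ⟩
      sum (degree G) ∎
      where
      open ≡-Reasoning
      F : ∀ {m} → (Fin m → ℕ) → ℕ
      F = EdgeCount.sumF
      G′ : Graph n
      G′ i j = G (suc i) (suc j)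
      r = countF (λ j → G zero (suc j))
      F-cong : ∀ {m} {f g : Fin m → ℕ} → (∀ i → f i ≡ g i) → F f ≡ F g
      F-cong {zero} e = refl
      F-cong {suc m} e = cong₂ _+_ (e zero) (F-cong (e ∘ suc))
      row₀ : row G zero ≡ r
      row₀ = cong₂ (λ b k → toNat b + k) (∧-zeroʳ (G zero zero)) (countF-cong (λ j → ∧-identityʳ (G zero (suc j))))
      rows : ∀ i → row G (suc i) ≡ row G′ i
      rows i = cong (λ b → toNat b + row G′ i) (∧-zeroʳ (G (suc i) zero))
      r-sum : r ≡ sum (λ i → toNat (G (suc i) zero))
      r-sum = trans (countF-sum (λ j → G zero (suc j))) (sum-cong-≗ (λ j → cong toNat (sy zero (suc j))))

  reach-trans : ∀ {n} {G : Graph n} {i j k} → Reach G i j → Reach G j k → Reach G i k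
  reach-trans here q = q
  reach-trans (step e p) q = step e (reach-trans p q)

  reach-sym : ∀ {n} {G : Graph n} → IsSimple G → ∀ {i j} → Reach G i j → Reach G j i
  reach-sym s here = here
  reach-sym s (step {i} {j} e p) = reach-trans (reach-sym s p) (step (trans (proj₁ s j i) e) here)

  reach-root : ∀ {n} {G : Graph n} T (g : Vertex T → Fin n) → (∀ u v → adj u v ≡ true → G (g u) (g v) ≡ true) →
    ∀ u → Reach G (g u) (g (root T))
  reach-root • g h here = here
  reach-root (S ◁ c) g h (inS u) = reach-root S (g ∘ inS) (λ u v → h (inS u) (inS v)) u
  reach-root (S ◁ c) g h (inC u) = reach-trans (reach-root c (g ∘ inC) (λ u v → h (inC u) (inC v)) u)
    (step (h (inC (root c)) (inS (root S)) (cong₂ _∧_ (isRoot-root c) (isRoot-root S))) here)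

  module _ {n} {G : Graph n} {κ} (rep : Rep G κ) where
    open Rep rep

    size-rep : sizeᶜ κ ≡ n
    size-rep = Data.Fin.Permutation.↔⇒≡ (mk↔ₛ′ (to ∘ vertexᶜ κ) (indexᶜ ∘ from)
        (λ i → trans (cong to (vertexᶜ-indexᶜ _)) (to-from i))
        (λ i → trans (cong indexᶜ (from-to _)) (indexᶜ-vertexᶜ κ i)))
      where import Data.Fin.Permutation

    sum-rep : ∀ (f : Fin n → ℕ) → sum f ≡ sumᶜ κ (f ∘ to)
    sum-rep f = trans (sum-permute f (mk↔ₛ′ (to ∘ vertexᶜ κ) (indexᶜ ∘ from)
        (λ i → trans (cong to (vertexᶜ-indexᶜ _)) (to-from i))
        (λ i → trans (cong indexᶜ (from-to _)) (indexᶜ-vertexᶜ κ i))))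
      (sym (sumᶜ-sum κ (f ∘ to)))

    degree-rep : ∀ u → degree G (to u) ≡ degᶜ u
    degree-rep u = trans (countF-sum (G (to u))) (trans (sum-rep (toNat ∘ G (to u))) (sumᶜ-cong κ (λ v → cong toNat (edge u v))))

    edges-rep : numEdges G ≡ n
    edges-rep = *-cancelˡ-≡ (numEdges G) n 2 (begin
      2 * numEdges G               ≡⟨ cong (numEdges G +_) (+-identityʳ _) ⟩
      numEdges G + numEdges G      ≡⟨ handshake G simple ⟩
      sum (degree G)               ≡⟨ sum-rep (degree G) ⟩
      sumᶜ κ (degree G ∘ to)       ≡⟨ sumᶜ-cong κ degree-rep ⟩
      sumᶜ κ degᶜ                  ≡⟨ sum-degᶜ κ ⟩
      2 * sizeᶜ κ                  ≡⟨ cong (2 *_) size-rep ⟩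
      2 * n                        ∎)
      where open ≡-Reasoning

    leaves-rep : numLeaves G ≡ leavesᶜ κ
    leaves-rep = trans (countF-sum isLeaf) (trans (sum-rep (toNat ∘ isLeaf)) (trans (sumᶜ-cong κ (λ u → cong (λ d → toNat (d ≡ᵇ 1)) (degree-rep u))) (countLeavesᶜ κ)))
      where
      isLeaf : Fin n → Bool
      isLeaf i = degree G i ≡ᵇ 1

    private
      r₁ = to (in₁ (root (t₁ κ)))
      r₂ = to (in₂ (root (t₂ κ)))
      r₃ = to (in₃ (root (t₃ κ)))

      roots : ∀ {T U} → (isRoot (root T) ∧ isRoot (root U)) ≡ true
      roots {T} {U} = cong₂ _∧_ (isRoot-root T) (isRoot-root U)

    connected-rep : Connected G
    connected-rep i j = subst₂ (Reach G) (to-from i) (to-from j) (reach-trans (reach (from i)) (reach-sym simple (reach (from j))))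
      where
      reach : ∀ u → Reach G (to u) r₁
      reach (in₁ u) = reach-root (t₁ κ) (to ∘ in₁) (λ u v e → trans (edge _ _) e) u
      reach (in₂ u) = reach-trans (reach-root (t₂ κ) (to ∘ in₂) (λ u v e → trans (edge _ _) e) u) (step (trans (edge _ _) (roots {t₂ κ} {t₁ κ})) here)
      reach (in₃ u) = reach-trans (reach-root (t₃ κ) (to ∘ in₃) (λ u v e → trans (edge _ _) e) u) (step (trans (edge _ _) (roots {t₃ κ} {t₁ κ})) here)

    girth-rep : HasGirth G 3
    -- `IsCycle` already demands length at least 3, so exhibiting the triangle settles both halves.
    girth-rep = (f , ≤-refl , injective , cyclic) , λ m c → proj₁ (proj₂ c)
      where
      f : Fin 3 → Fin n
      f zero = r₁
      f (suc zero) = r₂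
      f (suc (suc zero)) = r₃
      injective : ∀ {i j} → f i ≡ f j → i ≡ j
      injective {zero} {zero} e = refl
      injective {zero} {suc zero} e = contradiction (to-injective e) λ ()
      injective {zero} {suc (suc zero)} e = contradiction (to-injective e) λ ()
      injective {suc zero} {zero} e = contradiction (to-injective e) λ ()
      injective {suc zero} {suc zero} e = refl
      injective {suc zero} {suc (suc zero)} e = contradiction (to-injective e) λ ()
      injective {suc (suc zero)} {zero} e = contradiction (to-injective e) λ ()
      injective {suc (suc zero)} {suc zero} e = contradiction (to-injective e) λ ()
      injective {suc (suc zero)} {suc (suc zero)} e = refl
      cyclic : ∀ (i j : Fin 3) → (toℕ j ≡ suc (toℕ i) ⊎ (suc (toℕ i) ≡ 3 × toℕ j ≡ 0)) → G (f i) (f j) ≡ true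
      cyclic zero (suc zero) _ = trans (edge _ _) (roots {t₁ κ} {t₂ κ})
      cyclic (suc zero) (suc (suc zero)) _ = trans (edge _ _) (roots {t₂ κ} {t₃ κ})
      cyclic (suc (suc zero)) zero _ = trans (edge _ _) (roots {t₃ κ} {t₁ κ})
      cyclic zero zero (inj₁ ())
      cyclic zero zero (inj₂ (() , _))
      cyclic zero (suc (suc zero)) (inj₁ ())
      cyclic zero (suc (suc zero)) (inj₂ (() , _))
      cyclic (suc zero) zero (inj₁ ())
      cyclic (suc zero) zero (inj₂ (() , _))
      cyclic (suc zero) (suc zero) (inj₁ ())
      cyclic (suc zero) (suc zero) (inj₂ (() , _))
      cyclic (suc (suc zero)) (suc zero) (inj₁ ())
      cyclic (suc (suc zero)) (suc zero) (inj₂ (_ , ()))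
      cyclic (suc (suc zero)) (suc (suc zero)) (inj₁ ())
      cyclic (suc (suc zero)) (suc (suc zero)) (inj₂ (_ , ()))

    𝒰-rep : 𝒰 n (leavesᶜ κ) 3 G
    𝒰-rep = simple , connected-rep , edges-rep , leaves-rep , girth-rep

-- Evaluation of a code by successive elimination.

module Value (S : CommutativeSemiring 0ℓ 0ℓ) where

  open import Data.Product using (_×_; _,_)
  open import Function using (_∘_)
  open import Relation.Binary.PropositionalEquality using (_≡_; _≢_; refl; cong; cong₂)
  open import Relation.Nullary using (contradiction)
  open CommutativeSemiring S using (Carrier; _+_; _*_)
  open RootedTree

  Weight : Set
  Weight = Carrier × Carrier

  -- A pair (e , b) stands for a row e I + b L of the matrix; merging eliminates a pendant row.
  merge : Weight → Weight → Weight
  merge (e , b) (e′ , b′) = e * (e′ + b′) + b * e′ , b * (e′ + b′)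

  val : ∀ T → (Vertex T → Weight) → Weight
  val • w = w here
  val (S ◁ c) w = merge (val S (w ∘ inS)) (val c (w ∘ inC))

  -- det (diag e + diag b · L(K₃))
  triangleValue : Weight → Weight → Weight → Carrier
  triangleValue (e₁ , b₁) (e₂ , b₂) (e₃ , b₃) =
    e₁ * ((e₂ * e₃ + (e₂ * b₃ + b₂ * e₃)) + ((e₂ * b₃ + b₂ * e₃) + (b₂ * b₃ + (b₂ * b₃ + b₂ * b₃))))
    + b₁ * ((e₂ * e₃ + e₂ * e₃) + ((e₂ * b₃ + b₂ * e₃) + ((e₂ * b₃ + b₂ * e₃) + (e₂ * b₃ + b₂ * e₃))))

  valᶜ : ∀ κ → (Vertexᶜ κ → Weight) → Carrier
  valᶜ κ w = triangleValue (val (t₁ κ) (w ∘ in₁)) (val (t₂ κ) (w ∘ in₂)) (val (t₃ κ) (w ∘ in₃))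

  val-cong : ∀ T {w w′ : Vertex T → Weight} → (∀ u → w u ≡ w′ u) → val T w ≡ val T w′
  val-cong • e = e here
  val-cong (S ◁ c) e = cong₂ merge (val-cong S (e ∘ inS)) (val-cong c (e ∘ inC))

  valᶜ-cong : ∀ κ {w w′ : Vertexᶜ κ → Weight} → (∀ u → w u ≡ w′ u) → valᶜ κ w ≡ valᶜ κ w′
  valᶜ-cong κ e rewrite val-cong (t₁ κ) (e ∘ in₁) | val-cong (t₂ κ) (e ∘ in₂) | val-cong (t₃ κ) (e ∘ in₃) = refl

  -- The weights left after the row of the new leaf has been eliminated: its parent takes the merged
  -- weight and all others keep theirs.
  absorb : ∀ {T} (p : Vertex T) → (Vertex (addLeaf T p) → Weight) → Vertex T → Weight
  absorb here w here = merge (w (inS here)) (w (inC here))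
  absorb (inS p) w (inS u) = absorb p (w ∘ inS) u
  absorb (inS p) w (inC u) = w (inC u)
  absorb (inC p) w (inS u) = w (inS u)
  absorb (inC p) w (inC u) = absorb p (w ∘ inC) u

  val-addLeaf : ∀ {T} (p : Vertex T) w → val (addLeaf T p) w ≡ val T (absorb p w)
  val-addLeaf here w = refl
  val-addLeaf (inS {c = c} p) w = cong (λ t → merge t (val c (w ∘ inC))) (val-addLeaf p (w ∘ inS))
  val-addLeaf (inC p) w = cong (merge _) (val-addLeaf p (w ∘ inC))

  absorb-p : ∀ {T} (p : Vertex T) w → absorb p w p ≡ merge (w (emb p p)) (w (new p))
  absorb-p here w = refl
  absorb-p (inS p) w = absorb-p p (w ∘ inS)
  absorb-p (inC p) w = absorb-p p (w ∘ inC)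

  absorb-≢ : ∀ {T} (p : Vertex T) w u → u ≢ p → absorb p w u ≡ w (emb p u)
  absorb-≢ here w here ne = contradiction refl ne
  absorb-≢ (inS p) w (inS u) ne = absorb-≢ p (w ∘ inS) u (ne ∘ cong inS)
  absorb-≢ (inS p) w (inC u) ne = refl
  absorb-≢ (inC p) w (inS u) ne = refl
  absorb-≢ (inC p) w (inC u) ne = absorb-≢ p (w ∘ inC) u (ne ∘ cong inC)

  absorbᶜ : ∀ {κ} (p : Vertexᶜ κ) → (Vertexᶜ (addLeafᶜ κ p) → Weight) → Vertexᶜ κ → Weight
  absorbᶜ (in₁ p) w (in₁ u) = absorb p (w ∘ in₁) u
  absorbᶜ (in₁ p) w (in₂ u) = w (in₂ u)
  absorbᶜ (in₁ p) w (in₃ u) = w (in₃ u)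
  absorbᶜ (in₂ p) w (in₁ u) = w (in₁ u)
  absorbᶜ (in₂ p) w (in₂ u) = absorb p (w ∘ in₂) u
  absorbᶜ (in₂ p) w (in₃ u) = w (in₃ u)
  absorbᶜ (in₃ p) w (in₁ u) = w (in₁ u)
  absorbᶜ (in₃ p) w (in₂ u) = w (in₂ u)
  absorbᶜ (in₃ p) w (in₃ u) = absorb p (w ∘ in₃) u

  valᶜ-addLeaf : ∀ {κ} (p : Vertexᶜ κ) w → valᶜ (addLeafᶜ κ p) w ≡ valᶜ κ (absorbᶜ p w)
  valᶜ-addLeaf {κ} (in₁ p) w rewrite val-addLeaf p (w ∘ in₁) = refl
  valᶜ-addLeaf {κ} (in₂ p) w rewrite val-addLeaf p (w ∘ in₂) = refl
  valᶜ-addLeaf {κ} (in₃ p) w rewrite val-addLeaf p (w ∘ in₃) = refl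

  absorbᶜ-p : ∀ {κ} (p : Vertexᶜ κ) w → absorbᶜ p w p ≡ merge (w (embᶜ p p)) (w (newᶜ p))
  absorbᶜ-p (in₁ p) w = absorb-p p (w ∘ in₁)
  absorbᶜ-p (in₂ p) w = absorb-p p (w ∘ in₂)
  absorbᶜ-p (in₃ p) w = absorb-p p (w ∘ in₃)

  absorbᶜ-≢ : ∀ {κ} (p : Vertexᶜ κ) w u → u ≢ p → absorbᶜ p w u ≡ w (embᶜ p u)
  absorbᶜ-≢ (in₁ p) w (in₁ u) ne = absorb-≢ p (w ∘ in₁) u (ne ∘ cong in₁)
  absorbᶜ-≢ (in₁ p) w (in₂ u) ne = refl
  absorbᶜ-≢ (in₁ p) w (in₃ u) ne = refl
  absorbᶜ-≢ (in₂ p) w (in₁ u) ne = refl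
  absorbᶜ-≢ (in₂ p) w (in₂ u) ne = absorb-≢ p (w ∘ in₂) u (ne ∘ cong in₂)
  absorbᶜ-≢ (in₂ p) w (in₃ u) ne = refl
  absorbᶜ-≢ (in₃ p) w (in₁ u) ne = refl
  absorbᶜ-≢ (in₃ p) w (in₂ u) ne = refl
  absorbᶜ-≢ (in₃ p) w (in₃ u) ne = absorb-≢ p (w ∘ in₃) u (ne ∘ cong in₃)

-- Determinants of weighted Laplacians of represented graphs.

module Elimination (R : CommutativeRing 0ℓ 0ℓ) where

  open import Defs using (Graph; degree)
  open import Data.Bool using (true; false; if_then_else_)
  open import Data.Nat using (zero; suc)
  open import Data.Fin using (Fin; zero; suc; punchIn; punchOut; _≟_)
  open import Data.Fin.Properties using (punchInᵢ≢i; punchIn-injective; punchIn-punchOut)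
  open import Data.Product using (_,_; proj₁; proj₂) renaming (_×_ to _∧_)
  open import Function using (_∘_)
  open import Relation.Binary.PropositionalEquality as ≡ using (_≡_; _≢_)
  open import Relation.Nullary using (yes; no; contradiction)
  open CommutativeRing R hiding (zero)
  open import Algebra.Properties.Ring ring using (-‿distribˡ-*; -‿distribʳ-*; -‿involutive; -0#≈0#)
  open import Algebra.Properties.Semiring.Mult semiring using (_×_; ×-comm-*; ×-cong)
  open import Algebra.Solver.Ring.NaturalCoefficients.Default commutativeSemiring
  open import Relation.Binary.Reasoning.Setoid setoid
  open RootedTree using (Vertexᶜ; here; in₁; in₂; in₃; addLeafᶜ; triangle; base; ext; leafView; adjᶜ; adjᶜ-irrefl; newᶜ)
  open Value commutativeSemiring
  open Representation
  open Membership using (size-rep; degree-rep; degᶜ)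
  open Determinant R

  -- The matrix diag e + diag b · L(G) for the vertex weights (e , b).
  record IsWeighted {n} (G : Graph n) (w : Fin n → Weight) (M : Matrix n) : Set where
    field
      diagonal : ∀ i → M i i ≈ proj₁ (w i) + degree G i × proj₂ (w i)
      off-diagonal : ∀ i j → i ≢ j → M i j ≈ (if G i j then - proj₂ (w i) else 0#)
  open IsWeighted

  -- x = y - z, in a form suited to semiring computations.
  _≃_∸_ : Carrier → Carrier → Carrier → Set
  x ≃ y ∸ z = x + z ≈ y

  private
    cancel : ∀ {x y z} → x + z ≈ y + z → x ≈ y
    cancel {x} {y} {z} e = begin
      x               ≈⟨ sym (+-identityʳ x) ⟩
      x + 0#          ≈⟨ +-congˡ (sym (-‿inverseʳ z)) ⟩
      x + (z - z)     ≈⟨ sym (+-assoc _ _ _) ⟩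
      x + z - z       ≈⟨ +-congʳ e ⟩
      y + z - z       ≈⟨ +-assoc _ _ _ ⟩
      y + (z - z)     ≈⟨ +-congˡ (-‿inverseʳ z) ⟩
      y + 0#          ≈⟨ +-identityʳ y ⟩
      y               ∎

  ∸-self : ∀ x → x ≃ x ∸ 0#
  ∸-self x = +-identityʳ x

  ∸-neg : ∀ x → (- x) ≃ 0# ∸ x
  ∸-neg x = -‿inverseˡ x

  ∸-sub : ∀ {x y z x′ y′ z′} → x ≃ y ∸ z → x′ ≃ y′ ∸ z′ → (x - x′) ≃ y + z′ ∸ (z + y′)
  ∸-sub {x} {y} {z} {x′} {y′} {z′} p q = begin
    x - x′ + (z + y′)          ≈⟨ +-congˡ (+-congˡ (sym q)) ⟩
    x - x′ + (z + (x′ + z′))   ≈⟨ solve 5 (λ x nx′ z x′ z′ → x :+ nx′ :+ (z :+ (x′ :+ z′)) := (x :+ z) :+ z′ :+ (x′ :+ nx′)) refl x (- x′) z x′ z′ ⟩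
    (x + z) + z′ + (x′ - x′)   ≈⟨ +-cong (+-congʳ p) (-‿inverseʳ x′) ⟩
    y + z′ + 0#                ≈⟨ +-identityʳ _ ⟩
    y + z′                     ∎

  ∸-mul : ∀ {x y z x′ y′ z′} → x ≃ y ∸ z → x′ ≃ y′ ∸ z′ → (x * x′) ≃ y * y′ + z * z′ ∸ (y * z′ + z * y′)
  ∸-mul {x} {y} {z} {x′} {y′} {z′} p q = begin
    x * x′ + (y * z′ + z * y′)                        ≈⟨ +-congˡ (+-cong (*-congʳ (sym p)) (*-congˡ (sym q))) ⟩
    x * x′ + ((x + z) * z′ + z * (x′ + z′))           ≈⟨ solve 4 (λ x z x′ z′ → x :* x′ :+ ((x :+ z) :* z′ :+ z :* (x′ :+ z′)) := (x :+ z) :* (x′ :+ z′) :+ z :* z′) refl x z x′ z′ ⟩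
    (x + z) * (x′ + z′) + z * z′                      ≈⟨ +-congʳ (*-cong p q) ⟩
    y * y′ + z * z′                                   ∎

  private
    module Step {n} {G : Graph (suc n)} {κ} (p : Vertexᶜ κ) (rep : Rep G (addLeafᶜ κ p))
                {w : Fin (suc n) → Weight} {M : Matrix (suc n)} (W : IsWeighted G w M) where
      open Peel p rep
      open Rep rep

      w′ : Fin n → Weight
      w′ i with i ≟ u
      ... | yes _ = merge (w (punchIn v u)) (w v)
      ... | no _ = w (punchIn v i)

      row : ∀ j → j ≢ u → M v (punchIn v j) ≈ 0#
      row j ne = trans (off-diagonal W v (punchIn v j) (punchInᵢ≢i v j ∘ ≡.sym))
        (reflexive (≡.cong (λ b → if b then - proj₂ (w v) else 0#) (pendant-only j ne)))

      column : ∀ i → i ≢ u → M (punchIn v i) v ≈ 0#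
      column i ne = trans (off-diagonal W (punchIn v i) v (punchInᵢ≢i v i))
        (reflexive (≡.cong (λ b → if b then - proj₂ (w (punchIn v i)) else 0#) (≡.trans (proj₁ simple _ v) (pendant-only i ne))))

      M-vv : M v v ≈ proj₁ (w v) + proj₂ (w v)
      M-vv = trans (diagonal W v) (+-congˡ (trans (×-cong degree-v refl) (+-identityʳ _)))

      M-vu : M v (punchIn v u) ≈ - proj₂ (w v)
      M-vu = trans (off-diagonal W v (punchIn v u) (punchInᵢ≢i v u ∘ ≡.sym))
        (reflexive (≡.cong (λ b → if b then - proj₂ (w v) else 0#) pendant))

      M-uv : M (punchIn v u) v ≈ - proj₂ (w (punchIn v u))
      M-uv = trans (off-diagonal W (punchIn v u) v (punchInᵢ≢i v u))
        (reflexive (≡.cong (λ b → if b then - proj₂ (w (punchIn v u)) else 0#) (≡.trans (proj₁ simple _ v) pendant)))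

      M-uu : M (punchIn v u) (punchIn v u) ≈ proj₁ (w (punchIn v u)) + (proj₂ (w (punchIn v u)) + degree (delete v G) u × proj₂ (w (punchIn v u)))
      M-uu = trans (diagonal W (punchIn v u)) (+-congˡ (×-cong degree-u refl))

      -- The diagonal entry of the neighbour. Its degree is `d` plus one for the deleted edge; that
      -- extra one produces a term `b′ * b`, which the product of the two off-diagonal entries
      -- cancels. What remains has the merged weight and degree `d`.
      corner : ∀ e b e′ b′ d → (e′ + b′) * (e + (b + d × b)) - (- b′) * (- b) ≈ (e * (e′ + b′) + b * e′) + d × (b * (e′ + b′))
      corner e b e′ b′ d = cancel (begin
        (e′ + b′) * (e + (b + d × b)) - (- b′) * (- b) + b′ * b
          ≈⟨ +-congʳ (+-congˡ (-‿cong (trans (sym (-‿distribˡ-* _ _)) (trans (-‿cong (sym (-‿distribʳ-* _ _))) (-‿involutive _))))) ⟩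
        (e′ + b′) * (e + (b + d × b)) - b′ * b + b′ * b
          ≈⟨ trans (+-assoc _ _ _) (trans (+-congˡ (-‿inverseˡ _)) (+-identityʳ _)) ⟩
        (e′ + b′) * (e + (b + d × b))
          ≈⟨ solve 5 (λ e b e′ b′ db → (e′ :+ b′) :* (e :+ (b :+ db)) := (e :* (e′ :+ b′) :+ b :* e′) :+ (e′ :+ b′) :* db :+ b′ :* b) refl e b e′ b′ (d × b) ⟩
        (e * (e′ + b′) + b * e′) + (e′ + b′) * (d × b) + b′ * b
          ≈⟨ +-congʳ (+-congˡ (trans (×-comm-* d _ _) (×-cong {d} ≡.refl (*-comm _ _)))) ⟩
        (e * (e′ + b′) + b * e′) + d × (b * (e′ + b′)) + b′ * b ∎)

      weighted : IsWeighted (delete v G) w′ (eliminated v u M)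
      weighted = record { diagonal = diag ; off-diagonal = off }
        where
        diag : ∀ i → eliminated v u M i i ≈ proj₁ (w′ i) + degree (delete v G) i × proj₂ (w′ i)
        diag i with i ≟ u
        ... | no ne = trans (diagonal W (punchIn v i)) (+-congˡ (×-cong (degree-other i ne) refl))
        ... | yes ≡.refl = trans (+-cong (*-cong M-vv M-uu) (-‿cong (*-cong M-vu M-uv))) (corner _ _ _ _ (degree (delete v G) u))
        off : ∀ i j → i ≢ j → eliminated v u M i j ≈ (if delete v G i j then - proj₂ (w′ i) else 0#)
        off i j ne with i ≟ u | j ≟ u
        ... | no _ | _ = off-diagonal W _ _ (ne ∘ punchIn-injective v _ _)
        ... | yes ≡.refl | yes ≡.refl = contradiction ≡.refl ne
        ... | yes ≡.refl | no _ = trans (*-cong M-vv (off-diagonal W _ _ (ne ∘ punchIn-injective v _ _))) (scaled (delete v G u j))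
          where
          scaled : ∀ b → (proj₁ (w v) + proj₂ (w v)) * (if b then - proj₂ (w (punchIn v u)) else 0#)
                       ≈ (if b then - (proj₂ (w (punchIn v u)) * (proj₁ (w v) + proj₂ (w v))) else 0#)
          scaled true = trans (sym (-‿distribʳ-* _ _)) (-‿cong (*-comm _ _))
          scaled false = zeroʳ _

      absorbed : ∀ x → absorbᶜ p (w ∘ to) x ≡ w′ (to′ x)
      absorbed x with to′ x ≟ u
      ... | yes e with Rep.to-injective rep′ {x} {p} e
      ... | ≡.refl = ≡.trans (absorbᶜ-p p (w ∘ to)) (≡.cong (λ t → merge (w t) (w v)) (≡.sym (punchIn-to′ p)))
      absorbed x | no ne = ≡.trans (absorbᶜ-≢ p (w ∘ to) x (ne ∘ ≡.cong to′)) (≡.cong w (≡.sym (punchIn-to′ x)))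

  det₃ : ∀ (M : Matrix 3) → let i = zero; j = suc zero; k = suc (suc zero) in
    determinant 3 M ≈ M i i * (M j j * M k k - M j k * M k j)
      - (M i j * (M j i * M k k - M j k * M k i) - M i k * (M j i * M k j - M j j * M k i))
  det₃ M = trans (det-suc₀ 2 M) (+-cong (*-congˡ (det₂ _)) (-‿cong (trans (alt-suc _) (+-cong (*-congˡ (det₂ _))
      (-‿cong (trans (alt-suc _) (drop (*-congˡ (det₂ _)))))))))
    where
    drop : ∀ {f : Fin 0 → Carrier} {x y} → x ≈ y → x - alternatingSum f ≈ y
    drop e = trans (+-cong e (trans (-‿cong (alt-zero _)) -0#≈0#)) (+-identityʳ _)
    det₁ : ∀ (M : Matrix 1) → determinant 1 M ≈ M zero zero
    det₁ M = trans (det-suc₀ 0 M) (drop (trans (*-congˡ (det-zero _)) (*-identityʳ _)))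
    det₂ : ∀ (M : Matrix 2) → determinant 2 M ≈ M zero zero * M (suc zero) (suc zero) - M zero (suc zero) * M (suc zero) zero
    det₂ M = trans (det-suc₀ 1 M) (+-cong (*-congˡ (det₁ _)) (-‿cong (trans (alt-suc _) (drop (*-congˡ (det₁ _))))))

  -- Each entry is a pair of a positive and a negative part. Carrying the pairs through the
  -- expansion turns the claim into an identity without subtraction, within reach of the semiring
  -- solver.
  det-triangle : ∀ (M : Matrix 3) (w : Fin 3 → Weight) →
    (∀ i → M i i ≈ proj₁ (w i) + (proj₂ (w i) + proj₂ (w i))) → (∀ i j → i ≢ j → M i j ≈ - proj₂ (w i)) →
    determinant 3 M ≈ triangleValue (w zero) (w (suc zero)) (w (suc (suc zero)))
  det-triangle M w diag off = cancel (trans difference (solve 6 (λ e₀ b₀ e₁ b₁ e₂ b₂ →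
      let d₀ = e₀ :+ (b₀ :+ b₀) ; d₁ = e₁ :+ (b₁ :+ b₁) ; d₂ = e₂ :+ (b₂ :+ b₂)
          D = sub (mul (pos d₀) (sub (mul (pos d₁) (pos d₂)) (mul (neg b₁) (neg b₂))))
                  (sub (mul (neg b₀) (sub (mul (neg b₁) (pos d₂)) (mul (neg b₁) (neg b₂))))
                       (mul (neg b₀) (sub (mul (neg b₁) (neg b₂)) (mul (pos d₁) (neg b₂)))))
      in proj₁ D :=
        (e₀ :* ((e₁ :* e₂ :+ (e₁ :* b₂ :+ b₁ :* e₂)) :+ ((e₁ :* b₂ :+ b₁ :* e₂) :+ (b₁ :* b₂ :+ (b₁ :* b₂ :+ b₁ :* b₂))))
          :+ b₀ :* ((e₁ :* e₂ :+ e₁ :* e₂) :+ ((e₁ :* b₂ :+ b₁ :* e₂) :+ ((e₁ :* b₂ :+ b₁ :* e₂) :+ (e₁ :* b₂ :+ b₁ :* e₂)))))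
        :+ proj₂ D)
      refl _ _ _ _ _ _))
    where
    Pair : Set
    Pair = Polynomial 6 ∧ Polynomial 6
    pos neg : Polynomial 6 → Pair
    pos x = x , con 0
    neg x = con 0 , x
    sub mul : Pair → Pair → Pair
    sub (y , z) (y′ , z′) = y :+ z′ , z :+ y′
    mul (y , z) (y′ , z′) = y :* y′ :+ z :* z′ , y :* z′ :+ z :* y′
    onDiagonal : ∀ i → M i i ≃ proj₁ (w i) + (proj₂ (w i) + proj₂ (w i)) ∸ 0#
    onDiagonal i = trans (∸-self _) (diag i)
    offDiagonal : ∀ i j → i ≢ j → M i j ≃ 0# ∸ proj₂ (w i)
    offDiagonal i j ne = trans (+-congʳ (off i j ne)) (∸-neg _)
    difference = trans (+-congʳ (det₃ M)) (∸-sub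
      (∸-mul (onDiagonal zero) (∸-sub (∸-mul (onDiagonal (suc zero)) (onDiagonal (suc (suc zero))))
                                      (∸-mul (offDiagonal (suc zero) (suc (suc zero)) λ ()) (offDiagonal (suc (suc zero)) (suc zero) λ ()))))
      (∸-sub (∸-mul (offDiagonal zero (suc zero) λ ()) (∸-sub (∸-mul (offDiagonal (suc zero) zero λ ()) (onDiagonal (suc (suc zero))))
                                                             (∸-mul (offDiagonal (suc zero) (suc (suc zero)) λ ()) (offDiagonal (suc (suc zero)) zero λ ()))))
             (∸-mul (offDiagonal zero (suc (suc zero)) λ ()) (∸-sub (∸-mul (offDiagonal (suc zero) zero λ ()) (offDiagonal (suc (suc zero)) (suc zero) λ ()))
                                                                   (∸-mul (onDiagonal (suc zero)) (offDiagonal (suc (suc zero)) zero λ ()))))))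

  private
    -- The vertices a, b, c of the triangle are moved to the front by conjugation.
    det-base : ∀ n {G : Graph n} (rep : Rep G triangle) {w M} → IsWeighted G w M → determinant n M ≈ valᶜ triangle (w ∘ Rep.to rep)
    det-base n {G} rep {w} {M} W with size-rep rep
    ... | ≡.refl = begin
      determinant 3 M                                ≈⟨ sym (trans (det-lift₁-front b′ (λ i j → M (front a i) (front a j))) (det-front a M)) ⟩
      determinant 3 (λ i j → M (σ i) (σ j))          ≈⟨ det-cong 3 (λ i j → reflexive (≡.cong₂ M (σ≡ i) (σ≡ j))) ⟩
      determinant 3 (λ i j → M (to (f i)) (to (f j)))
        ≈⟨ det-triangle _ (w ∘ to ∘ f)
             (λ i → trans (IsWeighted.diagonal W _) (+-congˡ (trans (×-cong (≡.trans (degree-rep rep (f i)) (degree≡2 i)) refl) (+-congˡ (+-identityʳ _)))))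
             (λ i j ne → trans (IsWeighted.off-diagonal W _ _ (f-injective i j ne ∘ to-injective))
               (reflexive (≡.cong (λ b → if b then - proj₂ (w (to (f i))) else 0#) (≡.trans (edge _ _) (adjacent i j ne))))) ⟩
      valᶜ triangle (w ∘ to)                         ∎
      where
      open Rep rep
      f : Fin 3 → Vertexᶜ triangle
      f zero = in₁ here
      f (suc zero) = in₂ here
      f (suc (suc zero)) = in₃ here
      a = to (in₁ here)
      a≢b : a ≢ to (in₂ here)
      a≢b e = contradiction (to-injective e) λ ()
      a≢c : a ≢ to (in₃ here)
      a≢c e = contradiction (to-injective e) λ ()
      b′ = punchOut a≢b
      c′ = punchOut a≢c
      b′≢c′ : b′ ≢ c′
      b′≢c′ e = contradiction (to-injective {in₂ here} {in₃ here}
        (≡.trans (≡.sym (punchIn-punchOut a≢b)) (≡.trans (≡.cong (punchIn a) e) (punchIn-punchOut a≢c)))) λ ()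
      σ : Fin 3 → Fin 3
      σ i = front a (lift₁ (front b′) i)
      σ≡ : ∀ i → σ i ≡ to (f i)
      σ≡ zero = ≡.refl
      σ≡ (suc zero) = punchIn-punchOut a≢b
      σ≡ (suc (suc zero)) = ≡.trans (≡.cong (punchIn a) (≡.trans (≡.cong (punchIn b′) (only zero (punchOut b′≢c′))) (punchIn-punchOut b′≢c′))) (punchIn-punchOut a≢c)
        where
        only : ∀ (i j : Fin 1) → i ≡ j
        only zero zero = ≡.refl
      degree≡2 : ∀ i → degᶜ (f i) ≡ 2
      degree≡2 zero = ≡.refl
      degree≡2 (suc zero) = ≡.refl
      degree≡2 (suc (suc zero)) = ≡.refl
      adjacent : ∀ i j → i ≢ j → adjᶜ (f i) (f j) ≡ true
      adjacent zero zero ne = contradiction ≡.refl ne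
      adjacent zero (suc zero) _ = ≡.refl
      adjacent zero (suc (suc zero)) _ = ≡.refl
      adjacent (suc zero) zero _ = ≡.refl
      adjacent (suc zero) (suc zero) ne = contradiction ≡.refl ne
      adjacent (suc zero) (suc (suc zero)) _ = ≡.refl
      adjacent (suc (suc zero)) zero _ = ≡.refl
      adjacent (suc (suc zero)) (suc zero) _ = ≡.refl
      adjacent (suc (suc zero)) (suc (suc zero)) ne = contradiction ≡.refl ne
      f-injective : ∀ i j → i ≢ j → f i ≢ f j
      f-injective i j ne e = contradiction (≡.trans (≡.sym (adjacent i j ne)) (≡.trans (≡.cong (adjᶜ (f i)) (≡.sym e)) (adjᶜ-irrefl (f i)))) λ ()

  -- Eliminating a pendant row yields the weighted Laplacian of the smaller graph again, and its new
  -- weights are those of `absorbᶜ`, under which the fold does not change.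
  det-rep : ∀ n {G : Graph n} {κ} (rep : Rep G κ) {w M} → IsWeighted G w M → determinant n M ≈ valᶜ κ (w ∘ Rep.to rep)
  det-rep n {κ = κ} rep W with leafView κ
  det-rep n rep W | base = det-base n rep W
  -- The leaf of an extended code would be a vertex of a graph without vertices.
  det-rep zero rep W | ext κ p with Rep.to rep (newᶜ p)
  ... | ()
  det-rep (suc n) rep {w} {M} W | ext κ p = begin
    determinant _ M                        ≈⟨ det-eliminate v u M row column ⟩
    determinant _ (eliminated v u M)       ≈⟨ det-rep n rep′ weighted ⟩
    valᶜ κ (w′ ∘ to′)                      ≈⟨ reflexive (≡.sym (≡.trans (valᶜ-addLeaf p _) (valᶜ-cong κ absorbed))) ⟩
    valᶜ (addLeafᶜ κ p) (w ∘ Rep.to rep)   ∎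
    where
    open Peel p rep
    open Step p rep W

-- Signs, natural coefficients, and the value at x = 1.

module Counting where

  import Algebra.Construct.DirectProduct as DirectProduct
  open import Data.Nat using (ℕ; zero; suc; _+_; _*_; _∸_; _≤_; _<_; z≤n; s≤s)
  open import Data.Nat.Properties
  open import Data.Integer as ℤ using (ℤ; +_)
  import Data.Integer.Properties as ℤ
  open import Algebra.Properties.CommutativeSemigroup ℤ.*-commutativeSemigroup using () renaming (interchange to ℤ-interchange)
  open import Algebra.Properties.CommutativeSemigroup +-commutativeSemigroup using (interchange)
  open import Data.Bool using (true; false; if_then_else_)
  open import Data.Fin using (toℕ)
  open import Data.Fin.Properties using (toℕ-injective)
  open import Data.Product using (_×_; _,_; proj₁; proj₂; ∃-syntax)
  open import Data.Sum using (inj₁; inj₂)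
  open import Function using (_∘_)
  open import Relation.Binary.PropositionalEquality
  open import Relation.Nullary using (contradiction)
  open import Defs using (Graph; degree; charMatrix; laplacianCharPoly; coeff; c)
  open RootedTree
  open Representation using (Rep)
  open IntegerSeries using (⟦_⟧; seriesRing; ⊖_; ⟦det⟧; ⟪_⟫; at)
  module Zx = IntegerSeries
  module Nx = PowerSeries +-*-commutativeSemiring
  open Elimination seriesRing using (IsWeighted; det-rep)
  private module R = CommutativeRing seriesRing
  private module VR = Value R.commutativeSemiring
  open import Algebra.Properties.Semiring.Mult R.semiring using () renaming (_×_ to _×ᴿ_)

  -- A polynomial with natural coefficients is kept together with its value at x = 1.
  S : CommutativeSemiring 0ℓ 0ℓ
  S = DirectProduct.commutativeSemiring Nx.seriesSemiring +-*-commutativeSemiring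

  open CommutativeSemiring S using () renaming (Carrier to Pol; _+_ to _+ˢ_; _*_ to _*ˢ_; 1# to 1ˢ)

  x : Pol
  x = Nx.X , 1

  open Value S using (val; valᶜ; Weight)

  -- det (x I + L) of the graph described by κ
  P : Code → Pol
  P κ = valᶜ κ (λ _ → x , 1ˢ)

  coefficient : ℕ → Pol → ℕ
  coefficient k p = proj₁ p k

  value₁ : Pol → ℕ
  value₁ = proj₂

  sign : ℕ → ℤ
  sign zero = + 1
  sign (suc n) = ℤ.- sign n

  sign-+ : ∀ m n → sign (m + n) ≡ sign m ℤ.* sign n
  sign-+ zero n = sym (ℤ.*-identityˡ _)
  sign-+ (suc m) n = trans (cong ℤ.-_ (sign-+ m n)) (ℤ.neg-distribˡ-* (sign m) (sign n))

  sign-double : ∀ n → sign (n + n) ≡ + 1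
  sign-double zero = refl
  sign-double (suc n) = trans (cong (ℤ.-_ ∘ sign) (+-suc n n)) (trans (ℤ.neg-involutive _) (sign-double n))

  -- f(x) = (-1)^m g(-x)
  record Twisted (m : ℕ) (f : Zx.Series) (g : Pol) : Set where
    constructor twist
    field untwist : ∀ k → f k ≡ sign (m + k) ℤ.* + coefficient k g
  open Twisted

  twisted-+ : ∀ {m f f′ g g′} → Twisted m f g → Twisted m f′ g′ → Twisted m (f Zx.⊕ f′) (g +ˢ g′)
  twisted-+ {m} p q = twist λ k → trans (cong₂ ℤ._+_ (untwist p k) (untwist q k)) (sym (ℤ.*-distribˡ-+ (sign (m + k)) _ _))

  private
    sign-* : ∀ m n a b → (sign m ℤ.* + a) ℤ.* (sign n ℤ.* + b) ≡ sign (m + n) ℤ.* + (a * b)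
    sign-* m n a b = trans (ℤ-interchange (sign m) (+ a) (sign n) (+ b))
      (cong₂ ℤ._*_ (sym (sign-+ m n)) (sym (ℤ.pos-* a b)))

    twisted-⊛ : ∀ m m′ (f f′ : Zx.Series) (g g′ : Nx.Series) →
      (∀ k → f k ≡ sign (m + k) ℤ.* + g k) → (∀ k → f′ k ≡ sign (m′ + k) ℤ.* + g′ k) →
      ∀ k → (f Zx.⊛ f′) k ≡ sign (m + m′ + k) ℤ.* + (g Nx.⊛ g′) k
    twisted-⊛ m m′ f f′ g g′ p q zero = trans (cong₂ ℤ._*_ (p 0) (q 0)) (trans (sign-* (m + 0) (m′ + 0) (g 0) (g′ 0))
      (cong (λ t → sign t ℤ.* + (g 0 * g′ 0)) (interchange m 0 m′ 0)))
    twisted-⊛ m m′ f f′ g g′ p q (suc k) = trans (cong₂ ℤ._+_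
        (trans (cong₂ ℤ._*_ (p 0) (q (suc k))) (trans (sign-* (m + 0) (m′ + suc k) (g 0) (g′ (suc k)))
          (cong (λ t → sign t ℤ.* + (g 0 * g′ (suc k))) (interchange m 0 m′ (suc k)))))
        -- Passing to `tail f` shifts the index by one; the sign is kept by raising the twist from
        -- `m` to `suc m`.
        (trans (twisted-⊛ (suc m) m′ (Zx.tail f) f′ (Nx.tail g) g′ (λ k → trans (p (suc k)) (cong (λ t → sign t ℤ.* + g (suc k)) (+-suc m k))) q k)
          (cong (λ t → sign t ℤ.* + (Nx.tail g Nx.⊛ g′) k) (sym (+-suc (m + m′) k)))))
      (sym (ℤ.*-distribˡ-+ (sign (m + m′ + suc k)) _ _))

  twisted-* : ∀ {m m′ f f′ g g′} → Twisted m f g → Twisted m′ f′ g′ → Twisted (m + m′) (f Zx.⊛ f′) (g *ˢ g′)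
  twisted-* {m} {m′} {f} {f′} {g} {g′} p q = twist (twisted-⊛ m m′ f f′ (proj₁ g) (proj₁ g′) (untwist p) (untwist q))

  TwistedWeight : ℕ → VR.Weight → Weight → Set
  TwistedWeight m (e , b) (e′ , b′) = Twisted m e e′ × Twisted m b b′

  private
    -- The matrix `λ I - L` has e = λ and b = -1 at every vertex. Writing λ = -x and taking -1 out
    -- of each row gives the weight `(x , 1ˢ)`, a twist by 1 per vertex.
    λ₋₁ : VR.Weight
    λ₋₁ = Zx.X , ⊖ Zx.𝟙

    twisted-base : TwistedWeight 1 λ₋₁ (x , 1ˢ)
    twisted-base = twist (λ { zero → refl ; (suc zero) → refl ; (suc (suc k)) → sym (ℤ.*-zeroʳ (sign (suc (suc (suc k))))) })
                 , twist (λ { zero → refl ; (suc k) → sym (ℤ.*-zeroʳ (sign (suc (suc k)))) })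

  -- Each product in `merge` takes one factor from either tree, so twists add up; the summands
  -- always carry the same twist because `e` and `b` of a tree share theirs.
  twisted-val : ∀ T → TwistedWeight (size T) (VR.val T (λ _ → λ₋₁)) (val T (λ _ → x , 1ˢ))
  twisted-val • = twisted-base
  twisted-val (T ◁ t) with twisted-val T | twisted-val t
  ... | e , b | e′ , b′ = twisted-+ {m = m} (twisted-* {size T} e a′) (twisted-* {size T} b e′) , twisted-* {size T} b a′
    where
    m = size T + size t
    a′ = twisted-+ {m = size t} e′ b′

  twisted-valᶜ : ∀ κ → Twisted (sizeᶜ κ) (VR.valᶜ κ (λ _ → λ₋₁)) (P κ)
  twisted-valᶜ κ with twisted-val (t₁ κ) | twisted-val (t₂ κ) | twisted-val (t₃ κ)
  ... | e₁ , b₁ | e₂ , b₂ | e₃ , b₃ =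
    twisted-+ {sizeᶜ κ} (mul₁ e₁ (add₂₃ (add₂₃ ee (add₂₃ eb be)) (add₂₃ (add₂₃ eb be) (add₂₃ bb (add₂₃ bb bb)))))
              (mul₁ b₁ (add₂₃ (add₂₃ ee ee) (add₂₃ (add₂₃ eb be) (add₂₃ (add₂₃ eb be) (add₂₃ eb be)))))
    where
    n₂ = size (t₂ κ)
    n₃ = size (t₃ κ)
    mul₁ = twisted-* {size (t₁ κ)} {n₂ + n₃}
    add₂₃ = twisted-+ {n₂ + n₃}
    ee = twisted-* {n₂} {n₃} e₂ e₃
    eb = twisted-* {n₂} {n₃} e₂ b₃
    be = twisted-* {n₂} {n₃} b₂ e₃
    bb = twisted-* {n₂} {n₃} b₂ b₃

  open import Data.Nat using (_≡ᵇ_)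
  open EdgeCount using (≡ᵇ-refl; ≡ᵇ-sound)
  private
    multiple₀ : ∀ d → (d ×ᴿ (⊖ Zx.𝟙)) 0 ≡ ℤ.- (+ d)
    multiple₀ zero = refl
    multiple₀ (suc d) = trans (cong (λ t → ℤ.-[1+ 0 ] ℤ.+ t) (multiple₀ d)) (sym (ℤ.neg-distrib-+ (+ 1) (+ d)))

    multiple₊ : ∀ d k → (d ×ᴿ (⊖ Zx.𝟙)) (suc k) ≡ + 0
    multiple₊ zero k = refl
    multiple₊ (suc d) k = trans (ℤ.+-identityˡ _) (multiple₊ d k)

  charMatrix-weighted : ∀ {n} (G : Graph n) → IsWeighted G (λ _ → λ₋₁) (λ i j → ⟦ charMatrix G i j ⟧)
  charMatrix-weighted G = record { diagonal = λ i → ⟪ diag i ⟫ ; off-diagonal = λ i j ne → ⟪ off i j ne ⟫ }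
    where
    diag : ∀ i k → coeff k (charMatrix G i i) ≡ (Zx.X Zx.⊕ (degree G i ×ᴿ (⊖ Zx.𝟙))) k
    diag i k with toℕ i ≡ᵇ toℕ i | ≡ᵇ-refl (toℕ i)
    diag i zero | true | _ = sym (trans (ℤ.+-identityˡ _) (multiple₀ (degree G i)))
    diag i (suc zero) | true | _ = sym (cong (λ t → + 1 ℤ.+ t) (multiple₊ (degree G i) 0))
    diag i (suc (suc k)) | true | _ = sym (cong (λ t → + 0 ℤ.+ t) (multiple₊ (degree G i) (suc k)))
    off : ∀ i j → i ≢ j → ∀ k → coeff k (charMatrix G i j) ≡ (if G i j then ⊖ (⊖ Zx.𝟙) else Zx.𝟘) k
    off i j ne k with toℕ i ≡ᵇ toℕ j in eq
    ... | true = contradiction (toℕ-injective (≡ᵇ-sound _ _ eq)) ne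
    ... | false with G i j | k
    ... | true | zero = refl
    ... | true | suc _ = refl
    ... | false | _ = refl

  private
    power-sign : ∀ k → (ℤ.- + 1) ℤ.^ k ≡ sign k
    power-sign zero = refl
    power-sign (suc k) = trans (ℤ.-1*i≡-i _) (cong ℤ.-_ (power-sign k))

  -- Two signs meet: (-1)^k from the definition of `c` and (-1)^(n + (n - k)) from the twist. Their
  -- exponents add up to 2n, which leaves a natural number.
  c-rep : ∀ {n} {G : Graph n} {κ} → Rep G κ → sizeᶜ κ ≡ n → ∀ k → k ≤ n → c k G ≡ + coefficient (n ∸ k) (P κ)
  c-rep {n} {G} {κ} rep refl k k≤n = begin
    (ℤ.- + 1) ℤ.^ k ℤ.* coeff (n ∸ k) (laplacianCharPoly G)
      ≡⟨ cong₂ ℤ._*_ (power-sign k) (trans (at (R.trans (⟦det⟧ n (charMatrix G)) (det-rep n rep (charMatrix-weighted G))) (n ∸ k)) (untwist (twisted-valᶜ κ) (n ∸ k))) ⟩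
    sign k ℤ.* (sign (n + (n ∸ k)) ℤ.* + coefficient (n ∸ k) (P κ))
      ≡⟨ sym (ℤ.*-assoc (sign k) (sign (n + (n ∸ k))) _) ⟩
    sign k ℤ.* sign (n + (n ∸ k)) ℤ.* + coefficient (n ∸ k) (P κ)
      ≡⟨ cong (ℤ._* + coefficient (n ∸ k) (P κ)) even ⟩
    + 1 ℤ.* + coefficient (n ∸ k) (P κ)
      ≡⟨ ℤ.*-identityˡ _ ⟩
    + coefficient (n ∸ k) (P κ) ∎
    where
    open ≡-Reasoning
    even : sign k ℤ.* sign (n + (n ∸ k)) ≡ + 1
    even = trans (sym (sign-+ k _)) (trans (cong sign (trans (sym (+-assoc k n _)) (trans (cong (_+ (n ∸ k)) (+-comm k n)) (trans (+-assoc n k _) (cong (λ t → n + t) (m+[n∸m]≡n k≤n)))))) (sign-double n))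

  sumTo : ℕ → (ℕ → ℕ) → ℕ
  sumTo zero f = f 0
  sumTo (suc m) f = f 0 + sumTo m (Nx.tail f)

  Vanishes : ℕ → (ℕ → ℕ) → Set
  Vanishes m f = ∀ k → m < k → f k ≡ 0

  sumTo-cong : ∀ m {f g} → (∀ k → f k ≡ g k) → sumTo m f ≡ sumTo m g
  sumTo-cong zero e = e 0
  sumTo-cong (suc m) e = cong₂ _+_ (e 0) (sumTo-cong m (e ∘ suc))

  sumTo-+ : ∀ m f g → sumTo m (f Nx.⊕ g) ≡ sumTo m f + sumTo m g
  sumTo-+ zero f g = refl
  sumTo-+ (suc m) f g = trans (cong (λ t → (f 0 + g 0) + t) (sumTo-+ m (Nx.tail f) (Nx.tail g))) (interchange (f 0) (g 0) _ _)

  sumTo-scale : ∀ m a f → sumTo m (a Nx.· f) ≡ a * sumTo m f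
  sumTo-scale zero a f = refl
  sumTo-scale (suc m) a f = trans (cong (λ t → (a * f 0) + t) (sumTo-scale m a (Nx.tail f))) (sym (*-distribˡ-+ a _ _))

  sumTo-zero : ∀ m {f} → (∀ k → f k ≡ 0) → sumTo m f ≡ 0
  sumTo-zero zero e = e 0
  sumTo-zero (suc m) e = cong₂ _+_ (e 0) (sumTo-zero m (e ∘ suc))

  sumTo-extend : ∀ m d f → Vanishes m f → sumTo (m + d) f ≡ sumTo m f
  sumTo-extend zero zero f h = refl
  sumTo-extend zero (suc d) f h = trans (cong (λ t → f 0 + t) (sumTo-zero d (λ k → h (suc k) (s≤s z≤n)))) (+-identityʳ _)
  sumTo-extend (suc m) d f h = cong (λ t → f 0 + t) (sumTo-extend m d (Nx.tail f) (λ k m<k → h (suc k) (s≤s m<k)))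

  -- Ties the two components of `Pol` together: finitely many coefficients, whose sum is the stored
  -- second component. Only this makes that component a value at x = 1.
  Polynomial : ℕ → Pol → Set
  Polynomial m p = Vanishes m (proj₁ p) × sumTo m (proj₁ p) ≡ proj₂ p

  polynomial-+ : ∀ {m p q} → Polynomial m p → Polynomial m q → Polynomial m (p +ˢ q)
  polynomial-+ {m} {p} {q} (h , e) (h′ , e′) =
    (λ k lt → cong₂ _+_ (h k lt) (h′ k lt)) , trans (sumTo-+ m (proj₁ p) (proj₁ q)) (cong₂ _+_ e e′)

  ⊛-vanishes : ∀ m m′ f g → Vanishes m f → Vanishes m′ g → Vanishes (m + m′) (f Nx.⊛ g)
  ⊛-vanishes zero m′ f g h h′ (suc k) lt = cong₂ _+_
    (trans (cong (f 0 *_) (h′ (suc k) lt)) (*-zeroʳ (f 0)))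
    (trans (Nx.⊛-cong {Nx.tail f} {Nx.𝟘} (λ k → h (suc k) (s≤s z≤n)) (λ _ → refl) k) (Nx.⊛-zeroˡ g k))
  ⊛-vanishes (suc m) m′ f g h h′ (suc k) (s≤s lt) = cong₂ _+_
    (trans (cong (f 0 *_) (h′ (suc k) (s≤s (≤-trans (m≤n+m m′ m) (<⇒≤ lt))))) (*-zeroʳ (f 0)))
    (⊛-vanishes m m′ (Nx.tail f) g (λ k lt → h (suc k) (s≤s lt)) h′ k lt)

  -- The degree bounds let cut-off sums behave like values at 1: in the induction on `m`, the sum of
  -- `g` up to a larger index collapses to `sumTo m′ g`.
  ⊛-sumTo : ∀ m m′ f g → Vanishes m f → Vanishes m′ g → sumTo (m + m′) (f Nx.⊛ g) ≡ sumTo m f * sumTo m′ g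
  ⊛-sumTo zero m′ f g h h′ = trans (sumTo-cong m′ constant) (sumTo-scale m′ (f 0) g)
    where
    constant : ∀ k → (f Nx.⊛ g) k ≡ f 0 * g k
    constant zero = refl
    constant (suc k) = trans (cong (λ t → f 0 * g (suc k) + t) (trans (Nx.⊛-cong {Nx.tail f} {Nx.𝟘} (λ k → h (suc k) (s≤s z≤n)) (λ _ → refl) k) (Nx.⊛-zeroˡ g k))) (+-identityʳ _)
  ⊛-sumTo (suc m) m′ f g h h′ = begin
    f 0 * g 0 + sumTo (m + m′) (λ k → f 0 * g (suc k) + (Nx.tail f Nx.⊛ g) k)
      ≡⟨ cong (λ t → (f 0 * g 0) + t) (sumTo-+ (m + m′) (f 0 Nx.· Nx.tail g) (Nx.tail f Nx.⊛ g)) ⟩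
    f 0 * g 0 + (sumTo (m + m′) (f 0 Nx.· Nx.tail g) + sumTo (m + m′) (Nx.tail f Nx.⊛ g))
      ≡⟨ cong (λ t → (f 0 * g 0) + t) (cong₂ _+_ (sumTo-scale (m + m′) (f 0) (Nx.tail g)) (⊛-sumTo m m′ (Nx.tail f) g (λ k lt → h (suc k) (s≤s lt)) h′)) ⟩
    f 0 * g 0 + (f 0 * sumTo (m + m′) (Nx.tail g) + sumTo m (Nx.tail f) * sumTo m′ g)
      ≡⟨ sym (+-assoc (f 0 * g 0) _ _) ⟩
    f 0 * g 0 + f 0 * sumTo (m + m′) (Nx.tail g) + sumTo m (Nx.tail f) * sumTo m′ g
      ≡⟨ cong (_+ sumTo m (Nx.tail f) * sumTo m′ g) (sym (*-distribˡ-+ (f 0) (g 0) _)) ⟩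
    f 0 * sumTo (suc m + m′) g + sumTo m (Nx.tail f) * sumTo m′ g
      ≡⟨ cong (λ t → f 0 * t + sumTo m (Nx.tail f) * sumTo m′ g) (trans (cong (λ t → sumTo t g) (+-comm (suc m) m′)) (sumTo-extend m′ (suc m) g h′)) ⟩
    f 0 * sumTo m′ g + sumTo m (Nx.tail f) * sumTo m′ g
      ≡⟨ sym (*-distribʳ-+ (sumTo m′ g) (f 0) _) ⟩
    sumTo (suc m) f * sumTo m′ g ∎
    where open ≡-Reasoning

  polynomial-* : ∀ {m m′ p q} → Polynomial m p → Polynomial m′ q → Polynomial (m + m′) (p *ˢ q)
  polynomial-* {m} {m′} {p} {q} (h , e) (h′ , e′) =
    ⊛-vanishes m m′ (proj₁ p) (proj₁ q) h h′ , trans (⊛-sumTo m m′ (proj₁ p) (proj₁ q) h h′) (cong₂ _*_ e e′)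

  -- The bound `size T` is one too large for the degree of `b`, but gives `e` and `b` a common
  -- bound, as needed for their sum in `merge`.
  polynomial-val : ∀ T → let e , b = val T (λ _ → x , 1ˢ) in Polynomial (size T) e × Polynomial (size T) b
  polynomial-val • = ((λ { (suc zero) (s≤s ()) ; (suc (suc k)) lt → refl }) , refl) , ((λ { (suc k) lt → refl }) , refl)
  polynomial-val (T ◁ t) with polynomial-val T | polynomial-val t
  ... | e , b | e′ , b′ =
    polynomial-+ {size T + size t} (polynomial-* {size T} {size t} e (polynomial-+ {size t} e′ b′)) (polynomial-* {size T} {size t} b e′)
    , polynomial-* {size T} {size t} b (polynomial-+ {size t} e′ b′)

  polynomial-P : ∀ κ → Polynomial (sizeᶜ κ) (P κ)
  polynomial-P κ with polynomial-val (t₁ κ) | polynomial-val (t₂ κ) | polynomial-val (t₃ κ)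
  ... | e₁ , b₁ | e₂ , b₂ | e₃ , b₃ =
    polynomial-+ {sizeᶜ κ} (mul₁ e₁ (add₂₃ (add₂₃ ee (add₂₃ eb be)) (add₂₃ (add₂₃ eb be) (add₂₃ bb (add₂₃ bb bb)))))
              (mul₁ b₁ (add₂₃ (add₂₃ ee ee) (add₂₃ (add₂₃ eb be) (add₂₃ (add₂₃ eb be) (add₂₃ eb be)))))
    where
    n₂ = size (t₂ κ)
    n₃ = size (t₃ κ)
    mul₁ = polynomial-* {size (t₁ κ)} {n₂ + n₃}
    add₂₃ = polynomial-+ {n₂ + n₃}
    ee = polynomial-* {n₂} {n₃} e₂ e₃
    eb = polynomial-* {n₂} {n₃} e₂ b₃
    be = polynomial-* {n₂} {n₃} b₂ e₃
    bb = polynomial-* {n₂} {n₃} b₂ b₃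

  sumTo-mono : ∀ m {f g} → (∀ k → k ≤ m → f k ≤ g k) → sumTo m f ≤ sumTo m g
  sumTo-mono zero h = h 0 z≤n
  sumTo-mono (suc m) h = +-mono-≤ (h 0 z≤n) (sumTo-mono m (λ k k≤m → h (suc k) (s≤s k≤m)))

  -- This is how a strict drop at x = 1 produces the coefficient demanded by `_≺_`: either the first
  -- coefficients differ, or they are equal and cancel from the sums.
  sumTo-strict : ∀ m {f g} → (∀ k → f k ≤ g k) → sumTo m f < sumTo m g → ∃[ k ] (k ≤ m × f k < g k)
  sumTo-strict zero h lt = 0 , z≤n , lt
  sumTo-strict (suc m) {f} {g} h lt with m≤n⇒m<n∨m≡n (h 0)
  ... | inj₁ f₀<g₀ = 0 , z≤n , f₀<g₀
  ... | inj₂ e with sumTo-strict m {Nx.tail f} {Nx.tail g} (h ∘ suc) (+-cancelˡ-< (g 0) _ _ (subst (λ t → t + sumTo m (Nx.tail f) < g 0 + sumTo m (Nx.tail g)) e lt))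
  ... | k , k≤m , fk<gk = suc k , s≤s k≤m , fk<gk

-- Semirings with strictly positive elements.

module Positivity where


  -- The moves are instantiated twice: for polynomials paired with their value, positive meaning a
  -- positive value at 1, and for the natural numbers themselves at x = 1.
  record PositiveSemiring : Set₁ where
    field
      commutativeSemiring : CommutativeSemiring 0ℓ 0ℓ
    open CommutativeSemiring commutativeSemiring
    field
      x : Carrier
      Pos : Carrier → Set
      pos-x : Pos x
      pos-1 : Pos 1#
      pos-+ˡ : ∀ {p q} → Pos p → Pos (p + q)
      pos-+ʳ : ∀ {p q} → Pos q → Pos (p + q)
      pos-* : ∀ {p q} → Pos p → Pos q → Pos (p * q)

open Positivity using (PositiveSemiring)

-- Moves of branches and their effect on the polynomials.

module Moves (PS : PositiveSemiring) where

  open PositiveSemiring PS renaming (commutativeSemiring to S)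
  open CommutativeSemiring S hiding (zero)
  open import Relation.Binary.PropositionalEquality as ≡ using (_≡_)

  open import Data.Nat as ℕ using (ℕ; zero; suc; s≤s)
  import Data.Nat.Properties as ℕ
  open import Data.Product using (_×_; _,_; proj₁; proj₂; ∃-syntax)
  open import Relation.Binary.Reasoning.Setoid setoid
  open import Algebra.Solver.Ring.NaturalCoefficients.Default S
  open RootedTree
  open Shapes
  open Value S
  open import Data.Nat.Solver using (module +-*-Solver)

  private
    module NS = +-*-Solver

  infix 4 _≼_ _≺_
  -- With the difference as a witness each comparison becomes a semiring identity. For polynomials
  -- it bounds all coefficients and the value at 1 together.
  _≼_ _≺_ : Carrier → Carrier → Set
  p ≼ q = ∃[ r ] q ≈ p + r
  p ≺ q = ∃[ r ] (Pos r × q ≈ p + r)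

  ≼-reflexive : ∀ {p q} → q ≈ p → p ≼ q
  ≼-reflexive e = 0# , trans e (sym (+-identityʳ _))

  ≺⇒≼ : ∀ {p q} → p ≺ q → p ≼ q
  ≺⇒≼ (r , _ , e) = r , e

  ≼-trans : ∀ {p q r} → p ≼ q → q ≼ r → p ≼ r
  ≼-trans (s , e) (t , f) = s + t , trans f (trans (+-congʳ e) (+-assoc _ _ _))

  ≺-resp : ∀ {p p′ q q′} → p ≈ p′ → q ≈ q′ → p ≺ q → p′ ≺ q′
  ≺-resp ep eq (r , pr , e) = r , pr , trans (sym eq) (trans e (+-congʳ ep))

  private
    add-r : ∀ p r q s → (p + r) + (q + s) ≈ (p + q) + (r + s)
    add-r = solve 4 (λ p r q s → (p :+ r) :+ (q :+ s) := (p :+ q) :+ (r :+ s)) refl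

    mul-r : ∀ p r q s → (p + r) * (q + s) ≈ p * q + (r * q + (p + r) * s)
    mul-r = solve 4 (λ p r q s → (p :+ r) :* (q :+ s) := p :* q :+ (r :* q :+ (p :+ r) :* s)) refl

  ≼-+ : ∀ {p p′ q q′} → p ≼ p′ → q ≼ q′ → p + q ≼ p′ + q′
  ≼-+ (r , e) (s , f) = r + s , trans (+-cong e f) (add-r _ r _ s)

  ≼-* : ∀ {p p′ q q′} → p ≼ p′ → q ≼ q′ → p * q ≼ p′ * q′
  ≼-* (r , e) (s , f) = _ , trans (*-cong e f) (mul-r _ r _ s)

  ≺-+ʳ : ∀ {p p′ q q′} → p ≼ p′ → q ≺ q′ → p + q ≺ p′ + q′
  ≺-+ʳ (r , e) (s , ps , f) = r + s , pos-+ʳ ps , trans (+-cong e f) (add-r _ r _ s)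

  ≺-*ˡ : ∀ {p p′ q} → Pos q → p ≺ p′ → p * q ≺ p′ * q
  ≺-*ˡ pq (r , pr , e) = r * _ , pos-* pr pq , trans (*-congʳ e) (distribʳ _ _ _)

  ≺-*ʳ : ∀ {p q q′} → Pos p → q ≺ q′ → p * q ≺ p * q′
  ≺-*ʳ pp (r , pr , e) = _ * r , pos-* pp pr , trans (*-congˡ e) (distribˡ _ _ _)

  unit : Weight
  unit = x , 1#

  weight : Tree → Weight
  weight T = val T (λ _ → unit)

  -- `a T` is the determinant with the diagonal entry of the root raised by one, which is how `T`
  -- contributes when hung from a parent.
  e b a E : Tree → Carrier
  e T = proj₁ (weight T)
  b T = proj₂ (weight T)
  a T = e T + b T

  -- e T = x b T + E T; E T is the contribution of the children.
  E • = 0#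
  E (T ◁ c) = E T * a c + b T * e c

  e-split : ∀ T → e T ≈ x * b T + E T
  e-split • = sym (trans (+-identityʳ _) (*-identityʳ x))
  e-split (T ◁ c) = trans (+-congʳ (*-congʳ (e-split T)))
    (solve 5 (λ x bT ET ac ec → (x :* bT :+ ET) :* ac :+ bT :* ec := x :* (bT :* ac) :+ (ET :* ac :+ bT :* ec)) refl x (b T) (E T) (a c) (e c))

  mutual
    pos-e : ∀ T → Pos (e T)
    pos-e • = pos-x
    pos-e (T ◁ c) = pos-+ˡ (pos-* (pos-e T) (pos-a c))

    pos-b : ∀ T → Pos (b T)
    pos-b • = pos-1
    pos-b (T ◁ c) = pos-* (pos-b T) (pos-a c)

    pos-a : ∀ T → Pos (a T)
    pos-a T = pos-+ʳ (pos-b T)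

  pos-E : ∀ T c → Pos (E (T ◁ c))
  pos-E T c = pos-+ʳ (pos-* (pos-b T) (pos-e c))

  -- A ⊑ B: the conductance e/b of A is at most that of B.
  infix 4 _⊑_ _⊏_
  _⊑_ _⊏_ : Weight → Weight → Set
  (eA , bA) ⊑ (eB , bB) = eA * bB ≼ eB * bA
  (eA , bA) ⊏ (eB , bB) = eA * bB ≺ eB * bA

  private
    -- Hanging two trees from new parents preserves the order of their conductances. The surplus has
    -- two sources: the other children at the root of `T`, entering through `ET`, and the surplus
    -- `δ` of the child itself. `hang-⊏ˡ` draws strictness from the first, `hang-⊏ʳ` from the
    -- second.
    hang : ∀ bT ET eA bA eB bB δ → eB * bA ≈ eA * bB + δ →
      ((x * bT + ET) * (eB + bB) + bT * eB) * (1# * (eA + bA))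
        ≈ (x * (eA + bA) + 1# * eA) * (bT * (eB + bB)) + (ET * ((eB + bB) * (eA + bA)) + bT * δ)
    hang bT ET eA bA eB bB δ h = begin
      ((x * bT + ET) * (eB + bB) + bT * eB) * (1# * (eA + bA))
        ≈⟨ solve 7 (λ x bT ET eA bA eB bB → ((x :* bT :+ ET) :* (eB :+ bB) :+ bT :* eB) :* (con 1 :* (eA :+ bA))
             := (x :* bT :+ ET) :* ((eB :+ bB) :* (eA :+ bA)) :+ bT :* (eB :* eA :+ eB :* bA)) refl x bT ET eA bA eB bB ⟩
      (x * bT + ET) * ((eB + bB) * (eA + bA)) + bT * (eB * eA + eB * bA)
        ≈⟨ +-congˡ (*-congˡ (+-congˡ h)) ⟩
      (x * bT + ET) * ((eB + bB) * (eA + bA)) + bT * (eB * eA + (eA * bB + δ))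
        ≈⟨ solve 8 (λ x bT ET eA bA eB bB δ → (x :* bT :+ ET) :* ((eB :+ bB) :* (eA :+ bA)) :+ bT :* (eB :* eA :+ (eA :* bB :+ δ))
             := (x :* (eA :+ bA) :+ con 1 :* eA) :* (bT :* (eB :+ bB)) :+ (ET :* ((eB :+ bB) :* (eA :+ bA)) :+ bT :* δ)) refl x bT ET eA bA eB bB δ ⟩
      (x * (eA + bA) + 1# * eA) * (bT * (eB + bB)) + (ET * ((eB + bB) * (eA + bA)) + bT * δ) ∎

  hang-⊑ : ∀ T A c → weight A ⊑ weight c → weight (• ◁ A) ⊑ weight (T ◁ c)
  hang-⊑ T A c (δ , h) = _ , trans (*-congʳ (+-congʳ (*-congʳ (e-split T)))) (hang (b T) (E T) (e A) (b A) (e c) (b c) δ h)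

  hang-⊏ˡ : ∀ T d A c → weight A ⊑ weight c → weight (• ◁ A) ⊏ weight ((T ◁ d) ◁ c)
  hang-⊏ˡ T d A c (δ , h) = _ , pos-+ˡ (pos-* (pos-E T d) (pos-* (pos-a c) (pos-a A))) ,
    trans (*-congʳ (+-congʳ (*-congʳ (e-split (T ◁ d))))) (hang (b (T ◁ d)) (E (T ◁ d)) (e A) (b A) (e c) (b c) δ h)

  hang-⊏ʳ : ∀ T A c → weight A ⊏ weight c → weight (• ◁ A) ⊏ weight (T ◁ c)
  hang-⊏ʳ T A c (δ , pδ , h) = _ , pos-+ʳ (pos-* (pos-b T) pδ) ,
    trans (*-congʳ (+-congʳ (*-congʳ (e-split T)))) (hang (b T) (E T) (e A) (b A) (e c) (b c) δ h)

  •-⊑ : ∀ T → weight • ⊑ weight T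
  •-⊑ T = E T , trans (*-identityʳ _) (e-split T)

  •-⊏ : ∀ T c → weight • ⊏ weight (T ◁ c)
  •-⊏ T c = E (T ◁ c) , pos-E T c , trans (*-identityʳ _) (e-split (T ◁ c))

  path-⊏-path : ∀ {i j} → i ℕ.< j → weight (path i) ⊏ weight (path j)
  path-⊏-path {zero} {suc j} _ = •-⊏ • (path j)
  path-⊏-path {suc i} {suc j} (s≤s lt) = hang-⊏ʳ • (path i) (path j) (path-⊏-path lt)

  path-⊑-path : ∀ {i j} → i ℕ.≤ j → weight (path i) ⊑ weight (path j)
  path-⊑-path {zero} {j} _ = •-⊑ (path j)
  path-⊑-path {suc i} {suc j} (s≤s le) = hang-⊑ • (path i) (path j) (path-⊑-path le)

  -- The right-hand tree contains a path from its root on k + j + 2 vertices, and the branches `T`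
  -- along it can only raise the conductance.
  path-⊑-chain : ∀ {i j} k T → i ℕ.≤ suc j → weight (path i) ⊑ weight (chain k (T ◁ path j))
  path-⊑-chain {zero} {j} k T _ = •-⊑ (chain k (T ◁ path j))
  path-⊑-chain {suc i} {j} zero T (s≤s le) = hang-⊑ T (path i) (path j) (path-⊑-path le)
  path-⊑-chain {suc i} {j} (suc k) T (s≤s le) = hang-⊑ • (path i) (chain k (T ◁ path j)) (path-⊑-chain k T (ℕ.m≤n⇒m≤1+n le))

  -- The transfer matrix of a chain of k vertices.
  record Transfer (k : ℕ) : Set where
    field
      A C q : Carrier
      pos-A : Pos A
      -- This relation closes the induction: it makes the coefficient of `e T` in `e-chain` and that
      -- of `b T` in `a-chain` the same element `C`.
      xA : x * A ≈ x * C + q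
      e-chain : ∀ T → e (chain k T) ≈ C * e T + q * b T
      a-chain : ∀ T → a (chain k T) ≈ A * e T + C * b T

  transfer : ∀ k → Transfer k
  transfer zero = record
    { A = 1# ; C = 1# ; q = 0# ; pos-A = pos-1 ; xA = sym (+-identityʳ _)
    ; e-chain = λ T → solve 2 (λ e b → e := con 1 :* e :+ con 0 :* b) refl (e T) (b T)
    ; a-chain = λ T → solve 2 (λ e b → e :+ b := con 1 :* e :+ con 1 :* b) refl (e T) (b T) }
  transfer (suc k) = record
    { A = (x * A + C) + A ; C = x * A + C ; q = x * C + q ; pos-A = pos-+ʳ pos-A
    ; xA = trans (distribˡ _ _ _) (+-congˡ xA)
    ; e-chain = e-chain′
    ; a-chain = λ T → begin
        (x * a (chain k T) + 1# * e (chain k T)) + 1# * a (chain k T)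
          ≈⟨ +-cong (e-chain′ T) (trans (*-identityˡ _) (a-chain T)) ⟩
        ((x * A + C) * e T + (x * C + q) * b T) + (A * e T + C * b T)
          ≈⟨ solve 6 (λ xA C q' A e b → ((xA :+ C) :* e :+ q' :* b) :+ (A :* e :+ C :* b) := ((xA :+ C) :+ A) :* e :+ (q' :+ C) :* b) refl (x * A) C (x * C + q) A (e T) (b T) ⟩
        ((x * A + C) + A) * e T + ((x * C + q) + C) * b T
          ≈⟨ +-congˡ (*-congʳ (+-congʳ (sym xA))) ⟩
        ((x * A + C) + A) * e T + (x * A + C) * b T ∎ }
    where
    open Transfer (transfer k)
    e-chain′ : ∀ T → x * a (chain k T) + 1# * e (chain k T) ≈ (x * A + C) * e T + (x * C + q) * b T
    e-chain′ T = trans (+-cong (*-congˡ (a-chain T)) (*-congˡ (e-chain T)))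
      (solve 6 (λ x A C q e b → x :* (A :* e :+ C :* b) :+ con 1 :* (C :* e :+ q :* b) := (x :* A :+ C) :* e :+ (x :* C :+ q) :* b) refl x A C q (e T) (b T))

  -- Divided by `b`, the contributions of the children add up when roots are identified. `E U`
  -- stands in place of `e U` because the common root contributes its x only once.
  weight-⧺ : ∀ T U → (e (T ⧺ U) ≈ e T * b U + b T * E U) × (b (T ⧺ U) ≈ b T * b U)
  weight-⧺ T • = solve 2 (λ e b → e := e :* con 1 :+ b :* con 0) refl (e T) (b T) , sym (*-identityʳ _)
  weight-⧺ T (U ◁ c) with weight-⧺ T U
  ... | he , hb =
    trans (+-cong (*-congʳ he) (*-congʳ hb))
      (solve 6 (λ eT bT EU bU ac ec → (eT :* bU :+ bT :* EU) :* ac :+ bT :* bU :* ec := eT :* (bU :* ac) :+ bT :* (EU :* ac :+ bU :* ec)) refl (e T) (b T) (E U) (b U) (a c) (e c))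
    , trans (*-congʳ hb) (*-assoc _ _ _)

  -- Only `b` must drop strictly: `gather` works under a weak conductance inequality, which bounds
  -- `e` only weakly. This suffices, since a parent sees `a = e + b` and `P` contains `b` with a
  -- positive factor. Both leaf counts are kept so that the move can be used at a triangle vertex as
  -- well as below a parent.
  record Improves (T′ T : Tree) : Set where
    field
      size≡ : size T′ ≡ size T
      leaves≡ : leaves T′ ≡ leaves T
      leavesHung≡ : leavesHung T′ ≡ leavesHung T
      e≼ : e T′ ≼ e T
      b≺ : b T′ ≺ b T

    a≺ : a T′ ≺ a T
    a≺ = ≺-+ʳ e≼ b≺
  open Improves

  improves-root : ∀ {T T′} c → Improves T′ T → Improves (T′ ◁ c) (T ◁ c)
  improves-root c i = record
    { size≡ = ≡.cong (ℕ._+ size c) (size≡ i)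
    ; leaves≡ = ≡.cong (ℕ._+ leavesHung c) (leaves≡ i)
    ; leavesHung≡ = ≡.cong (ℕ._+ leavesHung c) (leaves≡ i)
    ; e≼ = ≼-+ (≼-* (e≼ i) (≼-reflexive refl)) (≼-* (≺⇒≼ (b≺ i)) (≼-reflexive refl))
    ; b≺ = ≺-*ˡ (pos-a c) (b≺ i) }

  improves-child : ∀ T {c c′} → Improves c′ c → Improves (T ◁ c′) (T ◁ c)
  improves-child T i = record
    { size≡ = ≡.cong (size T ℕ.+_) (size≡ i)
    ; leaves≡ = ≡.cong (leaves T ℕ.+_) (leavesHung≡ i)
    ; leavesHung≡ = ≡.cong (leaves T ℕ.+_) (leavesHung≡ i)
    ; e≼ = ≼-+ (≼-* (≼-reflexive refl) (≺⇒≼ (a≺ i))) (≼-* (≼-reflexive refl) (e≼ i))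
    ; b≺ = ≺-*ʳ (pos-b T) (a≺ i) }

  swap-weight : ∀ T c d → (e ((T ◁ c) ◁ d) ≈ e ((T ◁ d) ◁ c)) × (b ((T ◁ c) ◁ d) ≈ b ((T ◁ d) ◁ c))
  swap-weight T c d =
    solve 6 (λ eT bT ac ec ad ed → (eT :* ac :+ bT :* ec) :* ad :+ bT :* ac :* ed := (eT :* ad :+ bT :* ed) :* ac :+ bT :* ad :* ec) refl (e T) (b T) (a c) (e c) (a d) (e d)
    , solve 3 (λ bT ac ad → bT :* ac :* ad := bT :* ad :* ac) refl (b T) (a c) (a d)

  leaves-swap : ∀ T c d → leaves ((T ◁ c) ◁ d) ≡ leaves ((T ◁ d) ◁ c)
  leaves-swap T c d = ≡.trans (ℕ.+-assoc (leaves T) _ _) (≡.trans (≡.cong (leaves T ℕ.+_) (ℕ.+-comm (leavesHung c) _)) (≡.sym (ℕ.+-assoc (leaves T) _ _)))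

  size-swap : ∀ T c d → size ((T ◁ c) ◁ d) ≡ size ((T ◁ d) ◁ c)
  size-swap T c d = ≡.trans (ℕ.+-assoc (size T) _ _) (≡.trans (≡.cong (size T ℕ.+_) (ℕ.+-comm (size c) _)) (≡.sym (ℕ.+-assoc (size T) _ _)))

  improves-swap : ∀ {T c d T′} → Improves T′ ((T ◁ d) ◁ c) → Improves T′ ((T ◁ c) ◁ d)
  improves-swap {T} {c} {d} i = record
    { size≡ = ≡.trans (size≡ i) (size-swap T d c)
    ; leaves≡ = ≡.trans (leaves≡ i) (leaves-swap T d c)
    ; leavesHung≡ = ≡.trans (leavesHung≡ i) (leaves-swap T d c)
    ; e≼ = ≼-trans (e≼ i) (≼-reflexive (proj₁ (swap-weight T c d)))
    ; b≺ = ≺-resp refl (sym (proj₂ (swap-weight T c d))) (b≺ i) }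

  -- All branches at the far end of a chain except one path are moved to its near end.
  gather : ∀ X k U d m → weight (path (suc m)) ⊑ weight X →
    Improves ((X ⧺ (U ◁ d)) ◁ chain k (path (suc m))) (X ◁ chain k ((U ◁ d) ◁ path m))
  gather X k U d m (δ , h) = record
    { size≡ = size-eq
    ; leaves≡ = leaves-eq
    ; leavesHung≡ = leaves-eq
    -- The moved branches contribute `E Z`, the conductance surplus of `X` over `Y` is `δ`, and the
    -- chain between the two ends transports their product with factor `A`.
    ; e≼ = A * (E Z * δ) , sym (begin
        e (X ⧺ Z) * a (chain k Y) + b (X ⧺ Z) * e (chain k Y) + A * (E Z * δ)
          ≈⟨ +-congʳ (+-cong (*-cong (proj₁ (weight-⧺ X Z)) (a-chain Y)) (*-cong (proj₂ (weight-⧺ X Z)) (e-chain Y))) ⟩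
        (e X * b Z + b X * E Z) * (A * e Y + C * b Y) + b X * b Z * (C * e Y + q * b Y) + A * (E Z * δ)
          ≈⟨ solve 10 (λ eX bX bZ EZ A C q eY bY δ → (eX :* bZ :+ bX :* EZ) :* (A :* eY :+ C :* bY) :+ bX :* bZ :* (C :* eY :+ q :* bY) :+ A :* (EZ :* δ)
               := A :* (EZ :* (eY :* bX :+ δ)) :+ (eX :* (A :* (eY :* bZ) :+ C :* (bY :* bZ)) :+ bX :* (C :* (eY :* bZ :+ bY :* EZ) :+ q :* (bY :* bZ))))
               refl (e X) (b X) (b Z) (E Z) A C q (e Y) (b Y) δ ⟩
        A * (E Z * (e Y * b X + δ)) + (e X * (A * (e Y * b Z) + C * (b Y * b Z)) + b X * (C * (e Y * b Z + b Y * E Z) + q * (b Y * b Z)))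
          ≈⟨ +-congʳ (*-congˡ (*-congˡ (sym h))) ⟩
        A * (E Z * (e X * b Y)) + (e X * (A * (e Y * b Z) + C * (b Y * b Z)) + b X * (C * (e Y * b Z + b Y * E Z) + q * (b Y * b Z)))
          ≈⟨ solve 9 (λ eX bX bZ EZ A C q eY bY → A :* (EZ :* (eX :* bY)) :+ (eX :* (A :* (eY :* bZ) :+ C :* (bY :* bZ)) :+ bX :* (C :* (eY :* bZ :+ bY :* EZ) :+ q :* (bY :* bZ)))
               := eX :* (A :* (eY :* bZ :+ bY :* EZ) :+ C :* (bY :* bZ)) :+ bX :* (C :* (eY :* bZ :+ bY :* EZ) :+ q :* (bY :* bZ)))
               refl (e X) (b X) (b Z) (E Z) A C q (e Y) (b Y) ⟩
        e X * (A * (e Y * b Z + b Y * E Z) + C * (b Y * b Z)) + b X * (C * (e Y * b Z + b Y * E Z) + q * (b Y * b Z))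
          ≈⟨ sym (+-cong (*-congˡ aD) (*-congˡ eD)) ⟩
        e X * a (chain k (Z ◁ path m)) + b X * e (chain k (Z ◁ path m)) ∎)
    -- The minor `b` omits the row of the root, so branches moved there decouple; the saving is
    -- strict whatever `δ` is.
    ; b≺ = b X * (A * (b Y * E Z)) , pos-* (pos-b X) (pos-* pos-A (pos-* (pos-b Y) (pos-E U d))) , sym (begin
        b (X ⧺ Z) * a (chain k Y) + b X * (A * (b Y * E Z))
          ≈⟨ +-congʳ (*-cong (proj₂ (weight-⧺ X Z)) (a-chain Y)) ⟩
        b X * b Z * (A * e Y + C * b Y) + b X * (A * (b Y * E Z))
          ≈⟨ solve 7 (λ bX bZ EZ A C eY bY → bX :* bZ :* (A :* eY :+ C :* bY) :+ bX :* (A :* (bY :* EZ)) := bX :* (A :* (eY :* bZ :+ bY :* EZ) :+ C :* (bY :* bZ))) refl (b X) (b Z) (E Z) A C (e Y) (b Y) ⟩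
        b X * (A * (e Y * b Z + b Y * E Z) + C * (b Y * b Z))
          ≈⟨ *-congˡ (sym aD) ⟩
        b X * a (chain k (Z ◁ path m)) ∎)
    }
    where
    open Transfer (transfer k)
    Z = U ◁ d
    Y = path (suc m)
    eV : e (Z ◁ path m) ≈ e Y * b Z + b Y * E Z
    eV = trans (+-congʳ (*-congʳ (e-split Z)))
      (solve 5 (λ x bZ EZ ap ep → (x :* bZ :+ EZ) :* ap :+ bZ :* ep := (x :* ap :+ con 1 :* ep) :* bZ :+ con 1 :* ap :* EZ) refl x (b Z) (E Z) (a (path m)) (e (path m)))
    bV : b (Z ◁ path m) ≈ b Y * b Z
    bV = solve 2 (λ bZ ap → bZ :* ap := con 1 :* ap :* bZ) refl (b Z) (a (path m))
    aD : a (chain k (Z ◁ path m)) ≈ A * (e Y * b Z + b Y * E Z) + C * (b Y * b Z)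
    aD = trans (a-chain _) (+-cong (*-congˡ eV) (*-congˡ bV))
    eD : e (chain k (Z ◁ path m)) ≈ C * (e Y * b Z + b Y * E Z) + q * (b Y * b Z)
    eD = trans (e-chain _) (+-cong (*-congˡ eV) (*-congˡ bV))
    size-eq : size ((X ⧺ Z) ◁ chain k Y) ≡ size (X ◁ chain k (Z ◁ path m))
    size-eq = ℕ.suc-injective (≡.trans (≡.cong₂ ℕ._+_ (size-⧺ X Z) (size-chain k Y)) (≡.trans
      (NS.solve 4 (λ X Z k p → (X NS.:+ Z) NS.:+ (k NS.:+ (NS.con 1 NS.:+ p)) NS.:= NS.con 1 NS.:+ (X NS.:+ (k NS.:+ (Z NS.:+ p)))) ≡.refl (size X) (size Z) k (size (path m)))
      (≡.cong (λ t → suc (size X ℕ.+ t)) (≡.sym (size-chain k (Z ◁ path m))))))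
    leaves-eq : leaves ((X ⧺ Z) ◁ chain k Y) ≡ leaves (X ◁ chain k (Z ◁ path m))
    leaves-eq = ≡.trans (≡.cong₂ ℕ._+_ (leaves-⧺ X Z) (leavesHung-chain k Y)) (≡.trans (ℕ.+-assoc (leaves X) _ _)
      (≡.cong (leaves X ℕ.+_) (≡.sym (leavesHung-chain k (Z ◁ path m)))))

  -- The branches T at one end of the path through A, the chain and V ◁ d are moved to the other end.
  reroot : ∀ T A k V d → weight (• ◁ A) ⊏ weight (V ◁ d) →
    Improves (((V ◁ d) ◁ chain k (• ◁ A)) ⧺ T) ((T ◁ A) ◁ chain k (V ◁ d))
  reroot T B k V d (δ , pδ , h) = record
    { size≡ = size-eq
    ; leaves≡ = leaves-eq
    ; leavesHung≡ = ≡.trans (leavesHung-⧺ X (chain k Y) T) leaves-eq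
    ; e≼ = A * δ * E T , sym (begin
        e ((X ◁ chain k Y) ⧺ T) + A * δ * E T
          ≈⟨ +-congʳ (trans (proj₁ (weight-⧺ (X ◁ chain k Y) T)) (+-cong (*-congʳ (+-cong (*-congˡ (a-chain Y)) (*-congˡ (e-chain Y)))) (*-congʳ (*-congˡ (a-chain Y))))) ⟩
        (e X * (A * e Y + C * b Y) + b X * (C * e Y + q * b Y)) * b T + b X * (A * e Y + C * b Y) * E T + A * δ * E T
          ≈⟨ solve 10 (λ eX bX A C q eY bY bT ET δ → (eX :* (A :* eY :+ C :* bY) :+ bX :* (C :* eY :+ q :* bY)) :* bT :+ bX :* (A :* eY :+ C :* bY) :* ET :+ A :* δ :* ET
               := A :* ET :* (eY :* bX :+ δ) :+ ((eX :* (A :* eY :+ C :* bY) :+ bX :* (C :* eY :+ q :* bY)) :* bT :+ bX :* (C :* bY) :* ET))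
               refl (e X) (b X) A C q (e Y) (b Y) (b T) (E T) δ ⟩
        A * E T * (e Y * b X + δ) + ((e X * (A * e Y + C * b Y) + b X * (C * e Y + q * b Y)) * b T + b X * (C * b Y) * E T)
          ≈⟨ +-congʳ (*-congˡ (sym h)) ⟩
        A * E T * (e X * b Y) + ((e X * (A * e Y + C * b Y) + b X * (C * e Y + q * b Y)) * b T + b X * (C * b Y) * E T)
          ≈⟨ solve 11 (λ eX bX A C q x eB aB bT ET bY → A :* ET :* (eX :* (con 1 :* aB)) :+ ((eX :* (A :* (x :* aB :+ con 1 :* eB) :+ C :* (con 1 :* aB)) :+ bX :* (C :* (x :* aB :+ con 1 :* eB) :+ q :* (con 1 :* aB))) :* bT :+ bX :* (C :* (con 1 :* aB)) :* ET)
               := ((x :* bT :+ ET) :* aB :+ bT :* eB) :* (A :* eX :+ C :* bX) :+ bT :* aB :* (C :* eX :+ q :* bX))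
               refl (e X) (b X) A C q x (e B) (a B) (b T) (E T) (b Y) ⟩
        ((x * b T + E T) * a B + b T * e B) * (A * e X + C * b X) + b T * a B * (C * e X + q * b X)
          ≈⟨ sym (+-cong (*-cong (+-congʳ (*-congʳ (e-split T))) (a-chain X)) (*-congˡ (e-chain X))) ⟩
        (e T * a B + b T * e B) * a (chain k X) + b T * a B * e (chain k X) ∎)
    -- Here the root itself changes ends, and the strict drop of `b` has to come from `δ`; hence the
    -- strict conductance hypothesis.
    ; b≺ = A * δ * b T , pos-* (pos-* pos-A pδ) (pos-b T) , sym (begin
        b ((X ◁ chain k Y) ⧺ T) + A * δ * b T
          ≈⟨ +-congʳ (trans (proj₂ (weight-⧺ (X ◁ chain k Y) T)) (*-congʳ (*-congˡ (a-chain Y)))) ⟩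
        b X * (A * e Y + C * b Y) * b T + A * δ * b T
          ≈⟨ solve 7 (λ bX A C eY bY bT δ → bX :* (A :* eY :+ C :* bY) :* bT :+ A :* δ :* bT := A :* bT :* (eY :* bX :+ δ) :+ bX :* (C :* bY) :* bT) refl (b X) A C (e Y) (b Y) (b T) δ ⟩
        A * b T * (e Y * b X + δ) + b X * (C * b Y) * b T
          ≈⟨ +-congʳ (*-congˡ (sym h)) ⟩
        A * b T * (e X * b Y) + b X * (C * b Y) * b T
          ≈⟨ solve 6 (λ eX bX A C aB bT → A :* bT :* (eX :* (con 1 :* aB)) :+ bX :* (C :* (con 1 :* aB)) :* bT := bT :* aB :* (A :* eX :+ C :* bX)) refl (e X) (b X) A C (a B) (b T) ⟩
        b T * a B * (A * e X + C * b X)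
          ≈⟨ *-congˡ (sym (a-chain X)) ⟩
        b T * a B * a (chain k X) ∎)
    }
    where
    open Transfer (transfer k)
    X = V ◁ d
    Y = • ◁ B
    size-eq : size ((X ◁ chain k Y) ⧺ T) ≡ size ((T ◁ B) ◁ chain k X)
    size-eq = ℕ.suc-injective (≡.trans (size-⧺ (X ◁ chain k Y) T) (≡.trans (≡.cong (λ t → size X ℕ.+ t ℕ.+ size T) (size-chain k Y)) (≡.trans
      (NS.solve 4 (λ X k B T → X NS.:+ (k NS.:+ (NS.con 1 NS.:+ B)) NS.:+ T NS.:= NS.con 1 NS.:+ ((T NS.:+ B) NS.:+ (k NS.:+ X))) ≡.refl (size X) k (size B) (size T))
      (≡.cong (λ t → suc (size T ℕ.+ size B ℕ.+ t)) (≡.sym (size-chain k X))))))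
    leaves-eq : leaves ((X ◁ chain k Y) ⧺ T) ≡ leaves ((T ◁ B) ◁ chain k X)
    leaves-eq = ≡.trans (leaves-⧺ (X ◁ chain k Y) T) (≡.trans (≡.cong (λ t → leaves X ℕ.+ t ℕ.+ leaves T) (leavesHung-chain k Y)) (≡.trans
      (NS.solve 3 (λ X B T → (X NS.:+ B) NS.:+ T NS.:= (T NS.:+ B) NS.:+ X) ≡.refl (leaves X) (leavesHung B) (leaves T))
      (≡.cong (λ t → leaves T ℕ.+ leavesHung B ℕ.+ t) (≡.sym (leavesHung-chain k X)))))

  P : Code → Carrier
  P κ = valᶜ κ (λ _ → unit)

  record Improvesᶜ (κ′ κ : Code) : Set where
    field
      sizeᶜ≡ : sizeᶜ κ′ ≡ sizeᶜ κ
      leavesᶜ≡ : leavesᶜ κ′ ≡ leavesᶜ κ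
      P≺ : P κ′ ≺ P κ
  open Improvesᶜ

  improves-t₁ : ∀ {T T′} U W → Improves T′ T → Improvesᶜ (code T′ U W) (code T U W)
  improves-t₁ U W i = record
    { sizeᶜ≡ = ≡.cong (ℕ._+ (size U ℕ.+ size W)) (size≡ i)
    ; leavesᶜ≡ = ≡.cong (ℕ._+ (leaves U ℕ.+ leaves W)) (leaves≡ i)
    ; P≺ = ≺-+ʳ (≼-* (e≼ i) (≼-reflexive refl)) (≺-*ˡ (pos-+ˡ (pos-+ˡ (pos-* (pos-e U) (pos-e W)))) (b≺ i)) }

  P-swap₁₂ : ∀ T U W → P (code T U W) ≈ P (code U T W)
  P-swap₁₂ T U W = solve 6 (λ e₁ b₁ e₂ b₂ e₃ b₃ →
    e₁ :* ((e₂ :* e₃ :+ (e₂ :* b₃ :+ b₂ :* e₃)) :+ ((e₂ :* b₃ :+ b₂ :* e₃) :+ (b₂ :* b₃ :+ (b₂ :* b₃ :+ b₂ :* b₃))))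
      :+ b₁ :* ((e₂ :* e₃ :+ e₂ :* e₃) :+ ((e₂ :* b₃ :+ b₂ :* e₃) :+ ((e₂ :* b₃ :+ b₂ :* e₃) :+ (e₂ :* b₃ :+ b₂ :* e₃))))
    := e₂ :* ((e₁ :* e₃ :+ (e₁ :* b₃ :+ b₁ :* e₃)) :+ ((e₁ :* b₃ :+ b₁ :* e₃) :+ (b₁ :* b₃ :+ (b₁ :* b₃ :+ b₁ :* b₃))))
      :+ b₂ :* ((e₁ :* e₃ :+ e₁ :* e₃) :+ ((e₁ :* b₃ :+ b₁ :* e₃) :+ ((e₁ :* b₃ :+ b₁ :* e₃) :+ (e₁ :* b₃ :+ b₁ :* e₃)))))
    refl (e T) (b T) (e U) (b U) (e W) (b W)

  P-swap₂₃ : ∀ T U W → P (code T U W) ≈ P (code T W U)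
  P-swap₂₃ T U W = solve 6 (λ e₁ b₁ e₂ b₂ e₃ b₃ →
    e₁ :* ((e₂ :* e₃ :+ (e₂ :* b₃ :+ b₂ :* e₃)) :+ ((e₂ :* b₃ :+ b₂ :* e₃) :+ (b₂ :* b₃ :+ (b₂ :* b₃ :+ b₂ :* b₃))))
      :+ b₁ :* ((e₂ :* e₃ :+ e₂ :* e₃) :+ ((e₂ :* b₃ :+ b₂ :* e₃) :+ ((e₂ :* b₃ :+ b₂ :* e₃) :+ (e₂ :* b₃ :+ b₂ :* e₃))))
    := e₁ :* ((e₃ :* e₂ :+ (e₃ :* b₂ :+ b₃ :* e₂)) :+ ((e₃ :* b₂ :+ b₃ :* e₂) :+ (b₃ :* b₂ :+ (b₃ :* b₂ :+ b₃ :* b₂))))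
      :+ b₁ :* ((e₃ :* e₂ :+ e₃ :* e₂) :+ ((e₃ :* b₂ :+ b₃ :* e₂) :+ ((e₃ :* b₂ :+ b₃ :* e₂) :+ (e₃ :* b₂ :+ b₃ :* e₂)))))
    refl (e T) (b T) (e U) (b U) (e W) (b W)

  private
    rotate : ∀ l m n → m ℕ.+ (l ℕ.+ n) ≡ l ℕ.+ (m ℕ.+ n)
    rotate l m n = ≡.trans (≡.sym (ℕ.+-assoc m l n)) (≡.trans (≡.cong (ℕ._+ n) (ℕ.+-comm m l)) (ℕ.+-assoc l m n))

  improves-swap₁₂ : ∀ {T U W κ} → Improvesᶜ κ (code U T W) → Improvesᶜ κ (code T U W)
  improves-swap₁₂ {T} {U} {W} i = record
    { sizeᶜ≡ = ≡.trans (sizeᶜ≡ i) (rotate (size T) (size U) (size W))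
    ; leavesᶜ≡ = ≡.trans (leavesᶜ≡ i) (rotate (leaves T) (leaves U) (leaves W))
    ; P≺ = ≺-resp refl (P-swap₁₂ U T W) (P≺ i) }

  improves-swap₂₃ : ∀ {T U W κ} → Improvesᶜ κ (code T W U) → Improvesᶜ κ (code T U W)
  improves-swap₂₃ {T} {U} {W} i = record
    { sizeᶜ≡ = ≡.trans (sizeᶜ≡ i) (≡.cong (size T ℕ.+_) (ℕ.+-comm (size W) (size U)))
    ; leavesᶜ≡ = ≡.trans (leavesᶜ≡ i) (≡.cong (leaves T ℕ.+_) (ℕ.+-comm (leaves W) (leaves U)))
    ; P≺ = ≺-resp refl (P-swap₂₃ T W U) (P≺ i) }

  -- For fixed `b Y` and `b V`, `P` is affine in `E Y` and in `E V`. The symmetry of the triangle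
  -- makes the constant and the two linear terms agree before and after the move. Only the bilinear
  -- term is lost; its coefficient is the minor `e W + 2 b W` left when both loaded vertices are
  -- deleted.
  unite : ∀ T c U d W → Improvesᶜ (code • ((U ◁ d) ⧺ (T ◁ c)) W) (code (T ◁ c) (U ◁ d) W)
  unite T c U d W = record
    { sizeᶜ≡ = ≡.trans (≡.cong (ℕ._+ size W) (size-⧺ V Y)) (≡.trans (≡.cong (ℕ._+ size W) (ℕ.+-comm (size V) (size Y))) (ℕ.+-assoc (size Y) (size V) (size W)))
    ; leavesᶜ≡ = ≡.trans (≡.cong (ℕ._+ leaves W) (≡.trans (leaves-⧺ V Y) (ℕ.+-comm (leaves V) (leaves Y)))) (ℕ.+-assoc (leaves Y) (leaves V) (leaves W))
    ; P≺ = E Y * (E V * (e W + (b W + b W))) , pos-* (pos-E T c) (pos-* (pos-E U d) (pos-+ˡ (pos-e W))) , sym (begin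
        x * ((e (V ⧺ Y) * e W + (e (V ⧺ Y) * b W + b (V ⧺ Y) * e W)) + ((e (V ⧺ Y) * b W + b (V ⧺ Y) * e W) + (b (V ⧺ Y) * b W + (b (V ⧺ Y) * b W + b (V ⧺ Y) * b W))))
          + 1# * ((e (V ⧺ Y) * e W + e (V ⧺ Y) * e W) + ((e (V ⧺ Y) * b W + b (V ⧺ Y) * e W) + ((e (V ⧺ Y) * b W + b (V ⧺ Y) * e W) + (e (V ⧺ Y) * b W + b (V ⧺ Y) * e W))))
          + E Y * (E V * (e W + (b W + b W)))
          ≈⟨ +-congʳ (value-cong eN bN) ⟩
        x * ((eN′ * e W + (eN′ * b W + bN′ * e W)) + ((eN′ * b W + bN′ * e W) + (bN′ * b W + (bN′ * b W + bN′ * b W))))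
          + 1# * ((eN′ * e W + eN′ * e W) + ((eN′ * b W + bN′ * e W) + ((eN′ * b W + bN′ * e W) + (eN′ * b W + bN′ * e W))))
          + E Y * (E V * (e W + (b W + b W)))
          ≈⟨ solve 7 (λ x b₁ E₁ b₂ E₂ e₃ b₃ →
               let e₁ = x :* b₁ :+ E₁ ; e₂ = x :* b₂ :+ E₂ ; e = e₂ :* b₁ :+ b₂ :* E₁ ; b = b₂ :* b₁ in
               x :* ((e :* e₃ :+ (e :* b₃ :+ b :* e₃)) :+ ((e :* b₃ :+ b :* e₃) :+ (b :* b₃ :+ (b :* b₃ :+ b :* b₃))))
                 :+ con 1 :* ((e :* e₃ :+ e :* e₃) :+ ((e :* b₃ :+ b :* e₃) :+ ((e :* b₃ :+ b :* e₃) :+ (e :* b₃ :+ b :* e₃))))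
                 :+ E₁ :* (E₂ :* (e₃ :+ (b₃ :+ b₃)))
               := e₁ :* ((e₂ :* e₃ :+ (e₂ :* b₃ :+ b₂ :* e₃)) :+ ((e₂ :* b₃ :+ b₂ :* e₃) :+ (b₂ :* b₃ :+ (b₂ :* b₃ :+ b₂ :* b₃))))
                 :+ b₁ :* ((e₂ :* e₃ :+ e₂ :* e₃) :+ ((e₂ :* b₃ :+ b₂ :* e₃) :+ ((e₂ :* b₃ :+ b₂ :* e₃) :+ (e₂ :* b₃ :+ b₂ :* e₃)))))
               refl x (b Y) (E Y) (b V) (E V) (e W) (b W) ⟩
        eY * ((eV * e W + (eV * b W + b V * e W)) + ((eV * b W + b V * e W) + (b V * b W + (b V * b W + b V * b W))))
          + b Y * ((eV * e W + eV * e W) + ((eV * b W + b V * e W) + ((eV * b W + b V * e W) + (eV * b W + b V * e W))))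
          ≈⟨ sym value-split ⟩
        P (code Y V W) ∎)
    }
    where
    Y = T ◁ c
    V = U ◁ d
    eY eV eN′ bN′ : Carrier
    eY = x * b Y + E Y
    eV = x * b V + E V
    eN′ = eV * b Y + b V * E Y
    bN′ = b V * b Y
    eN : e (V ⧺ Y) ≈ eN′
    eN = trans (proj₁ (weight-⧺ V Y)) (+-congʳ (*-congʳ (e-split V)))
    bN : b (V ⧺ Y) ≈ bN′
    bN = proj₂ (weight-⧺ V Y)
    factors : Carrier → Carrier → Carrier × Carrier
    factors e₂ b₂ = (e₂ * e W + (e₂ * b W + b₂ * e W)) + ((e₂ * b W + b₂ * e W) + (b₂ * b W + (b₂ * b W + b₂ * b W)))
                  , (e₂ * e W + e₂ * e W) + ((e₂ * b W + b₂ * e W) + ((e₂ * b W + b₂ * e W) + (e₂ * b W + b₂ * e W)))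
    factors-cong : ∀ {p p′ q q′} → p ≈ p′ → q ≈ q′ → (proj₁ (factors p q) ≈ proj₁ (factors p′ q′)) × (proj₂ (factors p q) ≈ proj₂ (factors p′ q′))
    factors-cong h h′ = +-cong (+-cong (*-congʳ h) cross) (+-cong cross (+-cong (*-congʳ h′) (+-cong (*-congʳ h′) (*-congʳ h′))))
                      , +-cong (+-cong (*-congʳ h) (*-congʳ h)) (+-cong cross (+-cong cross cross))
      where cross = +-cong (*-congʳ h) (*-congʳ h′)
    value-cong : ∀ {p p′ q q′} → p ≈ p′ → q ≈ q′ →
      x * proj₁ (factors p q) + 1# * proj₂ (factors p q) ≈ x * proj₁ (factors p′ q′) + 1# * proj₂ (factors p′ q′)
    value-cong h h′ = +-cong (*-congˡ (proj₁ (factors-cong h h′))) (*-congˡ (proj₂ (factors-cong h h′)))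
    value-split : P (code Y V W) ≈ eY * proj₁ (factors eV (b V)) + b Y * proj₂ (factors eV (b V))
    value-split = +-cong (*-cong (e-split Y) (proj₁ (factors-cong (e-split V) refl))) (*-congˡ (proj₂ (factors-cong (e-split V) refl)))

  -- The weight of the triangle with a tail of q edges, seen from the end of the tail:
  -- tailB is its b and x tailB + tailE its e.
  tailB tailE : ℕ → Carrier
  tailB zero = (x * x + (x * 1# + 1# * x)) + ((x * 1# + 1# * x) + (1# * 1# + (1# * 1# + 1# * 1#)))
  tailB (suc q) = (x * tailB q + tailE q) + tailB q
  tailE zero = (x * x + x * x) + ((x * 1# + 1# * x) + ((x * 1# + 1# * x) + (x * 1# + 1# * x)))
  tailE (suc q) = x * tailB q + tailE q

  tail : ℕ → Weight
  tail q = x * tailB q + tailE q , tailB q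

  P-chain : ∀ q T → P (code (chain q T) • •) ≈ tailB q * e T + tailE q * b T
  P-chain zero T = +-cong (*-comm _ _) (*-comm _ _)
  P-chain (suc q) T = trans (reflexive (≡.cong (λ t → P (code t • •)) (chain-suc q T))) (trans (P-chain q (• ◁ T))
    (solve 5 (λ x t s e b → t :* (x :* (e :+ b) :+ con 1 :* e) :+ s :* (con 1 :* (e :+ b)) := ((x :* t :+ s) :+ t) :* e :+ (x :* t :+ s) :* b) refl x (tailB q) (tailE q) (e T) (b T)))

  -- The two positions of the centre differ only in which factors multiply E Z.
  rest : ℕ → Tree → ℕ → Carrier
  rest q Z d = ((x * tailB q + tailE q) * a Y + tailB q * e Y) * b Z + tailB q * b Y * E Z
    where Y = path (suc d)

  P-far : ∀ q Z d → P (code (chain (suc q) (Z ◁ path d)) • •) ≈ rest q Z d + E Z * ((x * tailB q + tailE q) * b (path (suc d)))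
  P-far q Z d = trans (P-chain (suc q) (Z ◁ path d)) (trans (+-congʳ (*-congˡ (+-congʳ (*-congʳ (e-split Z)))))
    (solve 7 (λ x t s bZ EZ ep ap →
       let eY = x :* ap :+ con 1 :* ep ; bY = con 1 :* ap in
       ((x :* t :+ s) :+ t) :* ((x :* bZ :+ EZ) :* ap :+ bZ :* ep) :+ (x :* t :+ s) :* (bZ :* ap)
       := ((x :* t :+ s) :* (eY :+ bY) :+ t :* eY) :* bZ :+ t :* bY :* EZ :+ EZ :* ((x :* t :+ s) :* bY))
       refl x (tailB q) (tailE q) (b Z) (E Z) (e (path d)) (a (path d))))

  P-near : ∀ q Z d → P (code (chain q (Z ◁ path (suc d))) • •) ≈ rest q Z d + E Z * (e (path (suc d)) * tailB q)
  P-near q Z d = trans (P-chain q (Z ◁ path (suc d))) (trans (+-congʳ (*-congˡ (+-congʳ (*-congʳ (e-split Z)))))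
    (solve 7 (λ x t s bZ EZ eY bY →
       t :* ((x :* bZ :+ EZ) :* (eY :+ bY) :+ bZ :* eY) :+ s :* (bZ :* (eY :+ bY))
       := ((x :* t :+ s) :* (eY :+ bY) :+ t :* eY) :* bZ :+ t :* bY :* EZ :+ EZ :* (eY :* t))
       refl x (tailB q) (tailE q) (b Z) (E Z) (e (path (suc d))) (b (path (suc d)))))

  pos-tailE : ∀ q → Pos (tailE q)
  pos-tailE zero = pos-+ˡ (pos-+ˡ (pos-* pos-x pos-x))
  pos-tailE (suc q) = pos-+ʳ (pos-tailE q)

  •-⊏-tail : ∀ q → weight • ⊏ tail q
  •-⊏-tail q = tailE q , pos-tailE q , *-identityʳ _

  hang-⊏-tail : ∀ A q → weight A ⊏ tail q → weight (• ◁ A) ⊏ tail (suc q)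
  hang-⊏-tail A q (δ , pδ , h) = δ , pδ , (begin
    (x * ((x * t + s) + t) + (x * t + s)) * (1# * a A)
      ≈⟨ solve 5 (λ x t s eA bA → (x :* ((x :* t :+ s) :+ t) :+ (x :* t :+ s)) :* (con 1 :* (eA :+ bA))
           := x :* ((x :* t :+ s) :+ t) :* (eA :+ bA) :+ (x :* t :+ s) :* eA :+ (x :* t :+ s) :* bA) refl x t s (e A) (b A) ⟩
    x * ((x * t + s) + t) * (e A + b A) + (x * t + s) * e A + (x * t + s) * b A
      ≈⟨ +-congˡ h ⟩
    x * ((x * t + s) + t) * (e A + b A) + (x * t + s) * e A + (e A * t + δ)
      ≈⟨ solve 6 (λ x t s eA bA δ → x :* ((x :* t :+ s) :+ t) :* (eA :+ bA) :+ (x :* t :+ s) :* eA :+ (eA :* t :+ δ)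
           := (x :* (eA :+ bA) :+ con 1 :* eA) :* ((x :* t :+ s) :+ t) :+ δ) refl x t s (e A) (b A) δ ⟩
    (x * a A + 1# * e A) * ((x * t + s) + t) + δ ∎)
    where
    t = tailB q
    s = tailE q

  -- The triangle has larger conductance than a path on at most three vertices.
  path-⊏-tail : ∀ d q → d ℕ.≤ 2 ℕ.+ q → weight (path d) ⊏ tail q
  path-⊏-tail zero q _ = •-⊏-tail q
  path-⊏-tail (suc d) (suc q) (s≤s le) = hang-⊏-tail (path d) q (path-⊏-tail d q le)
  path-⊏-tail 1 zero _ = x * x * x + (x * x + x * x + x * x + x * x) + (x + x + x) ,
    pos-+ʳ (pos-+ʳ pos-x) ,
    solve 1 (λ x → (x :* ((x :* x :+ (x :* con 1 :+ con 1 :* x)) :+ ((x :* con 1 :+ con 1 :* x) :+ (con 1 :* con 1 :+ (con 1 :* con 1 :+ con 1 :* con 1))))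
          :+ ((x :* x :+ x :* x) :+ ((x :* con 1 :+ con 1 :* x) :+ ((x :* con 1 :+ con 1 :* x) :+ (x :* con 1 :+ con 1 :* x))))) :* (con 1 :* (x :+ con 1))
        := (x :* (x :+ con 1) :+ con 1 :* x) :* ((x :* x :+ (x :* con 1 :+ con 1 :* x)) :+ ((x :* con 1 :+ con 1 :* x) :+ (con 1 :* con 1 :+ (con 1 :* con 1 :+ con 1 :* con 1))))
          :+ (x :* x :* x :+ (x :* x :+ x :* x :+ x :* x :+ x :* x) :+ (x :+ x :+ x))) refl x
  -- The surplus is x²(x + 3)². The terms 9x of the two sides cancel, as triangle and path have
  -- three vertices each; for a path on four vertices the surplus would start with -3x, so the bound
  -- on `d` is sharp.
  path-⊏-tail 2 zero _ = x * x * (x * x) + (x * x * x + x * x * x + x * x * x + x * x * x + x * x * x + x * x * x) + (x * x + x * x + x * x + x * x + x * x + x * x + x * x + x * x + x * x) ,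
    pos-+ˡ (pos-+ˡ (pos-* (pos-* pos-x pos-x) (pos-* pos-x pos-x))) ,
    solve 1 (λ x → (x :* ((x :* x :+ (x :* con 1 :+ con 1 :* x)) :+ ((x :* con 1 :+ con 1 :* x) :+ (con 1 :* con 1 :+ (con 1 :* con 1 :+ con 1 :* con 1))))
          :+ ((x :* x :+ x :* x) :+ ((x :* con 1 :+ con 1 :* x) :+ ((x :* con 1 :+ con 1 :* x) :+ (x :* con 1 :+ con 1 :* x))))) :* (con 1 :* ((x :* (x :+ con 1) :+ con 1 :* x) :+ con 1 :* (x :+ con 1)))
        := (x :* ((x :* (x :+ con 1) :+ con 1 :* x) :+ con 1 :* (x :+ con 1)) :+ con 1 :* (x :* (x :+ con 1) :+ con 1 :* x)) :* ((x :* x :+ (x :* con 1 :+ con 1 :* x)) :+ ((x :* con 1 :+ con 1 :* x) :+ (con 1 :* con 1 :+ (con 1 :* con 1 :+ con 1 :* con 1))))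
          :+ (x :* x :* (x :* x) :+ (x :* x :* x :+ x :* x :* x :+ x :* x :* x :+ x :* x :* x :+ x :* x :* x :+ x :* x :* x) :+ (x :* x :+ x :* x :+ x :* x :+ x :* x :+ x :* x :+ x :* x :+ x :* x :+ x :* x :+ x :* x))) refl x
  path-⊏-tail (suc (suc (suc d))) zero (s≤s (s≤s ()))

  -- If the tail is long, the centre moves one step towards the triangle and a leg grows.
  shift : ∀ q U c d → d ℕ.≤ suc q →
    Improvesᶜ (code (chain q ((U ◁ c) ◁ path (suc d))) • •) (code (chain (suc q) ((U ◁ c) ◁ path d)) • •)
  shift q U c d le with path-⊏-tail (suc d) q (s≤s le)
  ... | δ , pδ , h = record
    { sizeᶜ≡ = ≡.cong (ℕ._+ 2) (≡.trans (size-chain q _) (≡.trans (≡.cong (q ℕ.+_) (ℕ.+-suc (size Z) (size (path d)))) (≡.trans (ℕ.+-suc q _) (≡.cong suc (≡.sym (size-chain q _))))))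
    ; leavesᶜ≡ = ≡.cong (ℕ._+ 0) (leaves-eq q)
    ; P≺ = E Z * δ , pos-* (pos-E U c) pδ , trans (P-far q Z d) (trans
        (trans (+-congˡ (trans (*-congˡ h) (distribˡ _ _ _))) (sym (+-assoc _ _ _))) (+-congʳ (sym (P-near q Z d)))) }
    where
    Z = U ◁ c
    leaves-eq : ∀ q → leaves (chain q (Z ◁ path (suc d))) ≡ leaves (chain (suc q) (Z ◁ path d))
    leaves-eq zero = ≡.refl
    leaves-eq (suc q) = ≡.trans (leavesHung-chain q _) (≡.sym (leavesHung-chain q _))

-- Reordering of children, and isomorphism of represented graphs.

module Isomorphism where

  open import Defs using (Graph; Iso)
  open import Data.Bool using (Bool; _∧_)
  open import Data.Product using (_,_)
  open import Data.List.Relation.Binary.Permutation.Propositional using (_↭_; refl; prep; swap; trans)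
  open import Data.Nat using (zero; suc)
  open import Function.Bundles using (mk↔ₛ′)
  open import Relation.Binary.PropositionalEquality as ≡ using (_≡_; cong; cong₂)
  open RootedTree
  open Shapes
  open Representation using (Rep)

  infix 4 _~_
  -- Equality up to the order of the children.
  data _~_ : Tree → Tree → Set where
    ~-refl : ∀ {T} → T ~ T
    ~-trans : ∀ {T U W} → T ~ U → U ~ W → T ~ W
    ~-swap : ∀ {T c d} → (T ◁ c) ◁ d ~ (T ◁ d) ◁ c
    ~-root : ∀ {T U c} → T ~ U → T ◁ c ~ U ◁ c
    ~-child : ∀ {T c d} → c ~ d → T ◁ c ~ T ◁ d

  ~-sym : ∀ {T U} → T ~ U → U ~ T
  ~-sym ~-refl = ~-refl
  ~-sym (~-trans p q) = ~-trans (~-sym q) (~-sym p)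
  ~-sym ~-swap = ~-swap
  ~-sym (~-root p) = ~-root (~-sym p)
  ~-sym (~-child p) = ~-child (~-sym p)

  spider-↭ : ∀ {L L′} → L ↭ L′ → spider L ~ spider L′
  spider-↭ refl = ~-refl
  spider-↭ (prep m p) = ~-root (spider-↭ p)
  spider-↭ (swap m m′ p) = ~-trans ~-swap (~-root (~-root (spider-↭ p)))
  spider-↭ (trans p q) = ~-trans (spider-↭ p) (spider-↭ q)

  chain-~ : ∀ k {T U} → T ~ U → chain k T ~ chain k U
  chain-~ zero p = p
  chain-~ (suc k) p = ~-child (chain-~ k p)

  map~ : ∀ {T U} → T ~ U → Vertex T → Vertex U
  map~ ~-refl u = u
  map~ (~-trans p q) u = map~ q (map~ p u)
  map~ ~-swap (inS (inS u)) = inS (inS u)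
  map~ ~-swap (inS (inC u)) = inC u
  map~ ~-swap (inC u) = inS (inC u)
  map~ (~-root p) (inS u) = inS (map~ p u)
  map~ (~-root p) (inC u) = inC u
  map~ (~-child p) (inS u) = inS u
  map~ (~-child p) (inC u) = inC (map~ p u)

  map~-sym : ∀ {T U} (p : T ~ U) u → map~ (~-sym p) (map~ p u) ≡ u
  map~-sym ~-refl u = ≡.refl
  map~-sym (~-trans p q) u = ≡.trans (cong (map~ (~-sym p)) (map~-sym q (map~ p u))) (map~-sym p u)
  map~-sym ~-swap (inS (inS u)) = ≡.refl
  map~-sym ~-swap (inS (inC u)) = ≡.refl
  map~-sym ~-swap (inC u) = ≡.refl
  map~-sym (~-root p) (inS u) = cong inS (map~-sym p u)
  map~-sym (~-root p) (inC u) = ≡.refl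
  map~-sym (~-child p) (inS u) = ≡.refl
  map~-sym (~-child p) (inC u) = cong inC (map~-sym p u)

  -- Lets the second inverse law be read off from the first, applied to the reversed proof.
  ~-sym-sym : ∀ {T U} (p : T ~ U) → ~-sym (~-sym p) ≡ p
  ~-sym-sym ~-refl = ≡.refl
  ~-sym-sym (~-trans p q) = cong₂ ~-trans (~-sym-sym p) (~-sym-sym q)
  ~-sym-sym ~-swap = ≡.refl
  ~-sym-sym (~-root p) = cong ~-root (~-sym-sym p)
  ~-sym-sym (~-child p) = cong ~-child (~-sym-sym p)

  map~-sym′ : ∀ {T U} (p : T ~ U) u → map~ p (map~ (~-sym p) u) ≡ u
  map~-sym′ p u = ≡.trans (cong (λ q → map~ q (map~ (~-sym p) u)) (≡.sym (~-sym-sym p))) (map~-sym (~-sym p) u)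

  isRoot-map~ : ∀ {T U} (p : T ~ U) u → isRoot (map~ p u) ≡ isRoot u
  isRoot-map~ ~-refl u = ≡.refl
  isRoot-map~ (~-trans p q) u = ≡.trans (isRoot-map~ q (map~ p u)) (isRoot-map~ p u)
  isRoot-map~ ~-swap (inS (inS u)) = ≡.refl
  isRoot-map~ ~-swap (inS (inC u)) = ≡.refl
  isRoot-map~ ~-swap (inC u) = ≡.refl
  isRoot-map~ (~-root p) (inS u) = isRoot-map~ p u
  isRoot-map~ (~-root p) (inC u) = ≡.refl
  isRoot-map~ (~-child p) (inS u) = ≡.refl
  isRoot-map~ (~-child p) (inC u) = ≡.refl

  adj-map~ : ∀ {T U} (p : T ~ U) u v → adj (map~ p u) (map~ p v) ≡ adj u v
  adj-map~ ~-refl u v = ≡.refl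
  adj-map~ (~-trans p q) u v = ≡.trans (adj-map~ q (map~ p u) (map~ p v)) (adj-map~ p u v)
  adj-map~ ~-swap (inS (inS u)) (inS (inS v)) = ≡.refl
  adj-map~ ~-swap (inS (inS u)) (inS (inC v)) = ≡.refl
  adj-map~ ~-swap (inS (inS u)) (inC v) = ≡.refl
  adj-map~ ~-swap (inS (inC u)) (inS (inS v)) = ≡.refl
  adj-map~ ~-swap (inS (inC u)) (inS (inC v)) = ≡.refl
  adj-map~ ~-swap (inS (inC u)) (inC v) = ∧-false (isRoot u)
    where
    ∧-false : ∀ b → (b ∧ Bool.false) ≡ Bool.false
    ∧-false Bool.false = ≡.refl
    ∧-false Bool.true = ≡.refl
  adj-map~ ~-swap (inC u) (inS (inS v)) = ≡.refl
  adj-map~ ~-swap (inC u) (inS (inC v)) = ∧-false′ (isRoot u)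
    where
    ∧-false′ : ∀ b → Bool.false ≡ (b ∧ Bool.false)
    ∧-false′ Bool.false = ≡.refl
    ∧-false′ Bool.true = ≡.refl
  adj-map~ ~-swap (inC u) (inC v) = ≡.refl
  adj-map~ (~-root p) (inS u) (inS v) = adj-map~ p u v
  adj-map~ (~-root p) (inS u) (inC v) = cong (_∧ isRoot v) (isRoot-map~ p u)
  adj-map~ (~-root p) (inC u) (inS v) = cong (isRoot u ∧_) (isRoot-map~ p v)
  adj-map~ (~-root p) (inC u) (inC v) = ≡.refl
  adj-map~ (~-child p) (inS u) (inS v) = ≡.refl
  adj-map~ (~-child p) (inS u) (inC v) = cong (isRoot u ∧_) (isRoot-map~ p v)
  adj-map~ (~-child p) (inC u) (inS v) = cong (_∧ isRoot v) (isRoot-map~ p u)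
  adj-map~ (~-child p) (inC u) (inC v) = adj-map~ p u v

  private
    map₁ : ∀ {T T′ U W} → T ~ T′ → Vertexᶜ (code T U W) → Vertexᶜ (code T′ U W)
    map₁ p (in₁ u) = in₁ (map~ p u)
    map₁ p (in₂ u) = in₂ u
    map₁ p (in₃ u) = in₃ u

    swap₁₂ : ∀ {T U W} → Vertexᶜ (code T U W) → Vertexᶜ (code U T W)
    swap₁₂ (in₁ u) = in₂ u
    swap₁₂ (in₂ u) = in₁ u
    swap₁₂ (in₃ u) = in₃ u

    swap₂₃ : ∀ {T U W} → Vertexᶜ (code T U W) → Vertexᶜ (code T W U)
    swap₂₃ (in₁ u) = in₁ u
    swap₂₃ (in₂ u) = in₃ u
    swap₂₃ (in₃ u) = in₂ u

    transport : ∀ {n} {G : Graph n} {κ κ′} (f : Vertexᶜ κ′ → Vertexᶜ κ) (g : Vertexᶜ κ → Vertexᶜ κ′) →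
      (∀ u → f (g u) ≡ u) → (∀ u → g (f u) ≡ u) → (∀ u v → adjᶜ (f u) (f v) ≡ adjᶜ u v) → Rep G κ → Rep G κ′
    transport f g fg gf h rep = record
      { to = λ u → to (f u)
      ; from = λ i → g (from i)
      ; to-from = λ i → ≡.trans (cong to (fg _)) (to-from i)
      ; from-to = λ u → ≡.trans (cong g (from-to _)) (gf u)
      ; edge = λ u v → ≡.trans (edge _ _) (h u v) }
      where open Rep rep

  rep-~ : ∀ {n} {G : Graph n} {T T′ U W} → T ~ T′ → Rep G (code T U W) → Rep G (code T′ U W)
  rep-~ {T = T} {T′} {U} {W} p = transport (map₁ (~-sym p)) (map₁ p)
    (λ { (in₁ u) → cong in₁ (map~-sym p u) ; (in₂ u) → ≡.refl ; (in₃ u) → ≡.refl })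
    (λ { (in₁ u) → cong in₁ (map~-sym′ p u) ; (in₂ u) → ≡.refl ; (in₃ u) → ≡.refl })
    (λ { (in₁ u) (in₁ v) → adj-map~ (~-sym p) u v
       ; (in₁ u) (in₂ v) → cong (_∧ isRoot v) (isRoot-map~ (~-sym p) u)
       ; (in₁ u) (in₃ v) → cong (_∧ isRoot v) (isRoot-map~ (~-sym p) u)
       ; (in₂ u) (in₁ v) → cong (isRoot u ∧_) (isRoot-map~ (~-sym p) v)
       ; (in₂ u) (in₂ v) → ≡.refl
       ; (in₂ u) (in₃ v) → ≡.refl
       ; (in₃ u) (in₁ v) → cong (isRoot u ∧_) (isRoot-map~ (~-sym p) v)
       ; (in₃ u) (in₂ v) → ≡.refl
       ; (in₃ u) (in₃ v) → ≡.refl })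

  rep-swap₁₂ : ∀ {n} {G : Graph n} {T U W} → Rep G (code T U W) → Rep G (code U T W)
  rep-swap₁₂ = transport swap₁₂ swap₁₂
    (λ { (in₁ u) → ≡.refl ; (in₂ u) → ≡.refl ; (in₃ u) → ≡.refl })
    (λ { (in₁ u) → ≡.refl ; (in₂ u) → ≡.refl ; (in₃ u) → ≡.refl })
    (λ { (in₁ u) (in₁ v) → ≡.refl ; (in₁ u) (in₂ v) → ≡.refl ; (in₁ u) (in₃ v) → ≡.refl
       ; (in₂ u) (in₁ v) → ≡.refl ; (in₂ u) (in₂ v) → ≡.refl ; (in₂ u) (in₃ v) → ≡.refl
       ; (in₃ u) (in₁ v) → ≡.refl ; (in₃ u) (in₂ v) → ≡.refl ; (in₃ u) (in₃ v) → ≡.refl })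

  rep-swap₂₃ : ∀ {n} {G : Graph n} {T U W} → Rep G (code T U W) → Rep G (code T W U)
  rep-swap₂₃ = transport swap₂₃ swap₂₃
    (λ { (in₁ u) → ≡.refl ; (in₂ u) → ≡.refl ; (in₃ u) → ≡.refl })
    (λ { (in₁ u) → ≡.refl ; (in₂ u) → ≡.refl ; (in₃ u) → ≡.refl })
    (λ { (in₁ u) (in₁ v) → ≡.refl ; (in₁ u) (in₂ v) → ≡.refl ; (in₁ u) (in₃ v) → ≡.refl
       ; (in₂ u) (in₁ v) → ≡.refl ; (in₂ u) (in₂ v) → ≡.refl ; (in₂ u) (in₃ v) → ≡.refl
       ; (in₃ u) (in₁ v) → ≡.refl ; (in₃ u) (in₂ v) → ≡.refl ; (in₃ u) (in₃ v) → ≡.refl })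

  rep-iso : ∀ {n} {G H : Graph n} {κ} → Rep G κ → Rep H κ → Iso G H
  rep-iso r s = mk↔ₛ′ (λ i → S.to (R.from i)) (λ i → R.to (S.from i))
      (λ i → ≡.trans (cong S.to (R.from-to _)) (S.to-from i))
      (λ i → ≡.trans (cong R.to (S.from-to _)) (R.to-from i))
    , λ i j → ≡.trans (S.edge _ _) (≡.sym (R.edge′ i j))
    where
    module R = Rep r
    module S = Rep s

  iso-rep : ∀ {n} {G H : Graph n} {κ} → Iso G H → Rep G κ → Rep H κ
  iso-rep (σ , h) r = record
    { to = λ u → Inverse.to σ (to u)
    ; from = λ i → from (Inverse.from σ i)
    ; to-from = λ i → ≡.trans (cong (Inverse.to σ) (to-from _)) (Inverse.strictlyInverseˡ σ i)
    ; from-to = λ u → ≡.trans (cong from (Inverse.strictlyInverseʳ σ _)) (from-to u)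
    ; edge = λ u v → ≡.trans (h _ _) (edge u v) }
    where
    open Rep r
    open import Function.Bundles using (Inverse)

-- Reduction of a rooted tree to a chain ending in a balanced spider.

module Reduction (PS : PositiveSemiring) where

  open PositiveSemiring PS renaming (commutativeSemiring to S)
  open CommutativeSemiring S hiding (zero)

  open import Data.Nat as ℕ using (ℕ; zero; suc; s≤s)
  import Data.Nat.Properties as ℕ
  open import Data.List using (List; []; _∷_; _++_; replicate)
  open import Data.List.Relation.Binary.Permutation.Propositional using (_↭_; ↭-refl; ↭-reflexive; ↭-sym; ↭-trans; prep; swap)
  open import Data.List.Relation.Binary.Permutation.Propositional.Properties using (shift)
  open import Data.Product using (_×_; _,_; proj₁; proj₂; ∃-syntax)
  open import Relation.Binary.Definitions using (tri<; tri≈; tri>)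
  open import Data.List.Properties using (++-identityʳ)
  open import Data.Sum using (_⊎_; inj₁; inj₂)
  open import Relation.Binary.PropositionalEquality as ≡ using (_≡_)
  open RootedTree
  open Shapes
  open Value S
  open Isomorphism using (_~_; ~-refl; ~-trans; ~-swap; ~-root; ~-child; spider-↭)
  open Moves PS hiding (shift)
  open Improves
  open Improvesᶜ

  weight-~ : ∀ {T U} → T ~ U → (e T ≈ e U) × (b T ≈ b U)
  weight-~ ~-refl = refl , refl
  weight-~ (~-trans p q) = trans (proj₁ (weight-~ p)) (proj₁ (weight-~ q)) , trans (proj₂ (weight-~ p)) (proj₂ (weight-~ q))
  weight-~ (~-swap {T} {c} {d}) = swap-weight T c d
  weight-~ (~-root p) with weight-~ p
  ... | he , hb = +-cong (*-congʳ he) (*-congʳ hb) , *-congʳ hb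
  weight-~ (~-child p) with weight-~ p
  ... | he , hb = +-cong (*-congˡ (+-cong he hb)) (*-congˡ he) , *-congˡ (+-cong he hb)

  size-~ : ∀ {T U} → T ~ U → size T ≡ size U
  size-~ ~-refl = ≡.refl
  size-~ (~-trans p q) = ≡.trans (size-~ p) (size-~ q)
  size-~ (~-swap {T} {c} {d}) = size-swap T c d
  size-~ (~-root p) = ≡.cong (ℕ._+ _) (size-~ p)
  size-~ (~-child p) = ≡.cong (_ ℕ.+_) (size-~ p)

  mutual
    leaves-~ : ∀ {T U} → T ~ U → leaves T ≡ leaves U
    leaves-~ ~-refl = ≡.refl
    leaves-~ (~-trans p q) = ≡.trans (leaves-~ p) (leaves-~ q)
    leaves-~ (~-swap {T} {c} {d}) = leaves-swap T c d
    leaves-~ (~-root p) = ≡.cong (ℕ._+ _) (leaves-~ p)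
    leaves-~ (~-child p) = ≡.cong (_ ℕ.+_) (leavesHung-~ p)

    leavesHung-~ : ∀ {T U} → T ~ U → leavesHung T ≡ leavesHung U
    leavesHung-~ ~-refl = ≡.refl
    leavesHung-~ (~-trans p q) = ≡.trans (leavesHung-~ p) (leavesHung-~ q)
    leavesHung-~ (~-swap {T} {c} {d}) = leaves-swap T c d
    leavesHung-~ (~-root p) = ≡.cong (ℕ._+ _) (leaves-~ p)
    leavesHung-~ (~-child p) = ≡.cong (_ ℕ.+_) (leavesHung-~ p)

  P-~ : ∀ {T T′} → T ~ T′ → P (code T • •) ≈ P (code T′ • •)
  P-~ p = +-cong (*-congʳ (proj₁ (weight-~ p))) (*-congʳ (proj₂ (weight-~ p)))

  improves-~ : ∀ {T U T′} → T ~ U → Improves T′ U → Improves T′ T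
  improves-~ p i = record
    { size≡ = ≡.trans (size≡ i) (≡.sym (size-~ p))
    ; leaves≡ = ≡.trans (leaves≡ i) (≡.sym (leaves-~ p))
    ; leavesHung≡ = ≡.trans (leavesHung≡ i) (≡.sym (leavesHung-~ p))
    ; e≼ = ≼-trans (e≼ i) (≼-reflexive (proj₁ (weight-~ p)))
    ; b≺ = ≺-resp refl (sym (proj₂ (weight-~ p))) (b≺ i) }

  improvesᶜ-~ : ∀ {T U κ} → T ~ U → Improvesᶜ κ (code U • •) → Improvesᶜ κ (code T • •)
  improvesᶜ-~ p i = record
    { sizeᶜ≡ = ≡.trans (sizeᶜ≡ i) (≡.cong (ℕ._+ 2) (≡.sym (size-~ p)))
    ; leavesᶜ≡ = ≡.trans (leavesᶜ≡ i) (≡.cong (ℕ._+ 0) (≡.sym (leaves-~ p)))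
    ; P≺ = ≺-resp refl (sym (P-~ p)) (P≺ i) }

  improves-chain : ∀ k {T T′} → Improves T′ T → Improves (chain k T′) (chain k T)
  improves-chain zero i = i
  improves-chain (suc k) i = improves-child • (improves-chain k i)

  -- Two legs are demanded of the spider, since a chain ending in a spider with a single leg is just
  -- a path.
  data Normal : Tree → Set where
    isPath : ∀ m → Normal (path m)
    isSpider : ∀ k m m′ ms → Normal (chain k (spider (m ∷ m′ ∷ ms)))

  Improvable : Tree → Set
  Improvable T = ∃[ T′ ] Improves T′ T

  private
    -- One of the two branching places can always be emptied into the other. If the leg `j` at the
    -- root is at least as long as the leg `m` at the far spider, all far branches except `m` move
    -- to the root. Otherwise `T` moves to the far end, which conducts strictly better because of
    -- its further leg `m′`.
    fork-path : ∀ T j k m m′ ms → Improvable ((T ◁ path j) ◁ chain k (spider (m ∷ m′ ∷ ms)))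
    fork-path T j k m m′ ms with ℕ.≤-total m j
    ... | inj₁ m≤j = _ , gather (T ◁ path j) k (spider ms) (path m′) m (hang-⊑ T (path m) (path j) (path-⊑-path m≤j))
    ... | inj₂ j≤m = _ , reroot T (path j) k (spider (m′ ∷ ms)) (path m) (hang-⊏ˡ (spider ms) (path m′) (path j) (path m) (path-⊑-path j≤m))

    -- With spiders below two children, the branches can go to the root in either case: seen from
    -- the root, the other subtree contains a path at least as long as the one left behind.
    fork-spider : ∀ T k′ j j′ js k m m′ ms →
      Improvable ((T ◁ chain k′ (spider (j ∷ j′ ∷ js))) ◁ chain k (spider (m ∷ m′ ∷ ms)))
    fork-spider T k′ j j′ js k m m′ ms with ℕ.≤-total m j
    ... | inj₁ m≤j = _ , gather (T ◁ A) k (spider ms) (path m′) m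
            (hang-⊑ T (path m) A (path-⊑-chain k′ (spider (j′ ∷ js)) (ℕ.m≤n⇒m≤1+n m≤j)))
      where A = chain k′ (spider (j ∷ j′ ∷ js))
    ... | inj₂ j≤m = _ , improves-swap {T} {chain k′ (spider (j ∷ j′ ∷ js))} {D} (gather (T ◁ D) k′ (spider js) (path j′) j
            (hang-⊑ T (path j) D (path-⊑-chain k (spider (m′ ∷ ms)) (ℕ.m≤n⇒m≤1+n j≤m))))
      where D = chain k (spider (m ∷ m′ ∷ ms))

    -- The root of a normal tree is bare, lies on a chain, or is a centre. A new child spoils
    -- normality only when a second branching vertex arises, and then one of the forks applies.
    join : ∀ {T c} → Normal T → Normal c → Normal (T ◁ c) ⊎ Improvable (T ◁ c)
    join (isPath zero) (isPath m) = inj₁ (isPath (suc m))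
    join (isPath zero) (isSpider k m m′ ms) = inj₁ (isSpider (suc k) m m′ ms)
    join (isPath (suc s)) (isPath m) = inj₁ (isSpider zero m s [])
    join (isPath (suc s)) (isSpider k m m′ ms) = inj₂ (fork-path • s k m m′ ms)
    join (isSpider zero m m′ ms) (isPath j) = inj₁ (isSpider zero j m (m′ ∷ ms))
    join (isSpider zero j j′ js) (isSpider k m m′ ms) = inj₂ (fork-path (spider (j′ ∷ js)) j k m m′ ms)
    join (isSpider (suc k) m m′ ms) (isPath j) with fork-path • j k m m′ ms
    ... | T′ , i = inj₂ (T′ , improves-swap {•} {chain k (spider (m ∷ m′ ∷ ms))} {path j} i)
    join (isSpider (suc k′) j j′ js) (isSpider k m m′ ms) = inj₂ (fork-spider • k′ j j′ js k m m′ ms)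

  -- A single improvement is enough here; the iteration is left to the descent on the value at x =
  -- 1.
  reduce : ∀ T → Normal T ⊎ Improvable T
  reduce • = inj₁ (isPath 0)
  reduce (T ◁ c) with reduce T | reduce c
  ... | inj₂ (T′ , i) | _ = inj₂ (T′ ◁ c , improves-root c i)
  ... | inj₁ _ | inj₂ (c′ , i) = inj₂ (T ◁ c′ , improves-child T i)
  ... | inj₁ p | inj₁ q = join p q

  -- At least one leg has the smaller length, so `r` is less than the number of legs; `d` and `r`
  -- are then determined as quotient and remainder.
  balanced : ℕ → ℕ → ℕ → List ℕ
  balanced d r s = replicate r (suc d) ++ replicate (suc s) d

  private
    move-to-front : ∀ {A : Set} r (y : A) {z zs} → replicate r z ++ y ∷ zs ↭ y ∷ replicate r z ++ zs
    move-to-front r y {z} {zs} = shift y (replicate r z) zs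

  replicate-++ : ∀ {A : Set} r s (y : A) → replicate r y ++ replicate s y ≡ replicate (r ℕ.+ s) y
  replicate-++ zero s y = ≡.refl
  replicate-++ (suc r) s y = ≡.cong (y ∷_) (replicate-++ r s y)

  -- Legs are inserted one at a time into a balanced list. The new leg either keeps it balanced,
  -- possibly with a new smaller length, or differs by at least two from a leg already present.
  compare-legs : ∀ m ms →
    (∃[ i ] ∃[ j ] ∃[ rest ] ((m ∷ ms) ↭ i ∷ j ∷ rest × suc (suc j) ℕ.≤ i)) ⊎ (∃[ d ] ∃[ r ] ∃[ s ] (m ∷ ms) ↭ balanced d r s)
  compare-legs m [] = inj₂ (m , 0 , 0 , ↭-refl)
  compare-legs m (m′ ∷ ms) with compare-legs m′ ms
  ... | inj₁ (i , j , rest , p , le) = inj₁ (i , j , m ∷ rest , ↭-trans (prep m p) (↭-trans (swap m i ↭-refl) (prep i (swap m j ↭-refl))) , le)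
  ... | inj₂ (d , r , s , p) with ℕ.<-cmp m d
  ... | tri≈ _ ≡.refl _ = inj₂ (d , r , suc s , ↭-trans (prep d p) (↭-sym (move-to-front r d)))
  ... | tri> _ _ m>d with ℕ.m≤n⇒m<n∨m≡n m>d
  ... | inj₂ ≡.refl = inj₂ (d , suc r , s , prep _ p)
  ... | inj₁ m≥d+2 = inj₁ (m , d , _ , ↭-trans (prep m p) (prep m (move-to-front r d)) , m≥d+2)
  compare-legs m (m′ ∷ ms) | inj₂ (d , r , s , p) | tri< m<d _ _ with ℕ.m≤n⇒m<n∨m≡n m<d
  ... | inj₁ m≤d-2 = inj₁ (d , m , _ , ↭-trans (prep m (↭-trans p (move-to-front r d))) (swap m d ↭-refl) , m≤d-2)
  -- Here `m` is one below the short legs, and a long leg is present: these two differ by two.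
  compare-legs m (m′ ∷ ms) | inj₂ (d , suc r , s , p) | tri< m<d _ _ | inj₂ ≡.refl =
    inj₁ (suc d , m , _ , ↭-trans (prep m p) (swap m (suc d) ↭-refl) , ℕ.≤-refl)
  -- No long leg exists, so `m` becomes the short length and all earlier legs count as long.
  compare-legs m (m′ ∷ ms) | inj₂ (d , zero , s , p) | tri< m<d _ _ | inj₂ ≡.refl =
    inj₂ (m , suc s , 0 , ↭-trans (prep m p) (↭-sym (shift′ (suc s))))
    where
    shift′ : ∀ s → replicate s (suc m) ++ m ∷ [] ↭ m ∷ replicate s (suc m)
    shift′ s = ↭-trans (shift m (replicate s (suc m)) []) (prep m (↭-reflexive (++-identityʳ _)))

  -- The centre moves one vertex along the longer leg: `reroot` over an empty chain carries the
  -- remaining legs to the neighbour of the centre on leg `i`, so leg `j` grows by one vertex and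
  -- leg `i` shrinks by one.
  unbalanced-improvable : ∀ {L i j rest} → L ↭ i ∷ j ∷ rest → suc (suc j) ℕ.≤ i → Improvable (spider L)
  unbalanced-improvable {i = suc i} {j} {rest} p (s≤s le) =
    _ , improves-~ (spider-↭ p) (reroot (spider rest) (path j) 0 • (path i) (path-⊏-path (s≤s le)))

  reduceᶜ : ∀ q m m′ ms →
    (∃[ κ ] Improvesᶜ κ (code (chain q (spider (m ∷ m′ ∷ ms))) • •)) ⊎ (∃[ d ] ∃[ r ] ∃[ s ] (m ∷ m′ ∷ ms) ↭ balanced d r s)
  reduceᶜ q m m′ ms with compare-legs m (m′ ∷ ms)
  ... | inj₁ (i , j , rest , p , le) with unbalanced-improvable p le
  ... | T′ , imp = inj₁ (_ , improves-t₁ • • (improves-chain q imp))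
  reduceᶜ q m m′ ms | inj₂ bal = inj₂ bal

-- A code for every member of `𝒰 n l 3`.

module Decoding where

  open import Defs using (Graph; IsSimple; countF; degree; Reach; here; step; Connected; 𝒰)
  open import Data.Bool using (Bool; true; false)
  open import Data.Bool.Properties using (¬-not)
  open import Data.Nat using (ℕ; zero; suc; _+_; _*_; _≤_; z≤n; s≤s)
  open import Data.Nat.Properties hiding (_≟_)
  import Data.Nat.Properties as ℕ
  open import Algebra.Properties.CommutativeMonoid.Sum +-0-commutativeMonoid using (sum; sum-remove; sum-cong-≗; ∑-distrib-+)
  open import Data.Fin using (Fin; zero; suc; punchIn; punchOut; _≟_)
  open import Data.Fin.Properties using (any?; punchInᵢ≢i; punchIn-injective; punchIn-punchOut; punchOut-punchIn; punchOut-cong)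
  open import Data.Product using (_×_; _,_; proj₁; proj₂; ∃-syntax)
  open import Data.Sum using (_⊎_; inj₁; inj₂)
  open import Function using (_∘_)
  open import Relation.Binary.PropositionalEquality
  open import Relation.Nullary using (yes; no; contradiction)
  open RootedTree using (Code; Vertexᶜ; in₁; in₂; in₃; module Vertex; triangle; adjᶜ; adjᶜ-sym; adjᶜ-irrefl; addLeafᶜ; LeafExtension; leafExtension)
  open Vertex renaming (here to top)
  open Representation
  open Membership using (countF-sum; handshake)

  countF-one : ∀ {n} (f : Fin n → Bool) → countF f ≡ 1 → ∃[ u ] (f u ≡ true × ∀ i → f i ≡ true → i ≡ u)
  countF-one {suc n} f e with f zero in f₀
  ... | true = zero , f₀ , λ { zero _ → refl ; (suc i) fi → contradiction (trans (sym fi) (none (suc-injective e) i)) λ () }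
    where
    none : ∀ {n} {g : Fin n → Bool} → countF g ≡ 0 → ∀ i → g i ≡ false
    none {suc n} {g} e i with g zero in g₀
    none {suc n} {g} e zero | false = g₀
    none {suc n} {g} e (suc i) | false = none {g = g ∘ suc} e i
  ... | false with countF-one (f ∘ suc) e
  ... | u , fu , unique = suc u , fu , λ { zero fi → contradiction (trans (sym fi) f₀) λ () ; (suc i) fi → cong suc (unique i fi) }

  countF-two : ∀ {n} (f : Fin n → Bool) {b c} → countF f ≡ 2 → f b ≡ true → f c ≡ true → b ≢ c → ∀ i → f i ≡ true → i ≡ b ⊎ i ≡ c
  countF-two {suc n} f {b} {c} e fb fc b≢c i fi with i ≟ b
  ... | yes i≡b = inj₁ i≡b
  ... | no i≢b with countF-one (λ j → f (punchIn b j)) (suc-injective (trans (sym (trans (countF-remove b f) (cong (λ t → toNat t + countF (λ j → f (punchIn b j))) fb))) e))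
  ... | u , _ , unique = inj₂ (trans (only (i≢b ∘ sym) fi) (sym (only b≢c fc)))
    where
    only : ∀ {j} (b≢j : b ≢ j) → f j ≡ true → j ≡ punchIn b u
    only b≢j fj = trans (sym (punchIn-punchOut b≢j)) (cong (punchIn b) (unique _ (trans (cong f (punchIn-punchOut b≢j)) fj)))

  -- Applied to degrees: all at least 2 with sum 2n, hence all equal to 2.
  sum-tight : ∀ {n} (f : Fin n → ℕ) k → (∀ i → k ≤ f i) → sum f ≤ k * n → ∀ i → f i ≡ k
  sum-tight {suc n} f k lower upper i = ≤-antisym (+-cancelʳ-≤ (k * n) (f i) k (begin
    f i + k * n                              ≤⟨ +-monoʳ-≤ (f i) (bound (λ j → lower (punchIn i j))) ⟩
    f i + sum (λ j → f (punchIn i j))        ≡⟨ sym (sum-remove {i = i} f) ⟩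
    sum f                                    ≤⟨ upper ⟩
    k * suc n                                ≡⟨ *-suc k n ⟩
    k + k * n                                ∎)) (lower i)
    where
    open ≤-Reasoning
    bound : ∀ {n} {g : Fin n → ℕ} → (∀ j → k ≤ g j) → k * n ≤ sum g
    bound {zero} h = ≤-reflexive (*-zeroʳ k)
    bound {suc n} h = ≤-trans (≤-reflexive (*-suc k n)) (+-mono-≤ (h zero) (bound (h ∘ suc)))

  record Triangle {n} (G : Graph n) : Set where
    field
      a b c : Fin n
      ab : G a b ≡ true
      bc : G b c ≡ true
      ca : G c a ≡ true

  module _ {n} {G : Graph (suc n)} (simple : IsSimple G) where

    adjacent≢ : ∀ {i j} → G i j ≡ true → i ≢ j
    adjacent≢ {i} e refl = contradiction (trans (sym e) (proj₂ simple i)) λ ()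

    sym-adj : ∀ {i j} → G i j ≡ true → G j i ≡ true
    sym-adj {i} {j} e = trans (proj₁ simple j i) e

    module Pendant (v u : Fin (suc n)) (vu : G v u ≡ true) (only : ∀ i → G v i ≡ true → i ≡ u) where
      v≢u : v ≢ u
      v≢u = adjacent≢ vu

      u′ : Fin n
      u′ = punchOut v≢u

      not-pendant : ∀ {i j k} → G i j ≡ true → G i k ≡ true → j ≢ k → v ≢ i
      not-pendant ij ik j≢k refl = j≢k (trans (only _ ij) (sym (only _ ik)))

      triangle′ : Triangle G → Triangle (delete v G)
      triangle′ t = record
        { a = punchOut v≢a ; b = punchOut v≢b ; c = punchOut v≢c
        ; ab = trans (cong₂ G (punchIn-punchOut v≢a) (punchIn-punchOut v≢b)) ab
        ; bc = trans (cong₂ G (punchIn-punchOut v≢b) (punchIn-punchOut v≢c)) bc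
        ; ca = trans (cong₂ G (punchIn-punchOut v≢c) (punchIn-punchOut v≢a)) ca }
        where
        open Triangle t
        v≢a = not-pendant ab (sym-adj ca) (adjacent≢ bc)
        v≢b = not-pendant bc (sym-adj ab) (adjacent≢ ca)
        v≢c = not-pendant ca (sym-adj bc) (adjacent≢ ab)

      -- A walk entering v must leave it through u, so it can avoid v.
      mutual
        avoid : ∀ {i j} → Reach G i j → (v≢i : v ≢ i) (v≢j : v ≢ j) → Reach (delete v G) (punchOut v≢i) (punchOut v≢j)
        avoid here v≢i v≢j = subst (Reach _ _) (punchOut-cong v refl) here
        avoid (step {j = k} e p) v≢i v≢j with v ≟ k
        ... | no v≢k = step (trans (cong₂ G (punchIn-punchOut v≢i) (punchIn-punchOut v≢k)) e) (avoid p v≢k v≢j)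
        ... | yes refl = subst (λ t → Reach _ t _) (punchOut-cong v (sym (only _ (sym-adj e)))) (avoid-from p v≢j)

        avoid-from : ∀ {j} → Reach G v j → (v≢j : v ≢ j) → Reach (delete v G) u′ (punchOut v≢j)
        avoid-from here v≢j = contradiction refl v≢j
        avoid-from (step {j = k} e p) v≢j with only k e
        ... | refl = avoid p v≢u v≢j

      connected′ : Connected G → Connected (delete v G)
      connected′ con i j = subst₂ (Reach _) (back i) (back j) (avoid (con (punchIn v i) (punchIn v j)) (≢-sym (punchInᵢ≢i v i)) (≢-sym (punchInᵢ≢i v j)))
        where
        back : ∀ i → punchOut (≢-sym (punchInᵢ≢i v i)) ≡ i
        back i = trans (punchOut-cong v refl) (punchOut-punchIn v)

      degree≡1 : degree G v ≡ 1
      degree≡1 = countF-unique u vu (λ i ne → ¬-not λ e → ne (only i e))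

      degrees′ : sum (degree G) ≡ 2 * suc n → sum (degree (delete v G)) ≡ 2 * n
      degrees′ h = +-cancelˡ-≡ 2 _ _ (begin
        2 + sum (degree (delete v G))
          ≡⟨ cong₂ (λ p q → p + (q + sum (degree (delete v G)))) (sym degree≡1) (sym column) ⟩
        degree G v + (sum (λ i → toNat (G (punchIn v i) v)) + sum (degree (delete v G)))
          ≡⟨ cong (degree G v +_) (sym (∑-distrib-+ (λ i → toNat (G (punchIn v i) v)) (degree (delete v G)))) ⟩
        degree G v + sum (λ i → toNat (G (punchIn v i) v) + degree (delete v G) i)
          ≡⟨ cong (degree G v +_) (sum-cong-≗ (λ i → sym (countF-remove v (G (punchIn v i))))) ⟩
        degree G v + sum (λ i → degree G (punchIn v i))
          ≡⟨ sym (sum-remove {i = v} (degree G)) ⟩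
        sum (degree G)
          ≡⟨ trans h (*-suc 2 n) ⟩
        2 + 2 * n ∎)
        where
        open ≡-Reasoning
        column : sum (λ i → toNat (G (punchIn v i) v)) ≡ 1
        column = trans (sum-cong-≗ (λ i → cong toNat (proj₁ simple (punchIn v i) v))) (trans (sym (countF-sum (λ i → G v (punchIn v i))))
          (trans (sym (trans (countF-remove v (G v)) (cong (λ b → toNat b + countF (λ i → G v (punchIn v i))) (proj₂ simple v)))) degree≡1))

      module _ {κ : Code} (rep : Rep (delete v G) κ) where
        open Rep rep using (to; from; to-from; from-to; edge)
        p : Vertexᶜ κ
        p = from u′
        open LeafExtension (leafExtension p) hiding (p)

        private
          v-emb : Vertexᶜ κ → Fin (suc n)
          v-emb x = punchIn v (to x)

          to′ : Vertexᶜ (addLeafᶜ κ p) → Fin (suc n)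
          to′ w with view w
          ... | inj₁ _ = v
          ... | inj₂ (x , _) = v-emb x

          to-new : to′ new ≡ v
          to-new with view new
          ... | inj₁ _ = refl
          ... | inj₂ (x , e) = contradiction e new≢emb

          to-emb : ∀ x → to′ (emb x) ≡ v-emb x
          to-emb x with view (emb x)
          ... | inj₁ e = contradiction (sym e) new≢emb
          ... | inj₂ (y , e) = cong v-emb (sym (emb-injective e))

          from′ : Fin (suc n) → Vertexᶜ (addLeafᶜ κ p)
          from′ i with v ≟ i
          ... | yes _ = new
          ... | no v≢i = emb (from (punchOut v≢i))

          from-v : from′ v ≡ new
          from-v with v ≟ v
          ... | yes _ = refl
          ... | no ne = contradiction refl ne

          from-punchIn : ∀ j → from′ (punchIn v j) ≡ emb (from j)
          from-punchIn j with v ≟ punchIn v j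
          ... | yes e = contradiction (sym e) (punchInᵢ≢i v j)
          ... | no ne = cong (emb ∘ from) (trans (punchOut-cong v refl) (punchOut-punchIn v))

          to-from′ : ∀ i → to′ (from′ i) ≡ i
          to-from′ i with v ≟ i
          ... | yes refl = to-new
          ... | no v≢i = trans (to-emb _) (trans (cong (punchIn v) (to-from _)) (punchIn-punchOut v≢i))

          from-to′ : ∀ w → from′ (to′ w) ≡ w
          from-to′ w with view w
          ... | inj₁ refl = from-v
          ... | inj₂ (x , refl) = trans (from-punchIn (to x)) (cong emb (from-to x))

          edge-new : ∀ x → G v (v-emb x) ≡ adjᶜ new (emb x)
          edge-new x with G v (v-emb x) in e
          ... | true = sym (subst (λ y → adjᶜ new (emb y) ≡ true) p≡x ~-new)
            where
            p≡x : p ≡ x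
            p≡x = trans (cong from (punchIn-injective v u′ (to x) (trans (punchIn-punchOut v≢u) (sym (only _ e))))) (from-to x)
          ... | false = sym (¬-not λ a → contradiction (trans (sym (trans (cong (G v) (v-emb-u (~-new-only x a))) vu)) e) λ ())
            where
            v-emb-u : x ≡ p → v-emb x ≡ u
            v-emb-u refl = trans (cong (punchIn v) (to-from u′)) (punchIn-punchOut v≢u)

          edge′′ : ∀ w w′ → G (to′ w) (to′ w′) ≡ adjᶜ w w′
          edge′′ w w′ with view w | view w′
          ... | inj₁ refl | inj₁ refl = trans (proj₂ simple v) (sym (adjᶜ-irrefl new))
          ... | inj₁ refl | inj₂ (y , refl) = edge-new y
          ... | inj₂ (x , refl) | inj₁ refl = trans (proj₁ simple _ v) (trans (edge-new x) (adjᶜ-sym new (emb x)))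
          ... | inj₂ (x , refl) | inj₂ (y , refl) = trans (edge x y) (sym (~-emb x y))

        attach : Rep G (addLeafᶜ κ p)
        attach = record { to = to′ ; from = from′ ; to-from = to-from′ ; from-to = from-to′ ; edge = edge′′ }

    -- Without leaves the graph is 2-regular. Each triangle vertex then has its two neighbours
    -- inside the triangle, so no walk leaves it, and connectedness makes it the whole graph.
    module Leafless (con : Connected G) (h : sum (degree G) ≡ 2 * suc n) (no-leaf : ∀ i → degree G i ≢ 1) (t : Triangle G) where
      open Triangle t

      neighbour : ∀ i → ∃[ j ] G i j ≡ true
      neighbour i with i ≟ a
      ... | yes refl = b , ab
      ... | no i≢a with con i a
      ... | here = contradiction refl i≢a
      ... | step e _ = _ , e

      2≤degree : ∀ i → 2 ≤ degree G i
      2≤degree i with degree G i in e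
      ... | suc (suc d) = s≤s (s≤s z≤n)
      ... | suc zero = contradiction e (no-leaf i)
      ... | zero with neighbour i
      ... | j , ij = contradiction (trans (sym e) (trans (countF-remove j (G i)) (cong (λ t → toNat t + countF (λ k → G i (punchIn j k))) ij))) λ ()

      degree≡2 : ∀ i → degree G i ≡ 2
      degree≡2 = sum-tight (degree G) 2 2≤degree (≤-reflexive h)

      InTriangle : Fin (suc n) → Set
      InTriangle i = i ≡ a ⊎ i ≡ b ⊎ i ≡ c

      closed : ∀ {i j} → InTriangle i → G i j ≡ true → InTriangle j
      closed (inj₁ refl) e with countF-two (G a) (degree≡2 a) ab (sym-adj ca) (adjacent≢ bc) _ e
      ... | inj₁ r = inj₂ (inj₁ r)
      ... | inj₂ r = inj₂ (inj₂ r)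
      closed (inj₂ (inj₁ refl)) e with countF-two (G b) (degree≡2 b) bc (sym-adj ab) (adjacent≢ ca) _ e
      ... | inj₁ r = inj₂ (inj₂ r)
      ... | inj₂ r = inj₁ r
      closed (inj₂ (inj₂ refl)) e with countF-two (G c) (degree≡2 c) ca (sym-adj bc) (adjacent≢ ab) _ e
      ... | inj₁ r = inj₁ r
      ... | inj₂ r = inj₂ (inj₁ r)

      reachable : ∀ {i j} → InTriangle i → Reach G i j → InTriangle j
      reachable t here = t
      reachable t (step e p) = reachable (closed t e) p

      private
        to : Vertexᶜ triangle → Fin (suc n)
        to (in₁ top) = a
        to (in₂ top) = b
        to (in₃ top) = c

        pick : ∀ {i} → InTriangle i → Vertexᶜ triangle
        pick (inj₁ _) = in₁ top
        pick (inj₂ (inj₁ _)) = in₂ top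
        pick (inj₂ (inj₂ _)) = in₃ top

        to-pick : ∀ {i} (t : InTriangle i) → to (pick t) ≡ i
        to-pick (inj₁ refl) = refl
        to-pick (inj₂ (inj₁ refl)) = refl
        to-pick (inj₂ (inj₂ refl)) = refl

        to-injective : ∀ x y → to x ≡ to y → x ≡ y
        to-injective (in₁ top) (in₁ top) e = refl
        to-injective (in₁ top) (in₂ top) e = contradiction e (adjacent≢ ab)
        to-injective (in₁ top) (in₃ top) e = contradiction (sym e) (adjacent≢ ca)
        to-injective (in₂ top) (in₁ top) e = contradiction (sym e) (adjacent≢ ab)
        to-injective (in₂ top) (in₂ top) e = refl
        to-injective (in₂ top) (in₃ top) e = contradiction e (adjacent≢ bc)
        to-injective (in₃ top) (in₁ top) e = contradiction e (adjacent≢ ca)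
        to-injective (in₃ top) (in₂ top) e = contradiction (sym e) (adjacent≢ bc)
        to-injective (in₃ top) (in₃ top) e = refl

        edge : ∀ x y → G (to x) (to y) ≡ adjᶜ x y
        edge (in₁ top) (in₁ top) = proj₂ simple a
        edge (in₁ top) (in₂ top) = ab
        edge (in₁ top) (in₃ top) = sym-adj ca
        edge (in₂ top) (in₁ top) = sym-adj ab
        edge (in₂ top) (in₂ top) = proj₂ simple b
        edge (in₂ top) (in₃ top) = bc
        edge (in₃ top) (in₁ top) = ca
        edge (in₃ top) (in₂ top) = sym-adj bc
        edge (in₃ top) (in₃ top) = proj₂ simple c

        everywhere : ∀ i → InTriangle i
        everywhere i = reachable (inj₁ refl) (con a i)

      rep-triangle : Rep G triangle
      rep-triangle = record
        { to = to ; from = λ i → pick (everywhere i) ; to-from = λ i → to-pick (everywhere i)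
        ; from-to = λ x → to-injective _ x (to-pick (everywhere (to x))) ; edge = edge }

  -- Connectedness, degree sum 2n and the presence of a triangle all survive the deletion of a leaf:
  -- no triangle vertex is a leaf, and the deletion lowers the degree sum by 2. The degree sum
  -- replaces the edge count because it follows deletions easily.
  represent : ∀ n {G : Graph n} → IsSimple G → Connected G → sum (degree G) ≡ 2 * n → Triangle G → ∃[ κ ] Rep G κ
  represent zero _ _ _ t with Triangle.a t
  ... | ()
  represent (suc n) {G} simple con h t with any? (λ i → degree G i ℕ.≟ 1)
  ... | no no-leaf = triangle , Leafless.rep-triangle simple con h (λ i e → no-leaf (i , e)) t
  ... | yes (v , e) with countF-one (G v) e
  ... | u , vu , only with represent n ((λ i j → proj₁ simple _ _) , (λ i → proj₂ simple _)) (connected′ con) (degrees′ h) (triangle′ t)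
    where open Pendant simple v u vu only
  ... | κ , rep = _ , Pendant.attach simple v u vu only rep

  decode : ∀ {n l} {G : Graph n} → 𝒰 n l 3 G → ∃[ κ ] Rep G κ
  decode {n} {G = G} (simple , con , edges , _ , (f , _ , inj , cyc) , _) = represent n simple con
    (trans (sym (handshake G simple)) (trans (cong₂ _+_ edges edges) (cong (n +_) (sym (+-identityʳ n)))))
    (record { a = f zero ; b = f (suc zero) ; c = f (suc (suc zero))
            ; ab = cyc zero (suc zero) (inj₁ refl) ; bc = cyc (suc zero) (suc (suc zero)) (inj₁ refl)
            ; ca = cyc (suc (suc zero)) zero (inj₂ (refl , refl)) })

-- The labelled graph `U n l q` as a chain ending in a spider.

module BroomLabelling where

  open import Defs using (U; module U-construction)
  open import Data.Bool using (Bool; true; false; _∧_; _∨_; not; if_then_else_)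
  open import Data.Bool.Properties using (¬-not; ∨-identityʳ; ∧-identityʳ; ∧-zeroʳ; ∨-comm)
  open import Data.Bool.ListAction using (any)
  open import Data.List using (List; []; _∷_; _++_; replicate; applyUpTo)
  open import Data.List.Relation.Binary.Permutation.Propositional using (_↭_)
  open import Data.List.Relation.Binary.Permutation.Propositional.Properties using (++-comm)
  open import Data.Nat using (ℕ; zero; suc; pred; _+_; _*_; _∸_; _⊓_; _<ᵇ_; _≤ᵇ_; _≡ᵇ_; _≤_; _<_; z≤n; s≤s; NonZero)
  open import Data.Nat.DivMod using (m%n<n; m≡m%n+[m/n]*n; m≥n⇒m/n>0)
  open import Data.Nat.Properties
  open import Data.Nat.Solver using (module +-*-Solver)
  open import Data.Fin using (toℕ; fromℕ<)
  open import Data.Fin.Properties using (toℕ<n; toℕ-injective; toℕ-fromℕ<; toℕ-↑ˡ; toℕ-↑ʳ)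
  open import Data.Product using (_×_; _,_; ∃-syntax)
  open import Data.Sum using (_⊎_; inj₁; inj₂)
  open import Data.Unit using (⊤; tt)
  open import Function using (_∘_)
  open import Relation.Binary.PropositionalEquality
  open import Relation.Nullary using (¬_; contradiction)
  open RootedTree
  open Shapes
  open Representation using (Rep; toNat)
  open Membership using (index; vertex; vertex-index; index-vertex)
  open EdgeCount using (≡ᵇ-refl; ≡ᵇ-sound)

  module ParentLabelling (Par : ℕ → ℕ → Bool) (functional : ∀ {a b b′} → Par a b ≡ true → Par a b′ ≡ true → b ≡ b′) where

    ParentOf : ∀ T → (Vertex T → ℕ) → Set
    ParentOf • g = ⊤
    ParentOf (S ◁ c) g = ParentOf S (g ∘ inS) × ParentOf c (g ∘ inC) × Par (g (inC (root c))) (g (inS (root S))) ≡ true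

    parent-in : ∀ T g → ParentOf T g → ∀ u → isRoot u ≡ false → ∃[ w ] Par (g u) (g w) ≡ true
    parent-in (S ◁ c) g (pS , pc , e) (inS u) ne with parent-in S (g ∘ inS) pS u ne
    ... | w , h = inS w , h
    parent-in (S ◁ c) g (pS , pc , e) (inC u) _ with isRoot u in eq
    ... | true rewrite isRoot⇒root u eq = inS (root S) , e
    ... | false with parent-in c (g ∘ inC) pc u eq
    ... | w , h = inC w , h

    -- Every vertex other than the root already has its tree parent under `Par`; functionality
    -- excludes any other, and the root has none among the vertices of the tree. So `Par` adds no
    -- edges to those of the tree.
    adj-parent : ∀ T g → (∀ {u v} → g u ≡ g v → u ≡ v) → ParentOf T g → (∀ v → Par (g (root T)) (g v) ≡ false) →
      ∀ u v → (Par (g u) (g v) ∨ Par (g v) (g u)) ≡ adj u v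
    adj-parent • g inj p r here here = cong₂ _∨_ (r here) (r here)
    adj-parent (S ◁ c) g inj (pS , pc , e) r = go
      where
      root-c : ∀ v → Par (g (inC (root c))) (g (inC v)) ≡ false
      root-c v = ¬-not λ h → contradiction (inj (functional e h)) λ ()
      up : ∀ u v → Par (g (inS u)) (g (inC v)) ≡ false
      up u v with isRoot u in eq
      ... | true rewrite isRoot⇒root u eq = r (inC v)
      ... | false with parent-in S (g ∘ inS) pS u eq
      ... | w , h = ¬-not λ h′ → contradiction (inj (functional h h′)) λ ()
      down : ∀ u v → Par (g (inC v)) (g (inS u)) ≡ (isRoot u ∧ isRoot v)
      down u v with isRoot v in eq
      ... | false with parent-in c (g ∘ inC) pc v eq
      ... | w , h = trans (¬-not λ h′ → contradiction (inj (functional h h′)) λ ()) (sym (∧-zeroʳ (isRoot u)))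
      down u v | true rewrite isRoot⇒root v eq with isRoot u in eq′
      ... | true rewrite isRoot⇒root u eq′ = e
      ... | false = ¬-not λ h → contradiction (trans (sym eq′) (trans (cong isRoot (inS-injective (inj (functional h e)))) (isRoot-root S))) λ ()
      go : ∀ u v → (Par (g u) (g v) ∨ Par (g v) (g u)) ≡ adj u v
      go (inS u) (inS v) = adj-parent S (g ∘ inS) (inS-injective ∘ inj) pS (r ∘ inS) u v
      go (inC u) (inC v) = adj-parent c (g ∘ inC) (inC-injective ∘ inj) pc root-c u v
      go (inS u) (inC v) = cong₂ _∨_ (up u v) (down u v)
      go (inC u) (inS v) = trans (∨-comm (Par (g (inC u)) (g (inS v))) _) (trans (cong₂ _∨_ (up v u) (down v u)) (adj-sym {S ◁ c} (inS v) (inC u)))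

  -- The label of the i-th vertex (in preorder) of the tree at the triangle vertex 0: labels 1 and 2 are skipped.
  skip : ℕ → ℕ
  skip zero = 0
  skip (suc i) = 3 + i

  skip-injective : ∀ {i j} → skip i ≡ skip j → i ≡ j
  skip-injective {zero} {zero} _ = refl
  skip-injective {suc i} {suc j} e = suc-injective-3 e
    where
    suc-injective-3 : 3 + i ≡ 3 + j → suc i ≡ suc j
    suc-injective-3 refl = refl

  index-root : ∀ T → toℕ (index (root T)) ≡ 0
  index-root • = refl
  index-root (S ◁ c) = trans (toℕ-↑ˡ (index (root S)) (size c)) (index-root S)

  size>0 : ∀ T → 0 < size T
  size>0 • = s≤s z≤n
  size>0 (S ◁ c) = ≤-trans (size>0 S) (m≤m+n _ _)

  label : ∀ {T} → ℕ → Vertex T → ℕ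
  label o u = skip (o + toℕ (index u))

  module _ (Par : ℕ → ℕ → Bool) (functional : ∀ {a b b′} → Par a b ≡ true → Par a b′ ≡ true → b ≡ b′) where
    open ParentLabelling Par functional

    -- `ParentOf` for preorder labels, with `o` the position of the root in the surrounding tree;
    -- the offset turns it into a recursion on the tree.
    ParentAt : Tree → ℕ → Set
    ParentAt • o = ⊤
    ParentAt (S ◁ c) o = ParentAt S o × ParentAt c (o + size S) × Par (skip (o + size S)) (skip o) ≡ true

    parentOf-ext : ∀ T {g g′ : Vertex T → ℕ} → (∀ u → g u ≡ g′ u) → ParentOf T g → ParentOf T g′
    parentOf-ext • h p = tt
    parentOf-ext (S ◁ c) h (pS , pc , e) = parentOf-ext S (h ∘ inS) pS , parentOf-ext c (h ∘ inC) pc ,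
      trans (cong₂ Par (sym (h _)) (sym (h _))) e

    parentOf-label : ∀ T o → ParentAt T o → ParentOf T (label o)
    parentOf-label • o _ = tt
    parentOf-label (S ◁ c) o (pS , pc , e) =
        parentOf-ext S (λ u → sym (label-inS u)) (parentOf-label S o pS)
      , parentOf-ext c (λ u → sym (label-inC u)) (parentOf-label c (o + size S) pc)
      , trans (cong₂ Par (trans (label-inC (root c)) (cong skip (trans (cong (o + size S +_) (index-root c)) (+-identityʳ _))))
                         (trans (label-inS (root S)) (cong skip (trans (cong (o +_) (index-root S)) (+-identityʳ _))))) e
      where
      label-inS : ∀ u → label {S ◁ c} o (inS u) ≡ label o u
      label-inS u = cong (λ t → skip (o + t)) (toℕ-↑ˡ (index u) (size c))
      label-inC : ∀ u → label {S ◁ c} o (inC u) ≡ label (o + size S) u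
      label-inC u = cong skip (trans (cong (o +_) (toℕ-↑ʳ (size S) (index u))) (sym (+-assoc o (size S) _)))

  any-true : ∀ (p : ℕ → Bool) f n {i} → i < n → p (f i) ≡ true → any p (applyUpTo f n) ≡ true
  any-true p f (suc n) {zero} _ e rewrite e = refl
  any-true p f (suc n) {suc i} (s≤s lt) e with p (f 0)
  ... | true = refl
  ... | false = any-true p (f ∘ suc) n lt e

  any-false : ∀ (p : ℕ → Bool) f n → (∀ i → i < n → p (f i) ≡ false) → any p (applyUpTo f n) ≡ false
  any-false p f zero h = refl
  any-false p f (suc n) h rewrite h 0 (s≤s z≤n) = any-false p (f ∘ suc) n (λ i lt → h (suc i) (s≤s lt))

  ⊓-suc : ∀ i r → suc i ⊓ r ≡ (i ⊓ r) + toNat (i <ᵇ r)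
  ⊓-suc zero zero = refl
  ⊓-suc zero (suc r) = refl
  ⊓-suc (suc i) zero = refl
  ⊓-suc (suc i) (suc r) = cong suc (⊓-suc i r)

  <ᵇ-true : ∀ {i r} → i < r → (i <ᵇ r) ≡ true
  <ᵇ-true {zero} {suc r} _ = refl
  <ᵇ-true {suc i} {suc r} (s≤s lt) = <ᵇ-true lt

  <ᵇ-false : ∀ {i r} → r ≤ i → (i <ᵇ r) ≡ false
  <ᵇ-false {i} {zero} _ = refl
  <ᵇ-false {suc i} {suc r} (s≤s le) = <ᵇ-false le

  -- The hypothesis `room` provides one vertex for every leg. Hence `d` is positive, and legs can be
  -- listed by their number of vertices minus one.
  module _ (n l : ℕ) .{{l≢0 : NonZero l}} (q : ℕ) (room : q + 3 + l ≤ n) where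
    open U-construction n l q

    private
      N : ℕ
      N = n ∸ (q + 3)

      q+3≤n : q + 3 ≤ n
      q+3≤n = ≤-trans (m≤m+n (q + 3) l) room

      n≡ : q + 3 + N ≡ n
      n≡ = m+[n∸m]≡n q+3≤n

      d>0 : 0 < d
      d>0 = m≥n⇒m/n>0 (+-cancelˡ-≤ (q + 3) l N (≤-trans room (≤-reflexive (sym n≡))))

      d′ : ℕ
      d′ = pred d

      d≡ : d ≡ suc d′
      d≡ with d | d>0
      ... | suc _ | _ = refl

      r<l : r < l
      r<l = m%n<n N l

      legLength : ℕ → ℕ
      legLength i = d′ + toNat (i <ᵇ r)

      -- Later legs stand in front because `spider` makes the head of the list the last child;
      -- preorder then meets the legs in the order of `start`.
      legsTo : ℕ → List ℕ
      legsTo zero = []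
      legsTo (suc i) = legLength i ∷ legsTo i

      start-suc : ∀ i → start (suc i) ≡ start i + suc (legLength i)
      start-suc i rewrite ⊓-suc i r | d≡ =
        solve 5 (λ q d′ id m t → q :+ con 3 :+ (con 1 :+ d′ :+ id) :+ (m :+ t) := q :+ con 3 :+ id :+ m :+ (con 1 :+ (d′ :+ t)))
          refl q d′ (i * suc d′) (i ⊓ r) (toNat (i <ᵇ r))
        where open +-*-Solver

      start-mono : ∀ {i j} → i ≤ j → start i ≤ start j
      start-mono i≤j = +-mono-≤ (+-monoʳ-≤ (q + 3) (*-monoˡ-≤ d i≤j)) (⊓-monoˡ-≤ r i≤j)

      start≥ : ∀ i → q + 3 ≤ start i
      start≥ i = ≤-trans (m≤m+n (q + 3) (i * d)) (m≤m+n _ (i ⊓ r))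

      size-legsTo : ∀ i → q + 2 + size (spider (legsTo i)) ≡ start i
      size-legsTo zero = solve 1 (λ q → q :+ con 2 :+ con 1 := q :+ con 3 :+ con 0 :+ con 0) refl q
        where open +-*-Solver
      size-legsTo (suc i) = begin
        q + 2 + (size (spider (legsTo i)) + size (path (legLength i)))  ≡⟨ cong (λ t → q + 2 + (size (spider (legsTo i)) + t)) (size-path (legLength i)) ⟩
        q + 2 + (size (spider (legsTo i)) + suc (legLength i))          ≡⟨ sym (+-assoc (q + 2) _ _) ⟩
        q + 2 + size (spider (legsTo i)) + suc (legLength i)            ≡⟨ cong (_+ suc (legLength i)) (size-legsTo i) ⟩
        start i + suc (legLength i)                                     ≡⟨ sym (start-suc i) ⟩
        start (suc i)                                                   ∎
        where open ≡-Reasoning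

      start-l : start l ≡ n
      start-l = trans (cong (λ t → q + 3 + l * d + t) (m≥n⇒m⊓n≡n (<⇒≤ r<l))) (trans (+-assoc (q + 3) _ r)
        (trans (cong (q + 3 +_) (trans (+-comm _ r) (trans (cong (r +_) (*-comm l d)) (sym (m≡m%n+[m/n]*n N l))))) n≡))

      isStart-start : ∀ {i} → i < l → isStart (start i) ≡ true
      isStart-start {i} lt = any-true (λ j → start j ≡ᵇ start i) (λ j → j) l lt (≡ᵇ-refl (start i))

      isStart-other : ∀ v → (∀ j → start j ≢ v) → isStart v ≡ false
      isStart-other v h = any-false (λ j → start j ≡ᵇ v) (λ j → j) l (λ j _ → ¬-not λ e → h j (≡ᵇ-sound _ _ e))

      before-starts : ∀ {v} → v < q + 3 → isStart v ≡ false
      before-starts lt = isStart-other _ λ j e → <-irrefl (sym e) (<-≤-trans lt (start≥ j))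

      inside-leg : ∀ i t → suc t < suc (legLength i) → isStart (start i + suc t) ≡ false
      inside-leg i t lt = isStart-other _ λ j e → case-≤ j e (≤-<-connex j i)
        where
        case-≤ : ∀ j → start j ≡ start i + suc t → ¬ (j ≤ i ⊎ i < j)
        case-≤ j e (inj₁ j≤i) = <-irrefl e (≤-<-trans (start-mono j≤i) (m<m+n (start i) (s≤s z≤n)))
        case-≤ j e (inj₂ i<j) = <-irrefl (sym e) (<-≤-trans (+-monoʳ-< (start i) lt) (≤-trans (≤-reflexive (sym (start-suc i))) (start-mono i<j)))

      Par : ℕ → ℕ → Bool
      Par a b = (3 ≤ᵇ a) ∧ (parent a ≡ᵇ b)

      functional : ∀ {a b b′} → Par a b ≡ true → Par a b′ ≡ true → b ≡ b′
      functional {a} {b} {b′} e e′ with 3 ≤ᵇ a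
      ... | true = trans (sym (≡ᵇ-sound (parent a) b e)) (≡ᵇ-sound (parent a) b′ e′)

      par : ∀ {k b} → parent (3 + k) ≡ b → Par (3 + k) b ≡ true
      par {k} refl = ≡ᵇ-refl (parent (3 + k))

      ParAt : Tree → ℕ → Set
      ParAt = ParentAt Par functional

      -- The exception for label 3 in `parent` is the jump of `skip` over the triangle labels 1 and
      -- 2.
      parent-previous : ∀ o → isStart (3 + o) ≡ false → parent (3 + o) ≡ skip o
      parent-previous zero e rewrite e = refl
      parent-previous (suc o) e rewrite e = refl

      parent-start : ∀ {i} → i < l → parent (start i) ≡ ctr
      parent-start lt rewrite isStart-start lt = refl

      ctr≡ : ctr ≡ skip q
      ctr≡ = centre q
        where
        centre : ∀ q → (if q ≡ᵇ 0 then 0 else q + 2) ≡ skip q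
        centre zero = refl
        centre (suc k) = cong suc (+-comm k 2)

      parAt-path : ∀ i m o t → 3 + o ≡ start i + t → t + m < suc (legLength i) → ParAt (path m) (suc o)
      parAt-path i zero o t e lt = tt
      parAt-path i (suc m) o t e lt = tt ,
        subst (ParAt (path m)) (cong suc (sym (+-comm o 1))) (parAt-path i m (suc o) (suc t) e′ lt′) ,
        subst (λ v → Par v (3 + o) ≡ true) (cong (3 +_) (+-comm 1 o))
          (par (parent-previous (suc o) (trans (cong isStart e′) (inside-leg i t (≤-<-trans (s≤s (m≤m+n t m)) lt′)))))
        where
        e′ : 3 + suc o ≡ start i + suc t
        e′ = trans (cong suc e) (sym (+-suc (start i) t))
        lt′ : suc t + m < suc (legLength i)
        lt′ = subst (_< suc (legLength i)) (+-suc t m) lt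

      start≡3+ : ∀ i → start i ≡ 3 + (q + pred (size (spider (legsTo i))))
      start≡3+ i = trans (sym (size-legsTo i)) (trans (cong (q + 2 +_) (positive (size>0 (spider (legsTo i)))))
        (solve 2 (λ q p → q :+ con 2 :+ (con 1 :+ p) := con 3 :+ (q :+ p)) refl q (pred (size (spider (legsTo i))))))
        where
        open +-*-Solver
        positive : ∀ {k} → 0 < k → k ≡ suc (pred k)
        positive (s≤s _) = refl

      parAt-spider : ∀ i → i ≤ l → ParAt (spider (legsTo i)) q
      parAt-spider zero _ = tt
      parAt-spider (suc i) lt = parAt-spider i (<⇒≤ lt) ,
        subst (ParAt (path (legLength i))) (sym offset) (parAt-path i (legLength i) o 0 (trans (sym (start≡3+ i)) (sym (+-identityʳ _))) ≤-refl) ,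
        subst (λ v → Par (skip v) (skip q) ≡ true) (sym offset) (par (trans (cong parent (sym (start≡3+ i))) (trans (parent-start lt) ctr≡)))
        where
        o = q + pred (size (spider (legsTo i)))
        positive : ∀ {k} → 0 < k → q + k ≡ suc (q + pred k)
        positive (s≤s _) = +-suc q _
        offset : q + size (spider (legsTo i)) ≡ suc o
        offset = positive (size>0 (spider (legsTo i)))

      parAt-chain : ∀ k o T → o + k ≡ q → ParAt T q → ParAt (chain k T) o
      parAt-chain zero o T e p = subst (ParAt T) (trans (sym e) (+-identityʳ o)) p
      parAt-chain (suc k) o T e p = tt , subst (ParAt (chain k T)) (+-comm 1 o) (parAt-chain k (suc o) T (trans (sym (+-suc o k)) e) p) ,
        subst (λ v → Par (skip v) (skip o) ≡ true) (+-comm 1 o)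
          (par (parent-previous o (before-starts (≤-trans (s≤s (s≤s (s≤s (s≤s (m≤m+n o k))))) (≤-reflexive (trans (cong (3 +_) (trans (sym (+-suc o k)) e)) (+-comm 3 q)))))))

      T₁ : Tree
      T₁ = chain q (spider (legsTo l))

      κ : Code
      κ = code T₁ • •

      size-T₁ : 2 + size T₁ ≡ n
      size-T₁ = trans (cong (2 +_) (size-chain q _)) (trans (solve 2 (λ q s → con 2 :+ (q :+ s) := q :+ con 2 :+ s) refl q (size (spider (legsTo l)))) (trans (size-legsTo l) start-l))
        where open +-*-Solver

      lab : Vertexᶜ κ → ℕ
      lab (in₁ u) = label 0 u
      lab (in₂ here) = 1
      lab (in₃ here) = 2

      skip<n : ∀ {i} → i < size T₁ → skip i < n
      skip<n {zero} _ = <-≤-trans (s≤s z≤n) (≤-trans (m≤n+m 3 q) q+3≤n)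
      skip<n {suc i} lt = <-≤-trans (s≤s (s≤s lt)) (≤-reflexive size-T₁)

      lab<n : ∀ u → lab u < n
      lab<n (in₁ u) = skip<n (toℕ<n (index u))
      lab<n (in₂ here) = ≤-trans (s≤s (s≤s z≤n)) (≤-trans (m≤n+m 3 q) q+3≤n)
      lab<n (in₃ here) = ≤-trans (s≤s (s≤s (s≤s z≤n))) (≤-trans (m≤n+m 3 q) q+3≤n)

      skip≢1 : ∀ i → skip i ≢ 1
      skip≢1 zero ()
      skip≢1 (suc i) ()

      skip≢2 : ∀ i → skip i ≢ 2
      skip≢2 zero ()
      skip≢2 (suc i) ()

      index-injective : ∀ {T} {u v : Vertex T} → toℕ (index u) ≡ toℕ (index v) → u ≡ v
      index-injective {T} {u} {v} e = trans (sym (vertex-index u)) (trans (cong (vertex T) (toℕ-injective e)) (vertex-index v))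

      lab-injective : ∀ u v → lab u ≡ lab v → u ≡ v
      lab-injective (in₁ u) (in₁ v) e = cong in₁ (index-injective (skip-injective e))
      lab-injective (in₁ u) (in₂ here) e = contradiction e (skip≢1 (toℕ (index u)))
      lab-injective (in₁ u) (in₃ here) e = contradiction e (skip≢2 (toℕ (index u)))
      lab-injective (in₂ here) (in₃ here) ()
      lab-injective (in₃ here) (in₂ here) ()
      lab-injective (in₂ here) (in₁ v) e = contradiction (sym e) (skip≢1 (toℕ (index v)))
      lab-injective (in₂ here) (in₂ here) e = refl
      lab-injective (in₃ here) (in₁ v) e = contradiction (sym e) (skip≢2 (toℕ (index v)))
      lab-injective (in₃ here) (in₃ here) e = refl

      unlabel : ∀ m → m < n → Vertexᶜ κ
      unlabel 0 _ = in₁ (root T₁)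
      unlabel 1 _ = in₂ here
      unlabel 2 _ = in₃ here
      unlabel (suc (suc (suc m))) lt = in₁ (vertex T₁ (fromℕ< (inside lt)))
        where
        inside : 3 + m < n → suc m < size T₁
        inside lt = ≤-pred (≤-pred (≤-trans lt (≤-reflexive (sym size-T₁))))

      lab-unlabel : ∀ m lt → lab (unlabel m lt) ≡ m
      lab-unlabel 0 _ = cong skip (index-root T₁)
      lab-unlabel 1 _ = refl
      lab-unlabel 2 _ = refl
      lab-unlabel (suc (suc (suc m))) lt = cong skip (trans (cong toℕ (index-vertex T₁ _)) (toℕ-fromℕ< _))

      label-in₁ : ∀ u v → adjℕ (label {T₁} 0 u) (label {T₁} 0 v) ≡ adj u v
      label-in₁ u v = trans (cong (_∨ (Par (label 0 u) (label 0 v) ∨ Par (label 0 v) (label 0 u))) (not-triangle (toℕ (index u)) (toℕ (index v))))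
        (ParentLabelling.adj-parent Par functional T₁ (label 0) (λ e → index-injective (skip-injective e))
          (parentOf-label Par functional T₁ 0 (parAt-chain q 0 _ refl (parAt-spider l ≤-refl)))
          (λ v → cong (λ t → Par (skip t) (label 0 v)) (index-root T₁)) u v)
        where
        not-triangle : ∀ i j → ((skip i <ᵇ 3) ∧ (skip j <ᵇ 3) ∧ not (skip i ≡ᵇ skip j)) ≡ false
        not-triangle zero zero = refl
        not-triangle zero (suc j) = refl
        not-triangle (suc i) j = refl

      isRoot-index : ∀ {T} (u : Vertex T) → isRoot u ≡ (skip (toℕ (index u)) <ᵇ 3)
      isRoot-index {T} u with toℕ (index u) in e
      ... | zero = trans (cong isRoot (index-injective {T} {u} {root T} (trans e (sym (index-root T))))) (isRoot-root T)
      ... | suc i = ¬-not λ t → contradiction (trans (sym e) (trans (cong (toℕ ∘ index) (isRoot⇒root u t)) (index-root T))) λ ()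

      bare : ∀ {k} → (k ≡ 1 ⊎ k ≡ 2) → ∀ u → (∀ v → label {T₁} 0 v ≢ k) →
        adjℕ (label {T₁} 0 u) k ≡ (isRoot u ∧ true)
      bare {k} k≡ u h = trans (cong₂ _∨_ (triangle-edge k≡ (toℕ (index u))) (cong₂ _∨_ no-parent (small k≡)))
        (trans (∨-identityʳ _) (trans (sym (isRoot-index u)) (sym (∧-identityʳ _))))
        where
        triangle-edge : ∀ {k} → (k ≡ 1 ⊎ k ≡ 2) → ∀ i → ((skip i <ᵇ 3) ∧ (k <ᵇ 3) ∧ not (skip i ≡ᵇ k)) ≡ (skip i <ᵇ 3)
        triangle-edge (inj₁ refl) zero = refl
        triangle-edge (inj₂ refl) zero = refl
        triangle-edge (inj₁ refl) (suc i) = refl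
        triangle-edge (inj₂ refl) (suc i) = refl
        small : ∀ {k} → (k ≡ 1 ⊎ k ≡ 2) → Par k (label {T₁} 0 u) ≡ false
        small (inj₁ refl) = refl
        small (inj₂ refl) = refl
        no-parent : Par (label {T₁} 0 u) k ≡ false
        no-parent with isRoot u in e
        ... | true rewrite isRoot⇒root u e | index-root T₁ = refl
        ... | false with ParentLabelling.parent-in Par functional T₁ (label 0) (parentOf-label Par functional T₁ 0 (parAt-chain q 0 _ refl (parAt-spider l ≤-refl))) u e
        ... | w , p = ¬-not λ p′ → h w (functional p p′)

      adjℕ-sym : ∀ a b → adjℕ a b ≡ adjℕ b a
      adjℕ-sym a b = cong₂ _∨_ (triangle-sym (a <ᵇ 3) (b <ᵇ 3) (≡ᵇ-sym a b)) (∨-comm (Par a b) (Par b a))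
        where
        ≡ᵇ-sym : ∀ a b → (a ≡ᵇ b) ≡ (b ≡ᵇ a)
        ≡ᵇ-sym zero zero = refl
        ≡ᵇ-sym zero (suc b) = refl
        ≡ᵇ-sym (suc a) zero = refl
        ≡ᵇ-sym (suc a) (suc b) = ≡ᵇ-sym a b
        triangle-sym : ∀ s t {e e′} → e ≡ e′ → (s ∧ t ∧ not e) ≡ (t ∧ s ∧ not e′)
        triangle-sym true true refl = refl
        triangle-sym true false refl = refl
        triangle-sym false true refl = refl
        triangle-sym false false refl = refl

      edge : ∀ u v → adjℕ (lab u) (lab v) ≡ adjᶜ u v
      edge (in₁ u) (in₁ v) = label-in₁ u v
      edge (in₁ u) (in₂ here) = bare (inj₁ refl) u (λ v → skip≢1 (toℕ (index v)))
      edge (in₁ u) (in₃ here) = bare (inj₂ refl) u (λ v → skip≢2 (toℕ (index v)))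
      edge (in₂ here) (in₁ v) = trans (adjℕ-sym 1 (lab (in₁ v))) (trans (edge (in₁ v) (in₂ here)) (adjᶜ-sym {κ} (in₁ v) (in₂ here)))
      edge (in₂ here) (in₂ here) = refl
      edge (in₂ here) (in₃ here) = refl
      edge (in₃ here) (in₁ v) = trans (adjℕ-sym 2 (lab (in₁ v))) (trans (edge (in₁ v) (in₃ here)) (adjᶜ-sym {κ} (in₁ v) (in₃ here)))
      edge (in₃ here) (in₂ here) = refl
      edge (in₃ here) (in₃ here) = refl

      rep : Rep (U n l q) κ
      rep = record
        { to = λ u → fromℕ< (lab<n u)
        ; from = λ i → unlabel (toℕ i) (toℕ<n i)
        ; to-from = λ i → toℕ-injective (trans (toℕ-fromℕ< _) (lab-unlabel (toℕ i) _))
        ; from-to = λ u → lab-injective _ u (trans (lab-unlabel (toℕ (fromℕ< (lab<n u))) _) (toℕ-fromℕ< _))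
        ; edge = λ u v → trans (cong₂ adjℕ {toℕ (fromℕ< (lab<n u))} {lab u} {toℕ (fromℕ< (lab<n v))} {lab v} (toℕ-fromℕ< _) (toℕ-fromℕ< _)) (edge u v) }

      legsTo-long : ∀ i → i ≤ r → legsTo i ≡ replicate i (suc d′)
      legsTo-long zero _ = refl
      legsTo-long (suc i) lt = cong₂ _∷_ (trans (cong (λ b → d′ + toNat b) (<ᵇ-true lt)) (+-comm d′ 1)) (legsTo-long i (<⇒≤ lt))

      legsTo-short : ∀ k → legsTo (k + r) ≡ replicate k d′ ++ replicate r (suc d′)
      legsTo-short zero = legsTo-long r ≤-refl
      legsTo-short (suc k) = cong₂ _∷_ (trans (cong (λ b → d′ + toNat b) (<ᵇ-false (m≤n+m r k))) (+-identityʳ d′)) (legsTo-short k)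

    -- The legs of U n l q, a leg with m + 1 vertices being listed as m.
    rep-U : ∃[ d ] ∃[ r ] ∃[ s ] ∃[ L ] (Rep (U n l q) (code (chain q (spider L)) • •) ×
      L ↭ replicate r (suc d) ++ replicate (suc s) d × r + suc s ≡ l × q + 3 + (l * suc d + r) ≡ n)
    rep-U = d′ , r , s , legsTo l , rep , subst (_↭ replicate r (suc d′) ++ replicate (suc s) d′) (sym legs) (++-comm (replicate (suc s) d′) (replicate r (suc d′)))
          , trans (+-comm r (suc s)) l≡ , trans (cong (q + 3 +_) (trans (cong (λ t → l * t + r) (sym d≡)) (trans (+-comm _ r) (trans (cong (r +_) (*-comm l d)) (sym (m≡m%n+[m/n]*n N l)))))) n≡
      where
      s = pred (l ∸ r)
      suc-s : suc s ≡ l ∸ r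
      suc-s with l ∸ r | m<n⇒0<n∸m r<l
      ... | suc _ | _ = refl
      l≡ : suc s + r ≡ l
      l≡ = trans (cong (_+ r) suc-s) (m∸n+n≡m (<⇒≤ r<l))
      legs : legsTo l ≡ replicate (suc s) d′ ++ replicate r (suc d′)
      legs = trans (cong legsTo (sym l≡)) (legsTo-short (suc s))

-- Comparison of the graphs `U n l q` for different q.

module BroomComparison where

  open import Defs using (Graph; U; c)
  open import Data.Nat as ℕ using (ℕ; zero; suc; _+_; _*_; _∸_; _≤_; _<_; z≤n; s≤s; NonZero)
  open import Data.Nat.DivMod using (_/_; _%_; [m+kn]%n≡m%n; m<n⇒m%n≡m; m/n*n≤m; m*n/n≡m; /-monoˡ-≤)
  open import Data.Nat.Properties
  open import Data.Nat.Solver using (module +-*-Solver)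
  open import Data.Nat.ListAction using (sum)
  open import Data.Nat.ListAction.Properties using (sum-++)
  open import Data.Integer as ℤ using (+_)
  import Data.Integer.Properties as ℤ
  open import Data.List using ([]; _∷_; _++_; replicate; length)
  open import Data.List.Properties using (length-replicate; length-++; ++-identityʳ)
  open import Data.List.Relation.Binary.Permutation.Propositional using (_↭_; ↭-reflexive; ↭-sym; ↭-trans)
  open import Data.List.Relation.Binary.Permutation.Propositional.Properties using (shift)
  open import Data.Product using (_×_; _,_; proj₁; proj₂)
  open import Data.Sum using (inj₁; inj₂)
  open import Relation.Binary.PropositionalEquality
  open import Relation.Nullary using (contradiction)
  open RootedTree
  open Shapes
  open Representation using (Rep)
  open Isomorphism
  open Counting
  open Membership using (size-rep)
  open BroomLabelling using (rep-U)
  open Positivity using (PositiveSemiring)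

  open CommutativeSemiring S using () renaming (Carrier to Pol)

  Positive : Pol → Set
  Positive p = 0 < value₁ p

  positiveS : PositiveSemiring
  positiveS = record
    { commutativeSemiring = S ; x = x ; Pos = Positive ; pos-x = s≤s z≤n ; pos-1 = s≤s z≤n
    ; pos-+ˡ = λ {p} {q} h → ≤-trans h (m≤m+n (value₁ p) (value₁ q))
    ; pos-+ʳ = λ {p} {q} h → ≤-trans h (m≤n+m (value₁ q) (value₁ p))
    ; pos-* = *-mono-≤ }

  positiveℕ : PositiveSemiring
  positiveℕ = record
    { commutativeSemiring = +-*-commutativeSemiring ; x = 1 ; Pos = 0 <_ ; pos-x = s≤s z≤n ; pos-1 = s≤s z≤n
    ; pos-+ˡ = λ {p} {q} h → ≤-trans h (m≤m+n p q)
    ; pos-+ʳ = λ {p} {q} h → ≤-trans h (m≤n+m q p)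
    ; pos-* = *-mono-≤ }

  module M = Moves positiveS
  module Red = Reduction positiveS
  module N = Moves positiveℕ

  -- At x = 1 the triangle with a tail conducts more than any path.
  path-⊏₁-tail : ∀ d q → N.weight (path d) N.⊏ N.tail q
  path-⊏₁-tail zero q = N.•-⊏-tail q
  path-⊏₁-tail (suc d) (suc q) = N.hang-⊏-tail (path d) q (path-⊏₁-tail d q)
  -- At x = 1 the bare triangle has e = 16 and b = 8, hence conductance 2, while every path has e <
  -- 2b.
  path-⊏₁-tail (suc d) zero = 8 * (2 * b ∸ e) , *-monoʳ-< 8 (m<n⇒0<n∸m e<2b) , (begin
      16 * b                            ≡⟨ *-assoc 8 2 b ⟩
      8 * (2 * b)                       ≡⟨ cong (8 *_) (sym (m+[n∸m]≡n (<⇒≤ e<2b))) ⟩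
      8 * (e + (2 * b ∸ e))             ≡⟨ *-distribˡ-+ 8 e _ ⟩
      8 * e + 8 * (2 * b ∸ e)           ≡⟨ cong (_+ 8 * (2 * b ∸ e)) (*-comm 8 e) ⟩
      e * 8 + 8 * (2 * b ∸ e)           ∎)
    where
    open ≡-Reasoning
    e = N.e (path (suc d))
    b = N.b (path (suc d))
    e<2b : e < 2 * b
    e<2b = +-mono-≤-< (≤-refl {b}) (subst₂ _<_ (sym (*-identityˡ (N.e (path d)))) (sym (trans (+-identityʳ b) (*-identityˡ _)))
      (m<m+n (N.e (path d)) (N.pos-b (path d))))

  value₁-weight : ∀ T → value₁ (M.e T) ≡ N.e T × value₁ (M.b T) ≡ N.b T
  value₁-weight • = refl , refl
  value₁-weight (T ◁ t) with value₁-weight T | value₁-weight t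
  ... | e , b | e′ , b′ = cong₂ _+_ (cong₂ _*_ e (cong₂ _+_ e′ b′)) (cong₂ _*_ b e′) , cong₂ _*_ b (cong₂ _+_ e′ b′)

  value₁-tail : ∀ q → value₁ (M.tailB q) ≡ N.tailB q × value₁ (M.tailE q) ≡ N.tailE q
  value₁-tail zero = refl , refl
  value₁-tail (suc q) with value₁-tail q
  ... | b , e = cong₂ _+_ (cong₂ _+_ (cong (1 *_) b) e) b , cong₂ _+_ (cong (1 *_) b) e

  module _ where
    open CommutativeSemiring S using () renaming (_+_ to _⊹_; _*_ to _∗_)

    -- Only the factors of `E Z` differ, and at x = 1 they compare the triangle side with a path,
    -- which loses whatever its length; no relation between `q` and `d` enters.
    near<far : ∀ q U c d → value₁ (M.P (code (chain q ((U ◁ c) ◁ path (suc d))) • •)) < value₁ (M.P (code (chain (suc q) ((U ◁ c) ◁ path d)) • •))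
    near<far q U c d = subst₂ _<_ (sym (proj₂ (M.P-near q Z d))) (sym (proj₂ (M.P-far q Z d)))
      (+-monoʳ-< (value₁ (M.rest q Z d)) (*-monoʳ-< (value₁ (M.E Z)) {{ℕ.>-nonZero (M.pos-E U c)}} strict))
      where
      Z = U ◁ c
      eb<be : N.e (path (suc d)) * N.tailB q < (1 * N.tailB q + N.tailE q) * N.b (path (suc d))
      eb<be with path-⊏₁-tail (suc d) q
      ... | δ , pδ , h = <-≤-trans (m<m+n _ pδ) (≤-reflexive (sym h))
      strict : value₁ (M.e (path (suc d)) ∗ M.tailB q) < value₁ ((x ∗ M.tailB q ⊹ M.tailE q) ∗ M.b (path (suc d)))
      strict rewrite proj₁ (value₁-weight (path (suc d))) | proj₂ (value₁-weight (path (suc d))) | proj₁ (value₁-tail q) | proj₂ (value₁-tail q) = eb<be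

    coefficient-e₀ : ∀ T → coefficient 0 (M.e T) ≡ 0
    coefficient-e₀ • = refl
    coefficient-e₀ (T ◁ c) rewrite coefficient-e₀ T | coefficient-e₀ c = *-zeroʳ (coefficient 0 (M.b T))

    coefficient-b₀ : ∀ T → coefficient 0 (M.b T) ≡ 1
    coefficient-b₀ • = refl
    coefficient-b₀ (T ◁ c) rewrite coefficient-b₀ T | coefficient-e₀ c | coefficient-b₀ c = refl

    coefficient-e₁ : ∀ T → coefficient 1 (M.e T) ≡ size T
    coefficient-e₁ • = refl
    coefficient-e₁ (T ◁ c) rewrite coefficient-e₀ T | coefficient-e₁ T | coefficient-b₀ T | coefficient-e₀ c | coefficient-b₀ c | coefficient-e₁ c =
      cong₂ _+_ (*-identityʳ (size T)) (trans (cong (_+_ (1 * size c)) (*-zeroʳ (coefficient 1 (M.b T)))) (trans (+-identityʳ _) (*-identityˡ _)))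

    coefficient-E₀ : ∀ T → coefficient 0 (M.E T) ≡ 0
    coefficient-E₀ T = trans (sym (Nx.at (proj₁ (M.e-split T)) 0)) (coefficient-e₀ T)

    coefficient-E₁ : ∀ T → suc (coefficient 1 (M.E T)) ≡ size T
    coefficient-E₁ T = trans (cong (λ t → t + 0 + coefficient 1 (M.E T)) (sym (coefficient-b₀ T))) (trans
      (cong (_+ coefficient 1 (M.E T)) (+-identityʳ (coefficient 0 (M.b T))))
      (trans (cong (_+ coefficient 1 (M.E T)) (sym (+-identityʳ (coefficient 0 (M.b T))))) (trans (sym (Nx.at (proj₁ (M.e-split T)) 1)) (coefficient-e₁ T))))

    -- The 3 counts the spanning trees of the triangle. The linear coefficient of `tailE q` below is
    -- 3 times q + 2, the number of vertices other than the end of the tail.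
    tailB₀ : ∀ q → coefficient 0 (M.tailB q) ≡ 3
    tailE₀ : ∀ q → coefficient 0 (M.tailE q) ≡ 0
    tailB₀ zero = refl
    tailB₀ (suc q) rewrite tailE₀ q | tailB₀ q = refl
    tailE₀ zero = refl
    tailE₀ (suc q) = tailE₀ q

    tailE₁ : ∀ q → coefficient 1 (M.tailE q) ≡ 6 + 3 * q
    tailE₁ zero = refl
    tailE₁ (suc q) rewrite tailB₀ q | tailE₁ q = solve 1 (λ q → con 3 :+ (con 6 :+ con 3 :* q) := con 6 :+ con 3 :* (con 1 :+ q)) refl q
      where open +-*-Solver

    coefficient₂ : ∀ f g → coefficient 0 f ≡ 0 → coefficient 0 g ≡ 0 → coefficient 2 (f ∗ g) ≡ coefficient 1 f * coefficient 1 g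
    coefficient₂ f g f₀ g₀ rewrite f₀ | g₀ = trans (cong (_+_ (coefficient 1 f * coefficient 1 g)) (*-zeroʳ (coefficient 2 f))) (+-identityʳ _)

    coefficient₁ : ∀ f g → coefficient 0 f ≡ 0 → coefficient 1 (f ∗ g) ≡ coefficient 1 f * coefficient 0 g
    coefficient₁ f g f₀ rewrite f₀ = refl

    -- Neither `E Z` nor its two factors have a constant term, so the coefficient of x² is a product
    -- of linear ones. Those of the factors count vertices, three times q + 3 for the triangle with
    -- its tail and three times d + 2 for the path.
    far<near : ∀ q U c d → suc q < d →
      coefficient 2 (M.P (code (chain (suc q) ((U ◁ c) ◁ path d)) • •)) < coefficient 2 (M.P (code (chain q ((U ◁ c) ◁ path (suc d))) • •))
    far<near q U c d lt = subst₂ _<_ (sym (Nx.at (proj₁ (M.P-far q Z d)) 2)) (sym (Nx.at (proj₁ (M.P-near q Z d)) 2))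
      (+-monoʳ-< (coefficient 2 (M.rest q Z d)) (subst₂ _<_ (sym (coefficient₂ (M.E Z) far (coefficient-E₀ Z) far₀)) (sym (coefficient₂ (M.E Z) near (coefficient-E₀ Z) near₀))
        (*-monoʳ-< (coefficient 1 (M.E Z)) {{ℕ.>-nonZero E₁>0}} (subst₂ _<_ (sym far₁) (sym near₁) numbers))))
      where
      Z = U ◁ c
      Y = path (suc d)
      tailX = x ∗ M.tailB q ⊹ M.tailE q
      far = tailX ∗ M.b Y
      near = M.e Y ∗ M.tailB q
      far₀ : coefficient 0 far ≡ 0
      far₀ rewrite tailE₀ q = refl
      near₀ : coefficient 0 near ≡ 0
      near₀ rewrite coefficient-e₀ Y = refl
      far₁ : coefficient 1 far ≡ 9 + 3 * q
      far₁ = trans (coefficient₁ tailX (M.b Y) (tailE₀ q)) (trans (cong₂ _*_ tail₁ (coefficient-b₀ Y)) (*-identityʳ _))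
        where
        tail₁ : coefficient 1 tailX ≡ 9 + 3 * q
        tail₁ rewrite tailB₀ q | tailE₁ q = refl
      near₁ : coefficient 1 near ≡ (2 + d) * 3
      near₁ = trans (coefficient₁ (M.e Y) (M.tailB q) (coefficient-e₀ Y)) (cong₂ _*_ (trans (coefficient-e₁ Y) (size-path (suc d))) (tailB₀ q))
      numbers : 9 + 3 * q < (2 + d) * 3
      numbers = subst (_< (2 + d) * 3) (solve 1 (λ q → (con 3 :+ q) :* con 3 := con 9 :+ con 3 :* q) refl q) (*-monoˡ-< 3 (s≤s (s≤s lt)))
        where open +-*-Solver
      E₁>0 : 0 < coefficient 1 (M.E Z)
      E₁>0 = ≤-pred (≤-trans (+-mono-≤ (size≥1 U) (size≥1 c)) (≤-reflexive (sym (coefficient-E₁ Z))))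
        where
        size≥1 : ∀ T → 1 ≤ size T
        size≥1 • = s≤s z≤n
        size≥1 (T ◁ c) = ≤-trans (size≥1 T) (m≤m+n _ _)

  balanced-sum : ∀ d r s → length (Red.balanced d r s) ≡ r + suc s × length (Red.balanced d r s) + sum (Red.balanced d r s) ≡ (r + suc s) * suc d + r
  balanced-sum d r s = len , trans (cong₂ _+_ len sums)
      (solve 3 (λ d r s → r :+ (con 1 :+ s) :+ (r :* (con 1 :+ d) :+ (con 1 :+ s) :* d) := (r :+ (con 1 :+ s)) :* (con 1 :+ d) :+ r) refl d r s)
    where
    open +-*-Solver
    len : length (Red.balanced d r s) ≡ r + suc s
    len = trans (length-++ (replicate r (suc d))) (cong₂ _+_ (length-replicate r) (length-replicate (suc s)))
    sum-replicate : ∀ k m → sum (replicate k m) ≡ k * m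
    sum-replicate zero m = refl
    sum-replicate (suc k) m = cong (_+_ m) (sum-replicate k m)
    sums : sum (Red.balanced d r s) ≡ r * suc d + suc s * d
    sums = trans (sum-++ (replicate r (suc d)) (replicate (suc s) d)) (cong₂ _+_ (sum-replicate r (suc d)) (sum-replicate (suc s) d))

  division-unique : ∀ l .{{_ : NonZero l}} {d r d′ r′} → r < l → r′ < l → l * d + r ≡ l * d′ + r′ → d ≡ d′ × r ≡ r′
  division-unique l {d} {r} {d′} {r′} r<l r′<l e = *-cancelˡ-≡ d d′ l (+-cancelʳ-≡ r (l * d) (l * d′) (trans e (cong (_+_ (l * d′)) (sym r≡)))) , r≡
    where
    remainder : ∀ {d r} → r < l → (l * d + r) % l ≡ r
    remainder {d} {r} r<l = trans (cong (_% l) (trans (+-comm (l * d) r) (cong (_+_ r) (*-comm l d)))) (trans ([m+kn]%n≡m%n r d l) (m<n⇒m%n≡m r<l))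
    r≡ : r ≡ r′
    r≡ = trans (sym (remainder {d} r<l)) (trans (cong (_% l) e) (remainder {d′} r′<l))

  coefficient-unique : ∀ {n} {G : Graph n} {κ κ′} → Rep G κ → Rep G κ′ → ∀ j → j ≤ n → coefficient j (P κ) ≡ coefficient j (P κ′)
  coefficient-unique {n} {κ = κ} {κ′} rep rep′ j j≤n = subst (λ i → coefficient i (P κ) ≡ coefficient i (P κ′)) (m∸[m∸n]≡n j≤n)
    (ℤ.+-injective (trans (sym (c-rep rep (size-rep rep) (n ∸ j) (m∸n≤m n j))) (c-rep rep′ (size-rep rep′) (n ∸ j) (m∸n≤m n j))))

  coefficients : ∀ {n} {G : Graph n} {κ} → Rep G κ → sumTo n (proj₁ (P κ)) ≡ value₁ (P κ)
  coefficients {n} {κ = κ} rep = subst (λ m → sumTo m (proj₁ (P κ)) ≡ value₁ (P κ)) (size-rep rep) (proj₂ (polynomial-P κ))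

  value-unique : ∀ {n} {G : Graph n} {κ κ′} → Rep G κ → Rep G κ′ → value₁ (P κ) ≡ value₁ (P κ′)
  value-unique {n} rep rep′ = trans (sym (coefficients rep)) (trans (≤-antisym
    (sumTo-mono n (λ j le → ≤-reflexive (coefficient-unique rep rep′ j le)))
    (sumTo-mono n (λ j le → ≤-reflexive (coefficient-unique rep′ rep j le)))) (coefficients rep′))

  module _ (n l : ℕ) .{{_ : NonZero l}} where

    bound : ℕ
    bound = (n ∸ (3 + 2 * l)) / suc l

    module _ (enough : 3 + 2 * l ≤ n) where

      -- The left side equals q + 3 + l (q + 2): triangle, tail and l legs of q + 2 vertices fit
      -- into n vertices.
      within : ∀ {q} → q ≤ bound → q * suc l + (3 + 2 * l) ≤ n
      within {q} le = ≤-trans (+-monoˡ-≤ (3 + 2 * l) (≤-trans (*-monoˡ-≤ (suc l) le) (m/n*n≤m (n ∸ (3 + 2 * l)) (suc l)))) (≤-reflexive (m∸n+n≡m enough))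

      within⁻¹ : ∀ {q} → q * suc l + (3 + 2 * l) ≤ n → q ≤ bound
      within⁻¹ {q} le = ≤-trans (≤-reflexive (sym (m*n/n≡m q (suc l)))) (/-monoˡ-≤ (suc l) (m+n≤o⇒m≤o∸n (q * suc l) le))

      room : ∀ {q} → q ≤ bound → q + 3 + l ≤ n
      room {q} le = ≤-trans (≤-trans (m≤m+n (q + 3 + l) (q * l + l))
        (≤-reflexive (solve 2 (λ q l → q :+ con 3 :+ l :+ (q :* l :+ l) := q :* (con 1 :+ l) :+ (con 3 :+ con 2 :* l)) refl q l))) (within le)
        where open +-*-Solver

      -- Room for l legs of q + 2 vertices means l (q + 2) ≤ l (d + 1) + r, and a remainder below l
      -- cannot make up a further vertex for every leg.
      leg-long : ∀ {q d r} → q ≤ bound → r < l → q + 3 + (l * suc d + r) ≡ n → q < d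
      leg-long {q} {d} {r} le r<l e = ≤-pred (≤-pred (*-cancelˡ-< l (2 + q) (2 + d) (+-cancelˡ-< (q + 3) _ _ (begin-strict
        q + 3 + l * (2 + q)              ≡⟨ solve 2 (λ q l → q :+ con 3 :+ l :* (con 2 :+ q) := q :* (con 1 :+ l) :+ (con 3 :+ con 2 :* l)) refl q l ⟩
        q * suc l + (3 + 2 * l)          ≤⟨ within le ⟩
        n                                ≡⟨ sym e ⟩
        q + 3 + (l * suc d + r)          <⟨ +-monoʳ-< (q + 3) (+-monoʳ-< (l * suc d) r<l) ⟩
        q + 3 + (l * suc d + l)          ≡⟨ solve 3 (λ q l d → q :+ con 3 :+ (l :* (con 1 :+ d) :+ l) := q :+ con 3 :+ l :* (con 2 :+ d)) refl q l d ⟩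
        q + 3 + l * (2 + d)              ∎))))
        where
        open ≤-Reasoning
        open +-*-Solver

      -- Any balanced spider of the right size has the legs of `U n l q` up to order, because
      -- quotient and remainder are unique.
      rep-balanced : ∀ {q d r s} → q ≤ bound → r + suc s ≡ l → q + 3 + (l * suc d + r) ≡ n →
        ∀ {L} → L ↭ Red.balanced d r s → Rep (U n l q) (code (chain q (spider L)) • •)
      rep-balanced {q} {d} {r} {s} le l≡ n≡ {L} p with rep-U n l q (room le)
      ... | d′ , r′ , s′ , L′ , rep , p′ , l≡′ , n≡′ = rep-~ (chain-~ q (spider-↭ (↭-trans p′ (↭-trans same (↭-sym p))))) rep
        where
        less : ∀ {r s} → r + suc s ≡ l → r < l
        less {r} {s} e = <-≤-trans (m<m+n r (s≤s z≤n)) (≤-reflexive e)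
        unique : suc d′ ≡ suc d × r′ ≡ r
        unique = division-unique l (less l≡′) (less l≡) (+-cancelˡ-≡ (q + 3) _ _ (trans n≡′ (sym n≡)))
        s≡ : s′ ≡ s
        s≡ = suc-injective (+-cancelˡ-≡ r′ (suc s′) (suc s) (trans l≡′ (trans (sym l≡) (cong (_+ suc s) (sym (proj₂ unique))))))
        same : Red.balanced d′ r′ s′ ↭ Red.balanced d r s
        same = ↭-reflexive (trans (cong₂ (λ a b → Red.balanced a b s′) (suc-injective (proj₁ unique)) (proj₂ unique)) (cong (Red.balanced d r) s≡))

      -- The two strict inequalities point in opposite directions, which excludes comparability.
      -- They are stated for arbitrary codes, as the graph determines both numbers.
      Separated : ℕ → ℕ → Set
      Separated q q′ = ∀ {κ κ′} → Rep (U n l q) κ → Rep (U n l q′) κ′ →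
        value₁ (P κ) < value₁ (P κ′) × coefficient 2 (P κ′) < coefficient 2 (P κ)

      module _ (2≤l : 2 ≤ l) where

        private
          2≤n : 2 ≤ n
          2≤n = ≤-trans (s≤s (s≤s z≤n)) enough

        -- U n l q arises from U n l (q + 1) by moving the centre towards the triangle and lengthening a shortest leg.
        separated-step : ∀ q → suc q ≤ bound → Separated q (suc q)
        separated-step q le {κ} {κ′} rep rep′ with rep-U n l (suc q) (room le)
        ... | d , r , s , L , repL , p , l≡ , n≡ = conclude r s l≡ n≡ (↭-trans p (shift d (replicate r (suc d)) (replicate s d)))
          where
          conclude : ∀ r s → r + suc s ≡ l → suc q + 3 + (l * suc d + r) ≡ n → L ↭ d ∷ replicate r (suc d) ++ replicate s d →
            value₁ (P κ) < value₁ (P κ′) × coefficient 2 (P κ′) < coefficient 2 (P κ)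
          conclude r s l≡ n≡ p with replicate r (suc d) ++ replicate s d in eq
          -- Removing the short leg `d` leaves another one since l is at least 2.
          ... | [] = contradiction (trans (sym (cong (λ L → suc (length L)) eq)) (trans (cong suc (trans (length-++ (replicate r (suc d))) (cong₂ _+_ (length-replicate r) (length-replicate s)))) (trans (sym (+-suc r s)) l≡)))
                  (λ e → <-irrefl e 2≤l)
          ... | m ∷ ms =
              subst₂ _<_ (value-unique near rep) (value-unique far rep′) (near<far q (spider ms) (path m) d)
            , subst₂ _<_ (coefficient-unique far rep′ 2 2≤n) (coefficient-unique near rep 2 2≤n) (far<near q (spider ms) (path m) d (leg-long le r<l n≡))
            where
            r<l : r < l
            r<l = <-≤-trans (m<m+n r (s≤s z≤n)) (≤-reflexive l≡)
            far : Rep (U n l (suc q)) (code (chain (suc q) ((spider ms ◁ path m) ◁ path d)) • •)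
            far = rep-~ (chain-~ (suc q) (spider-↭ p)) repL
            near : Rep (U n l q) (code (chain q ((spider ms ◁ path m) ◁ path (suc d))) • •)
            near = lengthen s l≡ eq
              where
              q≤ : q ≤ bound
              q≤ = ≤-trans (n≤1+n q) le
              lengthen : ∀ s → r + suc s ≡ l → replicate r (suc d) ++ replicate s d ≡ m ∷ ms → Rep (U n l q) (code (chain q (spider (suc d ∷ m ∷ ms))) • •)
              lengthen (suc s) l≡ eq = rep-balanced q≤ (trans (sym (+-suc r (suc s))) l≡)
                (trans (cong (_+_ (q + 3)) (+-suc (l * suc d) r)) (trans (+-suc (q + 3) _) n≡)) (↭-reflexive (cong (_∷_ (suc d)) (sym eq)))
              -- The only short leg has been lengthened: all legs are now equal, and the pair of
              -- length and remainder becomes `suc d` and 0.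
              lengthen zero l≡ eq = rep-balanced {s = r} q≤ (trans (sym (+-comm r 1)) l≡)
                (trans (cong (λ t → q + 3 + (t * suc (suc d) + 0)) (sym l≡)) (trans
                  (solve 3 (λ q r d → q :+ con 3 :+ ((r :+ con 1) :* (con 2 :+ d) :+ con 0) := con 1 :+ q :+ con 3 :+ ((r :+ con 1) :* (con 1 :+ d) :+ r)) refl q r d)
                  (trans (cong (λ t → suc q + 3 + (t * suc d + r)) l≡) n≡)))
                (↭-reflexive (cong (_∷_ (suc d)) (trans (sym eq) (++-identityʳ _))))
                where open +-*-Solver

        separated : ∀ {q q′} → q < q′ → q′ ≤ bound → Separated q q′
        separated {q} {suc q′} (s≤s q≤q′) le rep rep′ with m≤n⇒m<n∨m≡n q≤q′
        ... | inj₂ refl = separated-step q le rep rep′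
        ... | inj₁ q<q′ = <-trans (proj₁ lower) (proj₁ upper) , <-trans (proj₂ upper) (proj₂ lower)
          where
          q′≤ = ≤-trans (n≤1+n q′) le
          mid = proj₁ (proj₂ (proj₂ (proj₂ (proj₂ (rep-U n l q′ (room q′≤))))))
          lower = separated q<q′ q′≤ rep mid
          upper = separated-step q′ le mid rep′

-- The minimal elements.

open import Defs
open import Data.Empty using (⊥; ⊥-elim)
open import Data.Nat as ℕ using (ℕ; zero; suc; _+_; _*_; _∸_; _≤_; _<_; z≤n; s≤s; NonZero)
open import Data.Nat.DivMod using (_/_)
open import Data.Nat.Induction using (Acc; acc; <-wellFounded)
open import Data.Nat.Properties
open import Data.Nat.Solver using (module +-*-Solver)
open import Data.Nat.ListAction using (sum)
open import Data.Nat.ListAction.Properties using (sum-↭)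
open import Data.Integer as ℤ using (+_)
import Data.Integer.Properties as ℤ
open import Data.List using (List; []; _∷_; _++_; replicate; length)
open import Data.List.Relation.Binary.Permutation.Propositional using (_↭_; ↭-trans)
open import Data.List.Relation.Binary.Permutation.Propositional.Properties using (↭-length; shift)
open import Data.Product using (_×_; _,_; proj₁; proj₂; ∃-syntax)
open import Data.Sum using (_⊎_; inj₁; inj₂)
open import Relation.Binary.Definitions using (tri<; tri≈; tri>)
open import Relation.Binary.PropositionalEquality
open import Relation.Nullary using (¬_; yes; no; contradiction)
open RootedTree
open Shapes
open Representation using (Rep)
open Isomorphism
open Counting
open Membership using (size-rep; leaves-rep; 𝒰-rep; graphOf; rep-graphOf)
open Decoding using (decode)
open BroomLabelling using (rep-U)
open BroomComparison
open M using (Improvesᶜ; improves-t₁; improves-swap₁₂; improves-swap₂₃; unite) renaming (_≺_ to _⊰_)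
open Improvesᶜ

coefficients-≤ : ∀ {p q} → p ⊰ q → ∀ j → coefficient j p ≤ coefficient j q
coefficients-≤ {p} (r , _ , e) j = ≤-trans (m≤m+n (coefficient j p) (coefficient j r)) (≤-reflexive (sym (Nx.at (proj₁ e) j)))

value-< : ∀ {p q} → p ⊰ q → value₁ p < value₁ q
value-< {p} (r , pr , e) = <-≤-trans (m<m+n (value₁ p) pr) (≤-reflexive (sym (proj₂ e)))

module _ {n : ℕ} where

  c-mono : ∀ {G H : Graph n} {κ κ′} → Rep G κ → Rep H κ′ → (∀ j → coefficient j (P κ′) ≤ coefficient j (P κ)) → H ⪯ G
  c-mono rep rep′ h k k≤n = subst₂ ℤ._≤_ (sym (c-rep rep′ (size-rep rep′) k k≤n)) (sym (c-rep rep (size-rep rep) k k≤n)) (ℤ.+≤+ (h (n ∸ k)))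

  c-mono⁻¹ : ∀ {G H : Graph n} {κ κ′} → Rep G κ → Rep H κ′ → H ⪯ G → ∀ j → j ≤ n → coefficient j (P κ′) ≤ coefficient j (P κ)
  c-mono⁻¹ {κ = κ} {κ′} rep rep′ h j j≤n = subst (λ i → coefficient i (P κ′) ≤ coefficient i (P κ)) (m∸[m∸n]≡n j≤n)
    (ℤ.drop‿+≤+ (subst₂ ℤ._≤_ (c-rep rep′ (size-rep rep′) (n ∸ j) (m∸n≤m n j)) (c-rep rep (size-rep rep) (n ∸ j) (m∸n≤m n j)) (h (n ∸ j) (m∸n≤m n j))))

  -- All coefficients are weakly smaller, and the strict drop of their sum, the value at x = 1,
  -- locates one that is strictly smaller.
  c-strict : ∀ {G H : Graph n} {κ κ′} → Rep G κ → Rep H κ′ → P κ′ ⊰ P κ → H ≺ G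
  c-strict {G} {H} {κ} {κ′} rep rep′ lt with sumTo-strict n (coefficients-≤ lt) (subst₂ _<_ (sym (coefficients rep′)) (sym (coefficients rep)) (value-< lt))
  ... | j , j≤n , lt′ = c-mono rep rep′ (coefficients-≤ lt) , n ∸ j , m∸n≤m n j ,
    subst₂ ℤ._<_ (sym (c-rep rep′ (size-rep rep′) (n ∸ j) (m∸n≤m n j))) (sym (c-rep rep (size-rep rep) (n ∸ j) (m∸n≤m n j)))
      (ℤ.+<+ (subst (λ i → coefficient i (P κ′) < coefficient i (P κ)) (sym (m∸[m∸n]≡n j≤n)) lt′))

realize : ∀ {n} κ → sizeᶜ κ ≡ n → ∃[ G ] Rep {n} G κ
realize κ refl = graphOf κ , rep-graphOf κ

module _ (n l : ℕ) .{{_ : NonZero l}} (2≤l : 2 ≤ l) (enough : 3 + 2 * l ≤ n) where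

  Reducible : Code → Set
  Reducible κ = ∃[ κ′ ] Improvesᶜ κ′ κ

  Optimal : Code → Set
  Optimal κ = ∃[ q ] (q ≤ bound n l × Rep (U n l q) κ)

  private
    p : ℕ
    p = bound n l

    leaves-broom : ∀ q m ms → leaves (chain q (spider (m ∷ ms))) ≡ suc (length ms)
    leaves-broom zero m ms = leaves-spider (m ∷ ms)
    leaves-broom (suc q) m ms = trans (leavesHung-chain q (spider (m ∷ ms))) (leaves-spider (m ∷ ms))

    leaves-path : ∀ m → leaves (path m) ≤ 1
    leaves-path zero = z≤n
    leaves-path (suc m) = ≤-reflexive (leavesHung-path m)

    -- The threshold is met exactly: q ≤ p identifies the graph as `U n l q`, while q > p leaves no
    -- room for l legs of q + 2 vertices, so the shortest leg has d ≤ q and `M.shift` applies. The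
    -- latter cannot happen for q = 0.
    broom : ∀ q m m′ ms d r s → (m ∷ m′ ∷ ms) ↭ Red.balanced d r s → suc (suc (length ms)) ≡ l →
      size (chain q (spider (m ∷ m′ ∷ ms))) + 2 ≡ n →
      let κ = code (chain q (spider (m ∷ m′ ∷ ms))) • • in Reducible κ ⊎ Optimal κ
    broom q m m′ ms d r s perm len≡ size≡ = decide (q ≤? p)
      where
      L : List ℕ
      L = m ∷ m′ ∷ ms
      r+s≡l : r + suc s ≡ l
      r+s≡l = trans (sym (proj₁ (balanced-sum d r s))) (trans (sym (↭-length perm)) len≡)
      n≡ : q + 3 + (l * suc d + r) ≡ n
      n≡ = begin
        q + 3 + (l * suc d + r)                     ≡⟨ cong (λ t → q + 3 + (t * suc d + r)) (sym r+s≡l) ⟩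
        q + 3 + ((r + suc s) * suc d + r)           ≡⟨ cong (_+_ (q + 3)) (sym (proj₂ (balanced-sum d r s))) ⟩
        q + 3 + (length (Red.balanced d r s) + sum (Red.balanced d r s))  ≡⟨ cong (_+_ (q + 3)) (sym (cong₂ _+_ (↭-length perm) (sum-↭ perm))) ⟩
        q + 3 + (length L + sum L)                  ≡⟨ solve 2 (λ q t → q :+ con 3 :+ t := q :+ (con 1 :+ t) :+ con 2) refl q (length L + sum L) ⟩
        q + suc (length L + sum L) + 2              ≡⟨ cong (_+ 2) (trans (cong (_+_ q) (sym (size-spider L))) (sym (size-chain q (spider L)))) ⟩
        size (chain q (spider L)) + 2               ≡⟨ size≡ ⟩
        n                                           ∎
        where
        open ≡-Reasoning
        open +-*-Solver
      leg-short : ¬ q ≤ p → d ≤ q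
      leg-short q≰p = ≤-pred (≤-pred (*-cancelˡ-< l (suc d) (2 + q) (+-cancelˡ-< (q + 3) _ _ (begin-strict
        q + 3 + l * suc d                ≤⟨ +-monoʳ-≤ (q + 3) (m≤m+n (l * suc d) r) ⟩
        q + 3 + (l * suc d + r)          ≡⟨ n≡ ⟩
        n                                <⟨ ≰⇒> (λ le → q≰p (within⁻¹ n l enough le)) ⟩
        q * suc l + (3 + 2 * l)          ≡⟨ solve 2 (λ q l → q :* (con 1 :+ l) :+ (con 3 :+ con 2 :* l) := q :+ con 3 :+ l :* (con 2 :+ q)) refl q l ⟩
        q + 3 + l * (2 + q)              ∎))))
        where
        open ≤-Reasoning
        open +-*-Solver
      rest : List ℕ
      rest = replicate r (suc d) ++ replicate s d
      perm′ : L ↭ d ∷ rest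
      perm′ = ↭-trans perm (shift d (replicate r (suc d)) (replicate s d))
      shifted : ∀ k rest → L ↭ d ∷ rest → d ≤ suc k → Reducible (code (chain (suc k) (spider L)) • •)
      shifted k [] perm _ = contradiction (↭-length perm) λ ()
      shifted k (y ∷ ys) perm d≤ = _ , Red.improvesᶜ-~ (chain-~ (suc k) (spider-↭ perm)) (M.shift k (spider ys) (path y) d d≤)
      far : ∀ k → k ≡ q → ¬ q ≤ p → Reducible (code (chain q (spider L)) • •)
      far zero refl q≰p = contradiction z≤n q≰p
      far (suc k) refl q≰p = shifted k rest perm′ (leg-short q≰p)
      decide : _ → Reducible (code (chain q (spider L)) • •) ⊎ Optimal (code (chain q (spider L)) • •)
      decide (yes q≤p) = inj₂ (q , q≤p , rep-balanced n l enough q≤p r+s≡l n≡ perm)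
      decide (no q≰p) = inj₁ (far q refl q≰p)

    single : ∀ T → size T + 2 ≡ n → leaves T ≡ l → Reducible (code T • •) ⊎ Optimal (code T • •)
    single T size≡ leaves≡ with Red.reduce T
    ... | inj₂ (T′ , i) = inj₁ (_ , improves-t₁ • • i)
    ... | inj₁ (Red.isPath m) = contradiction (≤-trans 2≤l (≤-trans (≤-reflexive (sym leaves≡)) (leaves-path m))) λ { (s≤s ()) }
    ... | inj₁ (Red.isSpider q m m′ ms) with Red.reduceᶜ q m m′ ms
    ... | inj₁ better = inj₁ better
    ... | inj₂ (d , r , s , perm) = broom q m m′ ms d r s perm (trans (sym (leaves-broom q m (m′ ∷ ms))) leaves≡) size≡

    swapped₁₂ : ∀ {T V W} → Reducible (code V T W) ⊎ Optimal (code V T W) → Reducible (code T V W) ⊎ Optimal (code T V W)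
    swapped₁₂ (inj₁ (κ , i)) = inj₁ (κ , improves-swap₁₂ i)
    swapped₁₂ (inj₂ (q , le , rep)) = inj₂ (q , le , rep-swap₁₂ rep)

    swapped₂₃ : ∀ {T V W} → Reducible (code T W V) ⊎ Optimal (code T W V) → Reducible (code T V W) ⊎ Optimal (code T V W)
    swapped₂₃ (inj₁ (κ , i)) = inj₁ (κ , improves-swap₂₃ i)
    swapped₂₃ (inj₂ (q , le , rep)) = inj₂ (q , le , rep-swap₂₃ rep)

  -- Two occupied triangle vertices are handled by `unite`. With at most one occupied, the normal
  -- form of its tree decides, the path being excluded by its leaf count.
  classify : ∀ κ → sizeᶜ κ ≡ n → leavesᶜ κ ≡ l → Reducible κ ⊎ Optimal κ
  classify (code (T ◁ t) (V ◁ v) W) _ _ = inj₁ (_ , unite T t V v W)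
  classify (code (T ◁ t) • (W ◁ w)) _ _ = swapped₂₃ (inj₁ (_ , unite T t W w •))
  classify (code • (V ◁ v) (W ◁ w)) _ _ = swapped₁₂ (swapped₂₃ (inj₁ (_ , unite V v W w •)))
  classify (code T@(_ ◁ _) • •) size≡ leaves≡ = single T size≡ (trans (sym (+-identityʳ (leaves T))) leaves≡)
  classify (code • T@(_ ◁ _) •) size≡ leaves≡ = swapped₁₂ (single T (trans (+-comm (size T) 2) (trans (cong suc (+-comm 1 (size T))) size≡)) (trans (sym (+-identityʳ (leaves T))) leaves≡))
  classify (code • • T@(_ ◁ _)) size≡ leaves≡ = swapped₂₃ (swapped₁₂ (single T (trans (+-comm (size T) 2) size≡) leaves≡))
  classify (code • • •) size≡ leaves≡ = single • size≡ leaves≡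

  -- Each improvement lowers the value at x = 1, a natural number, so the descent stops, and
  -- `classify` lets it stop only at some `U n l q`. The coefficientwise inequalities compose along
  -- the way.
  below : ∀ κ → sizeᶜ κ ≡ n → leavesᶜ κ ≡ l →
    ∃[ q ] ∃[ κ′ ] (q ≤ p × Rep (U n l q) κ′ × ∀ j → coefficient j (P κ′) ≤ coefficient j (P κ))
  below κ = descend κ (<-wellFounded (value₁ (P κ)))
    where
    descend : ∀ κ → Acc _<_ (value₁ (P κ)) → sizeᶜ κ ≡ n → leavesᶜ κ ≡ l →
      ∃[ q ] ∃[ κ′ ] (q ≤ p × Rep (U n l q) κ′ × ∀ j → coefficient j (P κ′) ≤ coefficient j (P κ))
    descend κ (acc smaller) size≡ leaves≡ with classify κ size≡ leaves≡
    ... | inj₂ (q , q≤p , rep) = q , κ , q≤p , rep , λ _ → ≤-refl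
    ... | inj₁ (κ′ , i) with descend κ′ (smaller (value-< (P≺ i))) (trans (sizeᶜ≡ i) size≡) (trans (leavesᶜ≡ i) leaves≡)
    ... | q , κ″ , q≤p , rep , h = q , κ″ , q≤p , rep , λ j → ≤-trans (h j) (coefficients-≤ (P≺ i) j)

  leaves-𝒰 : ∀ {G κ} → Rep G κ → 𝒰 n l 3 G → leavesᶜ κ ≡ l
  leaves-𝒰 rep (_ , _ , _ , leaves≡ , _) = trans (sym (leaves-rep rep)) leaves≡

  repU : ∀ {q} → q ≤ p → ∃[ κ ] (Rep (U n l q) κ × leavesᶜ κ ≡ l)
  repU {q} q≤p with rep-U n l q (room n l enough q≤p)
  ... | d , r , s , L , rep , perm , l≡ , _ = _ , rep , trans (+-identityʳ _) (trans (leaves-any L (↭-length perm)) (trans (proj₁ (balanced-sum d r s)) l≡))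
    where
    leaves-any : ∀ L → length L ≡ length (Red.balanced d r s) → leaves (chain q (spider L)) ≡ length (Red.balanced d r s)
    leaves-any [] e = contradiction (trans e (trans (proj₁ (balanced-sum d r s)) (+-suc r s))) λ ()
    leaves-any (m ∷ ms) e = trans (leaves-broom q m ms) e

  -- If q < q′ the coefficient of x² contradicts the assumed inequality; if q > q′ the sum of all
  -- coefficients does, being the value at x = 1.
  incomparable : ∀ {q q′ κ κ′} → q ≤ p → q′ ≤ p → Rep (U n l q) κ → Rep (U n l q′) κ′ →
    (∀ j → j ≤ n → coefficient j (P κ) ≤ coefficient j (P κ′)) → q ≡ q′
  incomparable {q} {q′} {κ} {κ′} le le′ rep rep′ h with <-cmp q q′
  ... | tri≈ _ q≡q′ _ = q≡q′
  ... | tri< q<q′ _ _ = contradiction (proj₂ (separated n l enough 2≤l q<q′ le′ rep rep′)) (≤⇒≯ (h 2 (≤-trans (s≤s (s≤s z≤n)) enough)))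
  ... | tri> _ _ q>q′ = contradiction (proj₁ (separated n l enough 2≤l q>q′ le rep′ rep))
          (≤⇒≯ (subst₂ _≤_ (coefficients rep) (coefficients rep′) (sumTo-mono n h)))

  -- A graph `H` strictly below `U n l q` would itself lie above some `U n l q′`. Incomparability
  -- forces q′ = q, and then `H` is both strictly below and above the same graph.
  U-minimal : ∀ q → q ≤ p → Minimal (𝒰 n l 3) (U n l q)
  U-minimal q q≤p with repU q≤p
  ... | κ , rep , leaves≡ = subst (λ l → 𝒰 n l 3 (U n _ q)) leaves≡ (𝒰-rep rep) , λ H H∈𝒰 H≺U → beaten H H∈𝒰 H≺U (decode H∈𝒰)
    where
    beaten : ∀ H → 𝒰 n l 3 H → H ≺ U n l q → ∃[ κ ] Rep H κ → ⊥
    beaten H H∈𝒰 (H⪯U , k , k≤n , lt) (κ₁ , rep₁) with below κ₁ (size-rep rep₁) (leaves-𝒰 rep₁ H∈𝒰)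
    ... | q′ , κ′ , q′≤p , rep′ , h with incomparable q′≤p q≤p rep′ rep (λ j j≤n → ≤-trans (h j) (c-mono⁻¹ rep rep₁ H⪯U j j≤n))
    ... | refl = ℤ.<-irrefl refl (ℤ.<-≤-trans lt (c-mono rep₁ rep′ h k k≤n))

  -- An improved code is again the code of a graph on n vertices with l leaves, so a minimal graph
  -- can only fall into the other alternative of `classify`.
  minimal-U : ∀ G → Minimal (𝒰 n l 3) G → ∃[ q ] (q ≤ p × Iso G (U n l q))
  minimal-U G (G∈𝒰 , minimal) with decode G∈𝒰
  ... | κ , rep with classify κ (size-rep rep) (leaves-𝒰 rep G∈𝒰)
  ... | inj₂ (q , q≤p , repU) = q , q≤p , rep-iso rep repU
  ... | inj₁ (κ′ , i) with realize κ′ (trans (sizeᶜ≡ i) (size-rep rep))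
  ... | H , rep′ = ⊥-elim (minimal H (subst (λ l → 𝒰 n l 3 H) (trans (leavesᶜ≡ i) (leaves-𝒰 rep G∈𝒰)) (𝒰-rep rep′)) (c-strict rep rep′ (P≺ i)))

  U-distinct : ∀ q q′ → q ≤ p → q′ ≤ p → Iso (U n l q) (U n l q′) → q ≡ q′
  U-distinct q q′ q≤p q′≤p iso with repU q≤p
  ... | κ , rep , _ = incomparable q≤p q′≤p rep (iso-rep iso rep) (λ _ _ → ≤-refl)

-- The third clause is what turns the list into exactly p + 1 elements up to isomorphism. The bound
-- 3 + 2 l ≤ n keeps the truncated subtraction genuine, so that the quotient is p ≥ 0. For a single
-- leaf all `U n 1 q` with room for a leg coincide, a triangle with one pendant path, hence 2 ≤ l.
theorem4p3 : ∀ (n l : ℕ) .{{_ : NonZero l}} → 2 ≤ l → 3 + 2 * l ≤ n →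
    ((∀ q → q ≤ (n ∸ (3 + 2 * l)) / suc l → Minimal (𝒰 n l 3) (U n l q))
    × (∀ G → Minimal (𝒰 n l 3) G →
    ∃[ q ] (q ≤ (n ∸ (3 + 2 * l)) / suc l × Iso G (U n l q)))
    × (∀ q q′ → q ≤ (n ∸ (3 + 2 * l)) / suc l → q′ ≤ (n ∸ (3 + 2 * l)) / suc l →
    Iso (U n l q) (U n l q′) → q ≡ q′))
theorem4p3 n l 2≤l enough = U-minimal n l 2≤l enough , minimal-U n l 2≤l enough , U-distinct n l 2≤l enough
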